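{- If $n\ge5$ is square-free and $n\equiv1\pmod 4$, then there are polynomials $E_n(s,t),F_n(s,t)\in\mathbb{Z}[s,t]$ such that $$4P_n(s,t)=E_n^2(s,t)-n\,t^2F_n^2(s,t),$$ with $\mathrm{sdeg}\,E_n=\phi(n)/2$ and $\mathrm{sdeg}\,F_n=\phi(n)/2-2$.
   Context: Let $\Phi_n(q)$ be the $n$th cyclotomic polynomial and $\phi$ the Euler totient function. For $n\ge 2$, $\Phi_n(q)$ is palindromic of degree $\phi(n)$ with constant term $1$, so there are unique complex numbers $\gamma_j$ with $\Phi_n(q)=\sum_{0\le j\le \phi(n)/2}\gamma_j q^j(1+q)^{\phi(n)-2j}$; the $n$th Lucas atom is $P_n(s,t)=\sum_j \gamma_j s^{\phi(n)-2j}(-t)^j$. For $f\in\mathbb{C}[s,t]$, $\mathrm{sdeg}\,f$ denotes the largest power of $s$ occurring in $f$. -}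

module Defs where

open import Data.Nat as ℕ using (ℕ; zero; suc; _≤_; _<_; _∸_; _%_)
open import Data.Nat.Divisibility using (_∣_; _∣?_)
open import Data.Nat.GCD using (gcd)
open import Data.Nat.Primality using (Prime)
open import Data.Integer as ℤ using (ℤ; +_; -_)
open import Data.List using (List; []; _∷_; foldr; map; filter; length; upTo; applyUpTo)
open import Data.Product using (_×_; ∃)
open import Relation.Binary.PropositionalEquality using (_≡_; _≢_)
open import Relation.Nullary using (¬_)

Σ≤ : ℕ → (ℕ → ℤ) → ℤ
Σ≤ zero    f = f 0
Σ≤ (suc n) f = Σ≤ n f ℤ.+ f (suc n)

totient : ℕ → ℕ
totient n = length (filter (λ k → gcd k n ℕ.≟ 1) (applyUpTo suc n))

SquareFree : ℕ → Set
SquareFree n = ∀ p → Prime p → ¬ (p ℕ.* p ∣ n)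

-- divisors of n (for n ≥ 1): the d ∈ {0,…,n} with d ∣ n
divisors : ℕ → List ℕ
divisors n = filter (λ d → d ∣? n) (upTo (suc n))

-- Univariate polynomials ℤ[q], represented by coefficient functions
-- (f i = coefficient of q^i); equality is coefficientwise.

Poly₁ : Set
Poly₁ = ℕ → ℤ

IsPoly₁ : Poly₁ → Set
IsPoly₁ f = ∃ λ N → ∀ i → N ≤ i → f i ≡ + 0

_≈₁_ : Poly₁ → Poly₁ → Set
f ≈₁ g = ∀ i → f i ≡ g i

const₁ : ℤ → Poly₁
const₁ c zero    = c
const₁ c (suc _) = + 0

one₁ : Poly₁
one₁ = const₁ (+ 1)

q₁ : Poly₁
q₁ (suc zero) = + 1
q₁ _          = + 0

_+₁_ : Poly₁ → Poly₁ → Poly₁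
(f +₁ g) i = f i ℤ.+ g i

_-₁_ : Poly₁ → Poly₁ → Poly₁
(f -₁ g) i = f i ℤ.- g i

_*₁_ : Poly₁ → Poly₁ → Poly₁
(f *₁ g) i = Σ≤ i (λ a → f a ℤ.* g (i ∸ a))

_^₁_ : Poly₁ → ℕ → Poly₁
f ^₁ zero  = one₁
f ^₁ suc k = f *₁ (f ^₁ k)

Σ₁ : ℕ → (ℕ → Poly₁) → Poly₁
Σ₁ n F i = Σ≤ n (λ j → F j i)

-- Cyclotomic polynomials: Φ is the (unique) family of integer polynomials
-- with  ∏_{d ∣ n} Φ_d(q) = q^n - 1  for every n ≥ 1.

IsCyclotomicFamily : (ℕ → Poly₁) → Set
IsCyclotomicFamily Φ =
  (∀ n → IsPoly₁ (Φ n)) ×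
  (∀ n → 1 ≤ n → foldr _*₁_ one₁ (map Φ (divisors n)) ≈₁ ((q₁ ^₁ n) -₁ one₁))

-- Bivariate polynomials ℤ[s,t]:  f i j = coefficient of s^i t^j.

Poly₂ : Set
Poly₂ = ℕ → ℕ → ℤ

IsPoly₂ : Poly₂ → Set
IsPoly₂ f = ∃ λ N → ∀ i j → (N ≤ i → f i j ≡ + 0) × (N ≤ j → f i j ≡ + 0)

_≈₂_ : Poly₂ → Poly₂ → Set
f ≈₂ g = ∀ i j → f i j ≡ g i j

const₂ : ℤ → Poly₂
const₂ c zero zero = c
const₂ c _    _    = + 0

one₂ : Poly₂
one₂ = const₂ (+ 1)

s₂ : Poly₂
s₂ (suc zero) zero = + 1
s₂ _          _    = + 0

t₂ : Poly₂
t₂ zero (suc zero) = + 1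
t₂ _    _          = + 0

_+₂_ : Poly₂ → Poly₂ → Poly₂
(f +₂ g) i j = f i j ℤ.+ g i j

_-₂_ : Poly₂ → Poly₂ → Poly₂
(f -₂ g) i j = f i j ℤ.- g i j

neg₂ : Poly₂ → Poly₂
neg₂ f i j = ℤ.- f i j

_*₂_ : Poly₂ → Poly₂ → Poly₂
(f *₂ g) i j = Σ≤ i (λ a → Σ≤ j (λ b → f a b ℤ.* g (i ∸ a) (j ∸ b)))

_^₂_ : Poly₂ → ℕ → Poly₂
f ^₂ zero  = one₂
f ^₂ suc k = f *₂ (f ^₂ k)

Σ₂ : ℕ → (ℕ → Poly₂) → Poly₂
Σ₂ n F i j = Σ≤ n (λ k → F k i j)

SDeg : Poly₂ → ℕ → Set
SDeg f d = (∃ λ j → f d j ≢ + 0) × (∀ i j → d < i → f i j ≡ + 0)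

IsLucasCoeffs : (ℕ → Poly₁) → ℕ → (ℕ → ℤ) → Set
IsLucasCoeffs Φ n γ =
  Φ n ≈₁ Σ₁ (totient n ℕ./ 2)
            (λ j → const₁ (γ j) *₁ ((q₁ ^₁ j) *₁ ((one₁ +₁ q₁) ^₁ (totient n ∸ 2 ℕ.* j))))

LucasAtom : ℕ → (ℕ → ℤ) → Poly₂
LucasAtom n γ =
  Σ₂ (totient n ℕ./ 2)
     (λ j → const₂ (γ j) *₂ ((s₂ ^₂ (totient n ∸ 2 ℕ.* j)) *₂ (neg₂ t₂ ^₂ j)))

{-# OPTIONS --safe #-}
module Submission where

-- With y = q / (1 + q)², the expansion of Φ_n says Σ γ_j y^j = ∏ (1 - λ_a y), where x is a primitive n-th root of
-- unity, λ_a = 2 + x^a + x^-a, and a runs over the units modulo n up to sign.  Since n ≡ 1 (mod 4), the Jacobi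
-- symbol χ modulo n is even, so the product splits as Γ₁ Γ₋₁ according to the sign of χ(a).  The Galois group fixes
-- the coefficients of Γ₁ + Γ₋₁ and acts through χ on those of Γ₁ - Γ₋₁.  As n is square-free, the primitive roots of
-- unity form a normal basis of ℤ[x]; hence Γ₁ + Γ₋₁ = A and Γ₁ - Γ₋₁ = B τ with integral A and B, τ being the
-- Gauss sum of χ.  Now τ² = n gives 4 γ = A² - n B², and E = Σ A_j s^(d-2j) (-t)^j, t F = Σ B_j s^(d-2j) (-t)^j with
-- d = φ(n)/2.  Finally A_0 = 2, B_0 = 0 and B_1 = -1 give the degrees in s.
--
-- ℤ[x] is realised as ℤ[ℤ/n] modulo the annihilator of a suitable function Ψ on ℤ/n, which is torsion-free by
-- construction.

open import Defs
import Level
open import Algebra using (CommutativeRing)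
import Algebra.Solver.Ring
import Algebra.Solver.Ring.AlmostCommutativeRing as ACR
open import Data.Integer as ℤ using (ℤ; +_)
open import Data.Integer.DivMod using (_%ℕ_; _/ℕ_; n%ℕd<d; a≡a%ℕn+[a/ℕn]*n)
open import Data.Integer.Divisibility.Signed
  using (_∣_; divides; _∣?_; ∣ᵤ⇒∣; ∣⇒∣ᵤ; ∣-refl; ∣-trans; ∣m⇒∣m*n; ∣n⇒∣m*n; ∣m∣n⇒∣m+n)
import Data.Integer.Properties as ℤₚ
open import Data.Integer.Tactic.RingSolver using (solve-∀)
open import Data.List using (List; []; _∷_; _++_; map; filter; foldr; length; upTo; applyUpTo)
open import Data.List.Membership.Propositional using (_∈_; find)
import Data.List.Membership.Propositional.Properties as ∈ₚ
import Data.List.Membership.Propositional.Properties.WithK as ∈ₚK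
import Data.List.Properties as Listₚ
open import Data.List.Relation.Binary.BagAndSetEquality using (∼bag⇒↭)
open import Data.List.Relation.Binary.Permutation.Propositional as ↭ using (_↭_)
import Data.List.Relation.Binary.Permutation.Propositional.Properties as ↭ₚ
open import Data.List.Relation.Unary.All as All using (All; []; _∷_)
import Data.List.Relation.Unary.All.Properties as Allₚ
open import Data.List.Relation.Unary.AllPairs using (AllPairs; []; _∷_)
open import Data.List.Relation.Unary.Any using (here; there)
open import Data.List.Relation.Unary.Unique.Propositional using (Unique)
import Data.List.Relation.Unary.Unique.Propositional.Properties as Uniqueₚ
open import Data.Maybe using (Maybe; just; nothing)
open import Data.Nat as ℕ using (ℕ; zero; suc; _≤_; _<_; z≤n; s≤s; _%_; _/_; _∸_)
open import Data.Nat.Coprimality using (Coprime; coprime-Bézout)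
import Data.Nat.Divisibility as ℕ∣
open import Data.Nat.DivMod using (m*n/n≡m; m≡m%n+[m/n]*n)
open import Data.Nat.GCD as GCD using (gcd; module Bézout)
open import Data.Nat.Induction using (<-rec)
open import Data.Nat.ListAction using (product)
import Data.Nat.ListAction.Properties as ListAction
open import Data.Nat.Primality as Prime using (Prime)
open import Data.Nat.Primality.Factorisation using (factorise; PrimeFactorisation)
import Data.Nat.Properties as ℕₚ
import Data.Nat.Tactic.RingSolver as ℕ-Ring
open import Data.Product using (Σ; _×_; ∃; _,_; proj₁; proj₂)
open import Data.Sum using (_⊎_; inj₁; inj₂)
open import Function using (mk⇔; _∘_; id)
open import Relation.Binary using (IsEquivalence)
open import Relation.Binary.PropositionalEquality as ≡ using (_≡_; _≢_; refl; cong; cong₂; subst)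
import Relation.Binary.Reasoning.Setoid as SetoidReasoning
open import Relation.Nullary using (¬_; Dec; yes; no; contradiction)

-- The obstacle is division: roots have to be split off in a ring that may have zero divisors. It is
-- overcome by one fact: x^c - 1 can be cancelled whenever n does not divide c. This cancels the
-- factors Φ_d(x^a), d < n, of x^(an) - 1 = 0, which leaves Φ_n(x^a) = 0; and since λ_b - λ_a = x^-b
-- (x^(b-a) - 1)(x^(b+a) - 1), it makes the differences of the λ_a cancellable, which is what
-- factoring a polynomial by its roots requires. The Galois action x ↦ x^u is followed on
-- representatives in ℤ[ℤ/n], where it permutes coefficients. Integrality is explicit: descent
-- returns as multiplier a coefficient of the representative once that has been made to vanish off
-- the units. For the trivial character the multiplier stands before the sum of the primitive roots,
-- which is ±1; for χ it stands before τ. Primitivity of χ, that is, for each p a unit that is 1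
-- modulo n/p and has χ = -1, is what makes x ↦ x^b multiply τ by χ(b) even for b not prime to n;
-- the evaluation of τ² uses all b.

record ℤAlgebra c ℓ : Set (Level.suc (c Level.⊔ ℓ)) where
  field
    commutativeRing : CommutativeRing c ℓ
  open CommutativeRing commutativeRing public hiding (zero) renaming (refl to ≈-refl)
  field
    ι    : ℤ → Carrier
    ι-+  : ∀ a b → ι (a ℤ.+ b) ≈ ι a + ι b
    ι-*  : ∀ a b → ι (a ℤ.* b) ≈ ι a * ι b
    ι-neg : ∀ a → ι (ℤ.- a) ≈ - ι a
    ι-0  : ι (+ 0) ≈ 0#
    ι-1  : ι (+ 1) ≈ 1#

module AlgebraSolver {c ℓ} (R : ℤAlgebra c ℓ) where
  open ℤAlgebra R

  private
    acr : ACR.AlmostCommutativeRing c ℓ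
    acr = ACR.fromCommutativeRing commutativeRing

    morphism : ACR._-Raw-AlmostCommutative⟶_ (CommutativeRing.rawRing ℤₚ.+-*-commutativeRing) acr
    morphism = record
      { ⟦_⟧    = ι
      ; +-homo = ι-+
      ; *-homo = ι-*
      ; -‿homo = ι-neg
      ; 0-homo = ι-0
      ; 1-homo = ι-1
      }

    dec : ∀ a b → Maybe (ι a ≈ ι b)
    dec a b with a ℤ.≟ b
    ... | yes a≡b = just (reflexive (cong ι a≡b))
    ... | no _    = nothing

  open Algebra.Solver.Ring _ acr morphism dec public
    using (solve; _:=_; _:+_; _:*_; _:-_; :-_; con)

-- Power series in y: products of linear factors, and factoring by roots.

module Series {c ℓ} (R : ℤAlgebra c ℓ) where
  open ℤAlgebra R
  open AlgebraSolver R
  open SetoidReasoning setoid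

  Ser : Set c
  Ser = ℕ → Carrier

  infix 4 _≋_
  _≋_ : Ser → Ser → Set ℓ
  f ≋ g = ∀ j → f j ≈ g j

  one : Ser
  one zero    = 1#
  one (suc _) = 0#

  -- t ∙ f is the product (1 - t y) f of power series in y.
  infixr 6 _∙_
  _∙_ : Carrier → Ser → Ser
  (t ∙ f) zero    = f zero
  (t ∙ f) (suc j) = f (suc j) - t * f j

  prod : List Carrier → Ser
  prod []      = one
  prod (t ∷ l) = t ∙ prod l

  sum : List Carrier → Carrier
  sum = foldr _+_ 0#

  conv : Ser → Ser → Ser
  conv f g zero    = f 0 * g 0
  conv f g (suc j) = f 0 * g (suc j) + conv (λ i → f (suc i)) g j

  ∙-cong : ∀ {t u f g} → t ≈ u → f ≋ g → t ∙ f ≋ u ∙ g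
  ∙-cong t≈u f≋g zero    = f≋g 0
  ∙-cong t≈u f≋g (suc j) = +-cong (f≋g (suc j)) (-‿cong (*-cong t≈u (f≋g j)))

  ∙-comm : ∀ t u f → t ∙ u ∙ f ≋ u ∙ t ∙ f
  ∙-comm t u f zero          = ≈-refl
  ∙-comm t u f (suc zero)    =
    solve 4 (λ t u a b → (b :- u :* a) :- t :* a := (b :- t :* a) :- u :* a) ≈-refl t u (f 0) (f 1)
  ∙-comm t u f (suc (suc j)) =
    solve 5 (λ t u a b d → (d :- u :* b) :- t :* (b :- u :* a) := (d :- t :* b) :- u :* (b :- t :* a))
      ≈-refl t u (f j) (f (suc j)) (f (suc (suc j)))

  prod-cong : ∀ {a} {A : Set a} (f g : A → Carrier) → (∀ x → f x ≈ g x) → ∀ l → prod (map f l) ≋ prod (map g l)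
  prod-cong f g f≈g []      j = ≈-refl
  prod-cong f g f≈g (x ∷ l) j = ∙-cong (f≈g x) (prod-cong f g f≈g l) j

  prod-↭ : ∀ {l l′} → l ↭ l′ → prod l ≋ prod l′
  prod-↭ ↭.refl             j = ≈-refl
  prod-↭ (↭.prep x p)       j = ∙-cong ≈-refl (prod-↭ p) j
  prod-↭ (↭.swap x y p)     j = trans (∙-comm x y _ j) (∙-cong ≈-refl (∙-cong ≈-refl (prod-↭ p)) j)
  prod-↭ (↭.trans p q)      j = trans (prod-↭ p j) (prod-↭ q j)

  prod-0 : ∀ l → prod l 0 ≈ 1#
  prod-0 []      = ≈-refl
  prod-0 (t ∷ l) = prod-0 l

  prod-1 : ∀ l → prod l 1 ≈ - sum l
  prod-1 []      = sym (trans (-‿cong (sym ι-0)) (trans (sym (ι-neg (+ 0))) ι-0))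
  prod-1 (t ∷ l) = begin
    prod l 1 - t * prod l 0 ≈⟨ +-cong (prod-1 l) (-‿cong (trans (*-congˡ (prod-0 l)) (*-identityʳ t))) ⟩
    - sum l - t             ≈⟨ solve 2 (λ s t → (:- s) :- t := :- (t :+ s)) ≈-refl (sum l) t ⟩
    - (t + sum l)           ∎

  prod-deg : ∀ l j → length l < j → prod l j ≈ 0#
  prod-deg []      (suc j) _         = ≈-refl
  prod-deg (t ∷ l) (suc j) (s≤s l<j) = begin
    prod l (suc j) - t * prod l j ≈⟨ +-cong (prod-deg l (suc j) (ℕₚ.m<n⇒m<1+n l<j)) (-‿cong (*-congˡ (prod-deg l j l<j))) ⟩
    0# - t * 0#                   ≈⟨ +-congʳ (sym ι-0) ⟩
    ι (+ 0) - t * 0#              ≈⟨ +-congˡ (-‿cong (*-congˡ (sym ι-0))) ⟩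
    ι (+ 0) - t * ι (+ 0)         ≈⟨ solve 1 (λ t → con (+ 0) :- t :* con (+ 0) := con (+ 0)) ≈-refl t ⟩
    ι (+ 0)                       ≈⟨ ι-0 ⟩
    0#                            ∎

  conv-cong : ∀ {f f′ g g′} → f ≋ f′ → g ≋ g′ → conv f g ≋ conv f′ g′
  conv-cong p q zero    = *-cong (p 0) (q 0)
  conv-cong p q (suc j) = +-cong (*-cong (p 0) (q (suc j))) (conv-cong (λ i → p (suc i)) q j)

  conv-zeroˡ : ∀ {f} g → (∀ i → f i ≈ 0#) → ∀ j → conv f g j ≈ 0#
  conv-zeroˡ g f≈0 zero    = trans (*-congʳ (f≈0 0)) (zeroˡ _)
  conv-zeroˡ g f≈0 (suc j) =
    trans (+-cong (trans (*-congʳ (f≈0 0)) (zeroˡ _)) (conv-zeroˡ g (λ i → f≈0 (suc i)) j)) (+-identityˡ 0#)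

  conv-linˡ : ∀ a b f h g j → conv (λ i → a * f i + b * h i) g j ≈ a * conv f g j + b * conv h g j
  conv-linˡ a b f h g zero =
    solve 5 (λ a b f h g → (a :* f :+ b :* h) :* g := a :* (f :* g) :+ b :* (h :* g)) ≈-refl a b (f 0) (h 0) (g 0)
  conv-linˡ a b f h g (suc j) = trans
    (+-congˡ (conv-linˡ a b (λ i → f (suc i)) (λ i → h (suc i)) g j))
    (solve 7 (λ a b f h g x y → (a :* f :+ b :* h) :* g :+ (a :* x :+ b :* y) := a :* (f :* g :+ x) :+ b :* (h :* g :+ y))
      ≈-refl a b (f 0) (h 0) (g (suc j)) _ _)

  conv-linʳ : ∀ a b f h g j → conv g (λ i → a * f i + b * h i) j ≈ a * conv g f j + b * conv g h j
  conv-linʳ a b f h g zero =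
    solve 5 (λ a b f h g → g :* (a :* f :+ b :* h) := a :* (g :* f) :+ b :* (g :* h)) ≈-refl a b (f 0) (h 0) (g 0)
  conv-linʳ a b f h g (suc j) = trans
    (+-congˡ (conv-linʳ a b f h (λ i → g (suc i)) j))
    (solve 7 (λ a b f h g x y → g :* (a :* f :+ b :* h) :+ (a :* x :+ b :* y) := a :* (g :* f :+ x) :+ b :* (g :* h :+ y))
      ≈-refl a b (f (suc j)) (h (suc j)) (g 0) _ _)

  conv-scale : ∀ s f g j → conv (λ i → f i * s) (λ i → g i * s) j ≈ conv f g j * (s * s)
  conv-scale s f g zero    = solve 3 (λ s f g → (f :* s) :* (g :* s) := (f :* g) :* (s :* s)) ≈-refl s (f 0) (g 0)
  conv-scale s f g (suc j) = trans
    (+-congˡ (conv-scale s (λ i → f (suc i)) g j))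
    (solve 4 (λ s f g x → (f :* s) :* (g :* s) :+ x :* (s :* s) := (f :* g :+ x) :* (s :* s)) ≈-refl s (f 0) (g (suc j)) _)

  conv-one : ∀ g → conv one g ≋ g
  conv-one g zero    = *-identityˡ _
  conv-one g (suc j) = trans (+-cong (*-identityˡ _) (conv-zeroˡ g (λ _ → ≈-refl) j)) (+-identityʳ _)

  conv-∙ : ∀ t f g → conv (t ∙ f) g ≋ t ∙ conv f g
  conv-∙ t f g zero    = ≈-refl
  conv-∙ t f g (suc j) = begin
    f 0 * g (suc j) + conv (λ i → f (suc i) - t * f i) g j
      ≈⟨ +-congˡ (conv-cong (λ i → solve 3 (λ t a b → b :- t :* a := con (+ 1) :* b :+ (:- t) :* a)
           ≈-refl t (f i) (f (suc i))) (λ _ → ≈-refl) j) ⟩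
    f 0 * g (suc j) + conv (λ i → ι (+ 1) * f (suc i) + - t * f i) g j
      ≈⟨ +-congˡ (conv-linˡ (ι (+ 1)) (- t) (λ i → f (suc i)) f g j) ⟩
    f 0 * g (suc j) + (ι (+ 1) * conv (λ i → f (suc i)) g j + - t * conv f g j)
      ≈⟨ solve 4 (λ t a x y → a :+ (con (+ 1) :* x :+ (:- t) :* y) := (a :+ x) :- t :* y)
           ≈-refl t (f 0 * g (suc j)) _ _ ⟩
    f 0 * g (suc j) + conv (λ i → f (suc i)) g j - t * conv f g j ∎

  conv-prod : ∀ l l′ → conv (prod l) (prod l′) ≋ prod (l ++ l′)
  conv-prod []      l′ j = conv-one _ j
  conv-prod (t ∷ l) l′ j = trans (conv-∙ t (prod l) (prod l′) j) (∙-cong ≈-refl (conv-prod l l′) j)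

  -- Polarisation (f + g)² - (f - g)² = 4 f g. The two mixed products stay apart; for products of
  -- linear factors they are identified later by permuting the factors.
  conv-polar : ∀ f g j →
    conv (λ i → f i + g i) (λ i → f i + g i) j - conv (λ i → f i - g i) (λ i → f i - g i) j
      ≈ ι (+ 2) * (conv f g j + conv g f j)
  conv-polar f g j = begin
    conv (λ i → f i + g i) (λ i → f i + g i) j - conv (λ i → f i - g i) (λ i → f i - g i) j
      ≈⟨ +-cong (expand (+ 1) (λ i → f i + g i) λ i →
           solve 2 (λ x y → x :+ y := con (+ 1) :* x :+ con (+ 1) :* y) ≈-refl (f i) (g i))
         (-‿cong (expand (ℤ.- + 1) (λ i → f i - g i) λ i →
           solve 2 (λ x y → x :- y := con (+ 1) :* x :+ con (ℤ.- + 1) :* y) ≈-refl (f i) (g i))) ⟩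
    _ ≈⟨ solve 4 (λ a b c d →
           (con (+ 1) :* (con (+ 1) :* a :+ con (+ 1) :* b) :+ con (+ 1) :* (con (+ 1) :* c :+ con (+ 1) :* d))
           :- (con (+ 1) :* (con (+ 1) :* a :+ con (ℤ.- + 1) :* b) :+ con (ℤ.- + 1) :* (con (+ 1) :* c :+ con (ℤ.- + 1) :* d))
           := con (+ 2) :* (b :+ c)) ≈-refl (conv f f j) (conv f g j) (conv g f j) (conv g g j) ⟩
    ι (+ 2) * (conv f g j + conv g f j) ∎
    where
    expand : ∀ ε h → (∀ i → h i ≈ ι (+ 1) * f i + ι ε * g i) →
      conv h h j ≈ ι (+ 1) * (ι (+ 1) * conv f f j + ι ε * conv f g j) + ι ε * (ι (+ 1) * conv g f j + ι ε * conv g g j)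
    expand ε h h≈ = trans (conv-cong h≈ h≈ j) (trans (conv-linˡ (ι (+ 1)) (ι ε) f g _ j)
      (+-cong (*-congˡ (conv-linʳ (ι (+ 1)) (ι ε) f g f j)) (*-congˡ (conv-linʳ (ι (+ 1)) (ι ε) f g g j))))

  -- ev t f m is the value at t of the reversed polynomial Σ_{j ≤ m} f_j z^(m-j).
  ev : Carrier → Ser → Ser
  ev t f zero    = f 0
  ev t f (suc j) = f (suc j) + t * ev t f j

  ev-cong : ∀ t {f g} → f ≋ g → ev t f ≋ ev t g
  ev-cong t f≋g zero    = f≋g 0
  ev-cong t f≋g (suc j) = +-cong (f≋g (suc j)) (*-congˡ (ev-cong t f≋g j))

  -- Synthetic division: the successive Horner values of f at t are the coefficients of f / (1 - t
  -- y). Hence t is a root of the reversed polynomial exactly when the coefficient of this quotient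
  -- just beyond the expected degree vanishes.
  ∙-ev : ∀ t f → f ≋ t ∙ ev t f
  ∙-ev t f zero    = ≈-refl
  ∙-ev t f (suc j) = solve 3 (λ t a b → a := (a :+ t :* b) :- t :* b) ≈-refl t (f (suc j)) (ev t f j)

  -- Reversal turns the factor 1 - u y into z - u. The extra term `g (suc j)` vanishes once g has
  -- degree at most j.
  ev-∙ : ∀ t u g j → ev t (u ∙ g) (suc j) ≈ g (suc j) + (t - u) * ev t g j
  ev-∙ t u g zero    = solve 4 (λ t u a b → (b :- u :* a) :+ t :* a := b :+ (t :- u) :* a) ≈-refl t u (g 0) (g 1)
  ev-∙ t u g (suc j) = trans (+-congˡ (*-congˡ (ev-∙ t u g j)))
    (solve 5 (λ t u a b e → (b :- u :* a) :+ t :* (a :+ (t :- u) :* e) := b :+ (t :- u) :* (a :+ t :* e))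
      ≈-refl t u (g (suc j)) (g (suc (suc j))) (ev t g j))

  Regular : Carrier → Set _
  Regular a = ∀ b → a * b ≈ 0# → b ≈ 0#

  -- The factor theorem with zero divisors allowed: after division by one root t, any other root u
  -- remains a root of the quotient because u - t can be cancelled. The roots are those of the
  -- reversed polynomial, so its leading coefficient is `f 0`.
  roots : ∀ (l : List Carrier) f → (∀ j → length l < j → f j ≈ 0#) →
          All (λ t → ev t f (length l) ≈ 0#) l → AllPairs (λ t u → Regular (u - t)) l →
          f ≋ λ j → f 0 * prod l j
  roots [] f deg [] [] zero    = sym (*-identityʳ _)
  roots [] f deg [] [] (suc j) = trans (deg (suc j) (s≤s z≤n)) (sym (zeroʳ _))
  roots (t ∷ l) f deg (ft≈0 ∷ fl≈0) (t#l ∷ l#l) j = begin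
    f j                           ≈⟨ ∙-ev t f j ⟩
    (t ∙ g) j                     ≈⟨ ∙-cong ≈-refl (roots l g gdeg gl≈0 l#l) j ⟩
    (t ∙ (λ i → f 0 * prod l i)) j ≈⟨ ∙-scale j ⟩
    f 0 * (t ∙ prod l) j          ∎
    where
    g : Ser
    g = ev t f

    -- The root condition at t kills the first coefficient beyond the degree of the quotient; the
    -- Horner recursion then kills all later ones.
    gdeg : ∀ j → length l < j → g j ≈ 0#
    gdeg (suc j) (s≤s l≤j) with ℕₚ.m≤n⇒m<n∨m≡n l≤j
    ... | inj₂ refl = ft≈0
    ... | inj₁ l<j  = begin
      f (suc j) + t * g j ≈⟨ +-cong (deg (suc j) (s≤s l<j)) (*-congˡ (gdeg j l<j)) ⟩
      0# + t * 0#         ≈⟨ trans (+-identityˡ _) (zeroʳ t) ⟩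
      0#                  ∎

    quotient-root : ∀ {u} → Regular (u - t) → ev u f (suc (length l)) ≈ 0# → ev u g (length l) ≈ 0#
    quotient-root {u} reg fu≈0 = reg _ (begin
      (u - t) * ev u g (length l)                       ≈⟨ +-identityˡ _ ⟨
      0# + (u - t) * ev u g (length l)                  ≈⟨ +-congʳ (sym ft≈0) ⟩
      g (suc (length l)) + (u - t) * ev u g (length l)  ≈⟨ ev-∙ u t g (length l) ⟨
      ev u (t ∙ g) (suc (length l))                     ≈⟨ ev-cong u (λ i → sym (∙-ev t f i)) (suc (length l)) ⟩
      ev u f (suc (length l))                           ≈⟨ fu≈0 ⟩
      0#                                                ∎)

    gl≈0 : All (λ u → ev u g (length l) ≈ 0#) l
    gl≈0 = All.zipWith (λ (reg , fu≈0) → quotient-root reg fu≈0) (t#l , fl≈0)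

    ∙-scale : ∀ j → (t ∙ (λ i → f 0 * prod l i)) j ≈ f 0 * (t ∙ prod l) j
    ∙-scale zero    = ≈-refl
    ∙-scale (suc j) = solve 4 (λ t a b d → (a :* d) :- t :* (a :* b) := a :* (d :- t :* b))
      ≈-refl t (f 0) (prod l j) (prod l (suc j))

  -- Multiplying f by y leaves the reversed polynomial as it is, but read in one degree more its
  -- leading coefficient is 0; so `roots` presents it as 0 times a product.
  too-many-roots : ∀ (l : List Carrier) f → (∀ j → length l ≤ j → f j ≈ 0#) →
    All (λ t → ev t f (ℕ.pred (length l)) ≈ 0#) l → AllPairs (λ t u → Regular (u - t)) l → l ≢ [] →
    ∀ j → f j ≈ 0#
  too-many-roots [] f _ _ _ l≢[] _ = contradiction refl l≢[]
  too-many-roots l@(_ ∷ l′) f deg fl≈0 l#l _ j =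
    trans (roots l f⁺ deg⁺ (All.map (λ p → trans (ev⁺ _ _) p) fl≈0) l#l (suc j)) (zeroˡ _)
    where
    f⁺ : Ser
    f⁺ zero    = 0#
    f⁺ (suc j) = f j

    deg⁺ : ∀ j → length l < j → f⁺ j ≈ 0#
    deg⁺ (suc j) (s≤s l≤j) = deg j l≤j

    ev⁺ : ∀ t j → ev t f⁺ (suc j) ≈ ev t f j
    ev⁺ t zero    = trans (+-congˡ (zeroʳ t)) (+-identityʳ _)
    ev⁺ t (suc j) = +-congˡ (*-congˡ (ev⁺ t j))

Σ≤-suc : ∀ n f → Σ≤ (suc n) f ≡ f 0 ℤ.+ Σ≤ n (λ i → f (suc i))
Σ≤-suc zero    f = refl
Σ≤-suc (suc n) f = ≡.trans (cong (ℤ._+ f (suc (suc n))) (Σ≤-suc n f)) (ℤₚ.+-assoc (f 0) _ _)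

Σ≤-cong : ∀ n {f g} → (∀ i → i ≤ n → f i ≡ g i) → Σ≤ n f ≡ Σ≤ n g
Σ≤-cong zero    f≡g = f≡g 0 z≤n
Σ≤-cong (suc n) f≡g = cong₂ ℤ._+_ (Σ≤-cong n (λ i i≤n → f≡g i (ℕₚ.m≤n⇒m≤1+n i≤n))) (f≡g (suc n) ℕₚ.≤-refl)

Σ≤-zero : ∀ n {f} → (∀ i → i ≤ n → f i ≡ + 0) → Σ≤ n f ≡ + 0
Σ≤-zero zero    f≡0 = f≡0 0 z≤n
Σ≤-zero (suc n) f≡0 = cong₂ ℤ._+_ (Σ≤-zero n (λ i i≤n → f≡0 i (ℕₚ.m≤n⇒m≤1+n i≤n))) (f≡0 (suc n) ℕₚ.≤-refl)

-- Values of integer polynomials in a ring.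

module Evaluation {c ℓ} (R : ℤAlgebra c ℓ) where
  open ℤAlgebra R
  open AlgebraSolver R
  open Series R using (ev)
  open SetoidReasoning setoid

  infixr 8 _^_
  _^_ : Carrier → ℕ → Carrier
  r ^ zero  = 1#
  r ^ suc k = r * r ^ k

  ^-cong : ∀ {r s} k → r ≈ s → r ^ k ≈ s ^ k
  ^-cong zero    r≈s = ≈-refl
  ^-cong (suc k) r≈s = *-cong r≈s (^-cong k r≈s)

  ^-+ : ∀ r j k → r ^ (j ℕ.+ k) ≈ r ^ j * r ^ k
  ^-+ r zero    k = sym (*-identityˡ _)
  ^-+ r (suc j) k = trans (*-congˡ (^-+ r j k)) (sym (*-assoc r _ _))

  ^-* : ∀ r s k → (r * s) ^ k ≈ r ^ k * s ^ k
  ^-* r s zero    = sym (*-identityˡ _)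
  ^-* r s (suc k) = trans (*-congˡ (^-* r s k))
    (solve 4 (λ r s a b → r :* s :* (a :* b) := r :* a :* (s :* b)) ≈-refl r s (r ^ k) (s ^ k))

  -- A relation, because a coefficient function carries no degree: the Horner scheme may stop at any
  -- place beyond which all coefficients vanish, and `Ev-unique` shows that the place does not
  -- affect the value.
  data Ev (r : Carrier) (f : Poly₁) (v : Carrier) : Set (c Level.⊔ ℓ) where
    vanish : (∀ i → f i ≡ + 0) → v ≈ 0# → Ev r f v
    horner : ∀ {w} → Ev r (λ i → f (suc i)) w → v ≈ ι (f 0) + r * w → Ev r f v

  module _ (r : Carrier) where

    private
      ι≈0 : ∀ {a} → a ≡ + 0 → ι a ≈ 0#
      ι≈0 refl = ι-0

    Ev-resp : ∀ {f g v w} → f ≈₁ g → v ≈ w → Ev r f v → Ev r g w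
    Ev-resp f≈g v≈w (vanish f≡0 v≈0) = vanish (λ i → ≡.trans (≡.sym (f≈g i)) (f≡0 i)) (trans (sym v≈w) v≈0)
    Ev-resp f≈g v≈w (horner e v≈)    =
      horner (Ev-resp (λ i → f≈g (suc i)) ≈-refl e) (trans (sym v≈w) (trans v≈ (+-congʳ (reflexive (cong ι (f≈g 0))))))

    Ev-tail : ∀ {f v} → Ev r f v → ∃ λ w → Ev r (λ i → f (suc i)) w × v ≈ ι (f 0) + r * w
    Ev-tail (vanish f≡0 v≈0) = 0# , vanish (λ i → f≡0 (suc i)) ≈-refl ,
      trans v≈0 (sym (trans (+-cong (ι≈0 (f≡0 0)) (zeroʳ r)) (+-identityˡ 0#)))
    Ev-tail (horner e v≈)    = _ , e , v≈

    Ev-vanish : ∀ {f v} → (∀ i → f i ≡ + 0) → Ev r f v → v ≈ 0#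
    Ev-vanish _   (vanish _ v≈0) = v≈0
    Ev-vanish f≡0 (horner e v≈)  = trans v≈
      (trans (+-cong (ι≈0 (f≡0 0)) (trans (*-congˡ (Ev-vanish (λ i → f≡0 (suc i)) e)) (zeroʳ r))) (+-identityˡ 0#))

    Ev-unique : ∀ {f v w} → Ev r f v → Ev r f w → v ≈ w
    Ev-unique (vanish f≡0 v≈0) e′ = trans v≈0 (sym (Ev-vanish f≡0 e′))
    Ev-unique (horner e v≈)    e′ with Ev-tail e′
    ... | _ , e₁ , w≈ = trans v≈ (trans (+-congˡ (*-congˡ (Ev-unique e e₁))) (sym w≈))

    Ev-exists : ∀ N f → (∀ i → N ≤ i → f i ≡ + 0) → ∃ (Ev r f)
    Ev-exists zero    f f≡0 = 0# , vanish (λ i → f≡0 i z≤n) ≈-refl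
    Ev-exists (suc N) f f≡0 with Ev-exists N (λ i → f (suc i)) (λ i N≤i → f≡0 (suc i) (s≤s N≤i))
    ... | w , e = _ , horner e ≈-refl

    Ev-zero : ∀ {f} → (∀ i → f i ≡ + 0) → Ev r f 0#
    Ev-zero f≡0 = vanish f≡0 ≈-refl

    Ev-const : ∀ a → Ev r (const₁ a) (ι a)
    Ev-const a = horner (Ev-zero λ _ → refl) (sym (trans (+-congˡ (zeroʳ r)) (+-identityʳ _)))

    Ev-one : Ev r one₁ 1#
    Ev-one = Ev-resp (λ _ → refl) ι-1 (Ev-const (+ 1))

    Ev-q : Ev r q₁ r
    Ev-q = horner
      (horner (Ev-zero λ _ → refl) (sym (trans (+-cong ι-1 (zeroʳ r)) (+-identityʳ 1#))))
      (sym (trans (+-congʳ ι-0) (trans (+-identityˡ _) (*-identityʳ r))))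

    Ev-+ : ∀ {f g v w} → Ev r f v → Ev r g w → Ev r (f +₁ g) (v + w)
    Ev-+ (vanish f≡0 v≈0) e′ =
      Ev-resp (λ i → ≡.sym (≡.trans (cong (ℤ._+ _) (f≡0 i)) (ℤₚ.+-identityˡ _))) (sym (trans (+-congʳ v≈0) (+-identityˡ _))) e′
    Ev-+ {f} {g} (horner {v} e v≈) e′ with Ev-tail e′
    ... | w , e₁ , w≈ = horner (Ev-+ e e₁) (trans (+-cong v≈ w≈) (trans
      (solve 5 (λ r a b v w → (a :+ r :* v) :+ (b :+ r :* w) := (a :+ b) :+ r :* (v :+ w)) ≈-refl r (ι (f 0)) (ι (g 0)) v w)
      (+-congʳ (sym (ι-+ (f 0) (g 0))))))

    Ev-scale : ∀ a {f v} → Ev r f v → Ev r (λ i → a ℤ.* f i) (ι a * v)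
    Ev-scale a (vanish f≡0 v≈0) =
      vanish (λ i → ≡.trans (cong (a ℤ.*_) (f≡0 i)) (ℤₚ.*-zeroʳ a)) (trans (*-congˡ v≈0) (zeroʳ _))
    Ev-scale a {f} (horner {v} e v≈) = horner (Ev-scale a e) (trans (*-congˡ v≈) (trans
      (solve 4 (λ r a b v → a :* (b :+ r :* v) := a :* b :+ r :* (a :* v)) ≈-refl r (ι a) (ι (f 0)) v)
      (+-congʳ (sym (ι-* a (f 0))))))

    Ev-- : ∀ {f g v w} → Ev r f v → Ev r g w → Ev r (f -₁ g) (v - w)
    Ev-- {f} {g} {v} {w} e e′ = Ev-resp (λ i → cong (ℤ._+_ (f i)) (ℤₚ.-1*i≡-i (g i)))
      (solve 2 (λ v w → v :+ con (ℤ.- + 1) :* w := v :- w) ≈-refl v w) (Ev-+ e (Ev-scale (ℤ.- + 1) e′))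

    Ev-* : ∀ {f g v w} → Ev r f v → Ev r g w → Ev r (f *₁ g) (v * w)
    Ev-* {g = g} (vanish f≡0 v≈0) e′ = vanish
      (λ i → Σ≤-zero i λ a _ → ≡.trans (cong (ℤ._* g (i ∸ a)) (f≡0 a)) (ℤₚ.*-zeroˡ (g (i ∸ a))))
      (trans (*-congʳ v≈0) (zeroˡ _))
    Ev-* {f} {g} (horner {v} e v≈) e′ with Ev-tail e′
    ... | w , e₁ , w≈ = horner
      (Ev-resp (λ i → ≡.sym (Σ≤-suc i _)) ≈-refl (Ev-+ (Ev-scale (f 0) e₁) (Ev-* e e′)))
      (trans (*-cong v≈ w≈) (trans
        (solve 5 (λ r a b v w → (a :+ r :* v) :* (b :+ r :* w) := a :* b :+ r :* (a :* w :+ v :* (b :+ r :* w)))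
          ≈-refl r (ι (f 0)) (ι (g 0)) v w)
        (+-cong (sym (ι-* (f 0) (g 0))) (*-congˡ (+-congˡ (*-congˡ (sym w≈)))))))

    Ev-^ : ∀ {f v} k → Ev r f v → Ev r (f ^₁ k) (v ^ k)
    Ev-^ zero    e = Ev-one
    Ev-^ (suc k) e = Ev-* e (Ev-^ k e)

    Ev-prod : ∀ (Φ : ℕ → Poly₁) (v : ℕ → Carrier) → (∀ d → Ev r (Φ d) (v d)) →
      ∀ l → Ev r (foldr _*₁_ one₁ (map Φ l)) (foldr _*_ 1# (map v l))
    Ev-prod Φ v e []      = Ev-one
    Ev-prod Φ v e (d ∷ l) = Ev-* (e d) (Ev-prod Φ v e l)

    sumTo : ℕ → (ℕ → Carrier) → Carrier
    sumTo zero    v = v 0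
    sumTo (suc n) v = sumTo n v + v (suc n)

    Ev-Σ : ∀ n {F : ℕ → Poly₁} {v : ℕ → Carrier} → (∀ j → Ev r (F j) (v j)) → Ev r (Σ₁ n F) (sumTo n v)
    Ev-Σ zero    e = e 0
    Ev-Σ (suc n) e = Ev-+ (Ev-Σ n e) (e (suc n))

    -- From (1 + r)² = r λ one gets r^j (1 + r)^(2(m - j)) = r^m λ^(m - j). The sum up to k is thus
    -- r^m λ^(m - k) times a Horner value; at k = m the expansion becomes r^m times the reversed
    -- polynomial of γ at λ.
    gamma-expansion : ∀ m (γ : ℕ → ℤ) {λ′} → (1# + r) * (1# + r) ≈ r * λ′ → ∀ k i → k ℕ.+ i ≡ m →
      sumTo k (λ j → ι (γ j) * (r ^ j * (1# + r) ^ (m ℕ.+ m ∸ 2 ℕ.* j))) ≈ r ^ m * (λ′ ^ i * ev λ′ (λ j → ι (γ j)) k)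
    gamma-expansion m γ {λ′} λ-def = go
      where
      exponent : ∀ j i → j ℕ.+ i ≡ m → m ℕ.+ m ∸ 2 ℕ.* j ≡ i ℕ.+ i
      exponent j i refl = ≡.trans (cong (_∸ 2 ℕ.* j) (rearrange j i)) (ℕₚ.m+n∸n≡m (i ℕ.+ i) (2 ℕ.* j))
        where
        rearrange : ∀ j i → (j ℕ.+ i) ℕ.+ (j ℕ.+ i) ≡ (i ℕ.+ i) ℕ.+ 2 ℕ.* j
        rearrange = ℕ-Ring.solve-∀

      term : ∀ j i → j ℕ.+ i ≡ m → r ^ j * (1# + r) ^ (m ℕ.+ m ∸ 2 ℕ.* j) ≈ r ^ m * λ′ ^ i
      term j i refl = begin
        r ^ j * (1# + r) ^ (j ℕ.+ i ℕ.+ (j ℕ.+ i) ∸ 2 ℕ.* j) ≈⟨ *-congˡ (reflexive (cong ((1# + r) ^_) (exponent j i refl))) ⟩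
        r ^ j * (1# + r) ^ (i ℕ.+ i)           ≈⟨ *-congˡ (trans (^-+ _ i i) (sym (^-* _ _ i))) ⟩
        r ^ j * ((1# + r) * (1# + r)) ^ i      ≈⟨ *-congˡ (trans (^-cong i λ-def) (^-* r λ′ i)) ⟩
        r ^ j * (r ^ i * λ′ ^ i)               ≈⟨ *-assoc _ _ _ ⟨
        r ^ j * r ^ i * λ′ ^ i                 ≈⟨ *-congʳ (^-+ r j i) ⟨
        r ^ (j ℕ.+ i) * λ′ ^ i                 ∎

      go : ∀ k i → k ℕ.+ i ≡ m →
        sumTo k (λ j → ι (γ j) * (r ^ j * (1# + r) ^ (m ℕ.+ m ∸ 2 ℕ.* j))) ≈ r ^ m * (λ′ ^ i * ev λ′ (λ j → ι (γ j)) k)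
      go zero    i eq = trans (*-congˡ (term 0 i eq))
        (solve 3 (λ a b g → g :* (a :* b) := a :* (b :* g)) ≈-refl (r ^ m) (λ′ ^ i) (ι (γ 0)))
      go (suc k) i eq = trans
        (+-cong (go k (suc i) (≡.trans (ℕₚ.+-suc k i) eq)) (*-congˡ (term (suc k) i eq)))
        (solve 5 (λ a b l e g → a :* (l :* b :* e) :+ g :* (a :* b) := a :* (b :* (g :+ l :* e)))
          ≈-refl (r ^ m) (λ′ ^ i) λ′ (ev λ′ (λ j → ι (γ j)) k) (ι (γ (suc k))))

module _ {c ℓ} (R : ℤAlgebra c ℓ) where
  open ℤAlgebra R

  ι-conv : ∀ A B j → ι ((A *₁ B) j) ≈ Series.conv R (λ i → ι (A i)) (λ i → ι (B i)) j
  ι-conv A B zero    = ι-* (A 0) (B 0)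
  ι-conv A B (suc j) = trans (reflexive (cong ι (Σ≤-suc j _)))
    (trans (ι-+ (A 0 ℤ.* B (suc j)) _) (+-cong (ι-* (A 0) (B (suc j))) (ι-conv (λ i → A (suc i)) B j)))

open import Data.Integer using (_+_; _*_; -_; _-_)

-- Divisibility goals reduced to ring identities.

∣-by : ∀ {m a c} x → m ∣ a → c ≡ x * a → m ∣ c
∣-by x m∣a refl = ∣n⇒∣m*n x m∣a

∣-by₂ : ∀ {m a b c} x y → m ∣ a → m ∣ b → c ≡ x * a + y * b → m ∣ c
∣-by₂ x y m∣a m∣b refl = ∣m∣n⇒∣m+n (∣n⇒∣m*n x m∣a) (∣n⇒∣m*n y m∣b)

≡⇒∣ : ∀ m {a b} → a ≡ b → m ∣ a - b
≡⇒∣ m {a} refl = divides (+ 0) (ℤₚ.+-inverseʳ a)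

∣-sym : ∀ {m} a b → m ∣ a - b → m ∣ b - a
∣-sym a b m∣ = ∣-by (- + 1) m∣ (eq a b)
  where
  eq : ∀ a b → b - a ≡ - + 1 * (a - b)
  eq = solve-∀

-- Residues and units.

small-multiple : ∀ {n} c → + n ∣ c → ℤ.∣ c ∣ < n → c ≡ + 0
small-multiple c n∣c c<n with ℤ.∣ c ∣ in eq | ∣⇒∣ᵤ n∣c
... | zero  | _   = ℤₚ.∣i∣≡0⇒i≡0 eq
... | suc k | n∣k = contradiction (ℕ∣.∣⇒≤ n∣k) (ℕₚ.<⇒≱ c<n)

residue-unique : ∀ {n a b} → a < n → b < n → + n ∣ + a - + b → a ≡ b
residue-unique {n} {a} {b} a<n b<n n∣a-b = ℤₚ.+-injective (ℤₚ.i-j≡0⇒i≡j (+ a) (+ b) (small-multiple (+ a - + b) n∣a-b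
  (subst (λ c → ℤ.∣ c ∣ < n) (≡.sym (ℤₚ.m-n≡m⊖n a b)) (ℕₚ.≤-<-trans (ℤₚ.∣m⊝n∣≤m⊔n a b) (ℕₚ.⊔-lub a<n b<n)))))

%ℕ-cong : ∀ k n .{{_ : ℕ.NonZero n}} → + n ∣ k - + (k %ℕ n)
%ℕ-cong k n = divides (k /ℕ n) (≡.trans (cong (_- + (k %ℕ n)) (a≡a%ℕn+[a/ℕn]*n k n)) (eq (+ (k %ℕ n)) _))
  where
  eq : ∀ r q → r + q - r ≡ q
  eq = solve-∀

module _ {a b} {A : Set a} {B : Set b} {π : A → B} {π′ : B → A} where

  map-Unique : ∀ {l} → (∀ {x} → x ∈ l → π′ (π x) ≡ x) → Unique l → Unique (map π l)
  map-Unique inv []           = []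
  map-Unique {x ∷ l} inv (x∉l ∷ l!) = All.tabulate fresh ∷ map-Unique (inv ∘ there) l!
    where
    fresh : ∀ {y} → y ∈ map π l → π x ≢ y
    fresh y∈ πx≡y with ∈ₚ.∈-map⁻ π y∈
    ... | z , z∈l , refl = All.lookup x∉l z∈l
      (≡.trans (≡.sym (inv (here refl))) (≡.trans (cong π′ πx≡y) (inv (there z∈l))))

  map-↭ : ∀ {l l′} → Unique l → Unique l′ →
    (∀ {x} → x ∈ l → π x ∈ l′ × π′ (π x) ≡ x) → (∀ {y} → y ∈ l′ → π′ y ∈ l × π (π′ y) ≡ y) → map π l ↭ l′
  map-↭ {l} {l′} l! l′! to from = ∼bag⇒↭ (∈ₚK.unique∧set⇒bag (map-Unique (proj₂ ∘ to) l!) l′! (mk⇔ ⇒ ⇐))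
    where
    ⇒ : ∀ {y} → y ∈ map π l → y ∈ l′
    ⇒ y∈ with ∈ₚ.∈-map⁻ π y∈
    ... | x , x∈l , refl = proj₁ (to x∈l)

    ⇐ : ∀ {y} → y ∈ l′ → y ∈ map π l
    ⇐ y∈l′ = subst (_∈ map π l) (proj₂ (from y∈l′)) (∈ₚ.∈-map⁺ π (proj₁ (from y∈l′)))

Unit : ℤ → ℤ → Set
Unit m u = ∃ λ v → m ∣ u * v - + 1

unit-inverse : ∀ {m u} ((v , _) : Unit m u) → Unit m v
unit-inverse {m} {u} (v , m∣) = u , subst (λ c → m ∣ c - + 1) (ℤₚ.*-comm u v) m∣

unit-1 : ∀ m → Unit m (+ 1)
unit-1 m = + 1 , divides (+ 0) refl

unit-* : ∀ {m u u′} → Unit m u → Unit m u′ → Unit m (u * u′)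
unit-* {m} {u} {u′} (v , p) (v′ , p′) = v * v′ , ∣-by₂ (u′ * v′) (+ 1) p p′ (eq u u′ v v′)
  where
  eq : ∀ u u′ v v′ → u * u′ * (v * v′) - + 1 ≡ u′ * v′ * (u * v - + 1) + + 1 * (u′ * v′ - + 1)
  eq = solve-∀

unit-cong : ∀ {m} a b → m ∣ a - b → Unit m a → Unit m b
unit-cong a b m∣ (v , p) = v , ∣-by₂ (+ 1) (- v) p m∣ (eq a b v)
  where
  eq : ∀ a b v → b * v - + 1 ≡ + 1 * (a * v - + 1) + - v * (a - b)
  eq = solve-∀

unit-neg : ∀ {m u} → Unit m u → Unit m (- u)
unit-neg {m} {u} (v , p) = - v , subst (λ c → m ∣ c - + 1) (eq u v) p
  where
  eq : ∀ u v → u * v ≡ - u * - v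
  eq = solve-∀

unit-cancel : ∀ {m} u {a} → Unit m u → m ∣ u * a → m ∣ a
unit-cancel u {a} (v , p) q = ∣-by₂ v (- a) q p (eq u v a)
  where
  eq : ∀ u v a → a ≡ v * (u * a) + - a * (u * v - + 1)
  eq = solve-∀

-- The inverse comes from 1 - u (v + w - u v w) = (1 - u v)(1 - u w), whose right side is divisible
-- by a b.
unit-product : ∀ {a b u} → Unit a u → Unit b u → Unit (a * b) u
unit-product {a} {b} {u} (v , divides q eq₁) (w , divides r eq₂) = v + w - u * v * w ,
  divides (- q * r) (≡.trans (eq u v w) (≡.trans (cong₂ (λ x y → - x * y) eq₁ eq₂) (eq′ q a r b)))
  where
  eq : ∀ u v w → u * (v + w - u * v * w) - + 1 ≡ - (u * v - + 1) * (u * w - + 1)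
  eq = solve-∀
  eq′ : ∀ q a r b → - (q * a) * (r * b) ≡ - q * r * (a * b)
  eq′ = solve-∀

product∣ : ∀ {a b c} → Unit a b → a ∣ c → b ∣ c → a * b ∣ c
product∣ {a} {b} unit a∣c (divides r refl) with unit-cancel b unit (subst (a ∣_) (ℤₚ.*-comm r b) a∣c)
... | divides q refl = divides q (ℤₚ.*-assoc q a b)

unit⊎∣ : ∀ {p} → Prime p → ∀ k → Unit (+ p) k ⊎ + p ∣ k
unit⊎∣ {p} pp k with + p ∣? k
... | yes p∣k = inj₂ p∣k
... | no  p∤k = inj₁ (with-sign (coprime-Bézout coprime) (ℤₚ.+∣i∣≡i⊎+∣i∣≡-i k))
  where
  coprime : Coprime p ℤ.∣ k ∣
  coprime (d∣p , d∣k) with Prime.prime⇒irreducible pp d∣p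
  ... | inj₁ d≡1  = d≡1
  ... | inj₂ refl = contradiction (∣ᵤ⇒∣ d∣k) p∤k

  abs-unit : Bézout.Identity 1 p ℤ.∣ k ∣ → Unit (+ p) (+ ℤ.∣ k ∣)
  abs-unit (Bézout.+- x y eq) = - + y , divides (- + x) (≡.trans (alg (+ ℤ.∣ k ∣) (+ y))
    (≡.trans (cong -_ (≡.trans (cong (_+_ (+ 1)) (≡.sym (ℤₚ.pos-* y ℤ.∣ k ∣))) (≡.trans (cong +_ eq) (ℤₚ.pos-* x p))))
      (ℤₚ.neg-distribˡ-* (+ x) (+ p))))
    where
    alg : ∀ a y → a * - y - + 1 ≡ - (+ 1 + y * a)
    alg = solve-∀
  abs-unit (Bézout.-+ x y eq) = + y , divides (+ x) (≡.trans
    (cong (_- + 1) (≡.trans (ℤₚ.*-comm (+ ℤ.∣ k ∣) (+ y)) (≡.trans (≡.sym (ℤₚ.pos-* y ℤ.∣ k ∣)) (≡.trans (cong +_ (≡.sym eq)) (cong (_+_ (+ 1)) (ℤₚ.pos-* x p))))))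
    (alg (+ x * + p)))
    where
    alg : ∀ a → + 1 + a - + 1 ≡ a
    alg = solve-∀

  with-sign : Bézout.Identity 1 p ℤ.∣ k ∣ → (+ ℤ.∣ k ∣ ≡ k ⊎ + ℤ.∣ k ∣ ≡ - k) → Unit (+ p) k
  with-sign id (inj₁ eq) = subst (Unit (+ p)) eq (abs-unit id)
  with-sign id (inj₂ eq) = subst (Unit (+ p)) (ℤₚ.neg-involutive k) (unit-neg {u = - k} (subst (Unit (+ p)) eq (abs-unit id)))

1<prime : ∀ {p} → Prime p → 1 < p
1<prime {suc (suc _)} _ = s≤s (s≤s z≤n)
1<prime {0} pp = contradiction pp Prime.¬prime[0]
1<prime {1} pp = contradiction pp Prime.¬prime[1]

prime∤1 : ∀ {p} → Prime p → ¬ + p ∣ + 1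
prime∤1 pp p∣1 = ℕₚ.<⇒≱ (1<prime pp) (ℕ∣.∣⇒≤ (∣⇒∣ᵤ p∣1))

unit⇒∤ : ∀ {p k} → Prime p → Unit (+ p) k → ¬ + p ∣ k
unit⇒∤ {k = k} pp (v , p∣) p∣k = prime∤1 pp (∣-by₂ v (- + 1) p∣k p∣ (eq k v))
  where
  eq : ∀ k v → + 1 ≡ v * k + - + 1 * (k * v - + 1)
  eq = solve-∀

prime-∣* : ∀ {p} → Prime p → ∀ a b → + p ∣ a * b → + p ∣ a ⊎ + p ∣ b
prime-∣* pp a b p∣ab with unit⊎∣ pp a
... | inj₁ unit = inj₂ (unit-cancel a unit p∣ab)
... | inj₂ p∣a  = inj₁ p∣a

distinct-primes : ∀ {p q} → Prime p → Prime q → p ≢ q → Unit (+ p) (+ q)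
distinct-primes {p} {q} pp pq p≢q with unit⊎∣ pp (+ q)
... | inj₁ unit = unit
... | inj₂ p∣q with Prime.prime⇒irreducible pq (∣⇒∣ᵤ p∣q)
...   | inj₁ refl = contradiction pp Prime.¬prime[1]
...   | inj₂ p≡q  = contradiction p≡q p≢q

∈⇒∣product : ∀ {q ps} → q ∈ ps → + q ∣ + product ps
∈⇒∣product q∈ps = ∣ᵤ⇒∣ (ListAction.∈⇒∣product q∈ps)

unit-of-list : ∀ {u} ps → (∀ {q} → q ∈ ps → Unit (+ q) u) → Unit (+ product ps) u
unit-of-list {u} []       units = + 0 , divides (u * + 0 - + 1) (≡.sym (ℤₚ.*-identityʳ _))
unit-of-list {u} (p ∷ ps) units = subst (λ m → Unit m u) (≡.sym (ℤₚ.pos-* p (product ps)))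
  (unit-product {u = u} (units (here refl)) (unit-of-list {u} ps (λ q∈ → units (there q∈))))

product∣-list : ∀ {ps c} → All Prime ps → Unique ps → (∀ {q} → q ∈ ps → + q ∣ c) → + product ps ∣ c
product∣-list {[]}     {c} _          _              _    = divides c (≡.sym (ℤₚ.*-identityʳ c))
product∣-list {p ∷ ps} {c} (pp ∷ pps) (p∉ps ∷ ps!) ps∣c = subst (_∣ c) (≡.sym (ℤₚ.pos-* p (product ps)))
  (product∣ (coprime p pp ps (λ q∈ → All.lookup p∉ps q∈ , All.lookup pps q∈)) (ps∣c (here refl)) (product∣-list pps ps! (ps∣c ∘ there)))
  where
  coprime : ∀ p → Prime p → ∀ qs → (∀ {q} → q ∈ qs → p ≢ q × Prime q) → Unit (+ p) (+ product qs)
  coprime p pp []       _ = unit-1 (+ p)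
  coprime p pp (q ∷ qs) h = subst (Unit (+ p)) (≡.sym (ℤₚ.pos-* q (product qs)))
    (unit-* {u = + q} (distinct-primes pp (proj₂ (h (here refl))) (proj₁ (h (here refl)))) (coprime p pp qs (h ∘ there)))

unit⊎factor : ∀ {ps} → All Prime ps → ∀ k → Unit (+ product ps) k ⊎ ∃ λ p → p ∈ ps × + p ∣ k
unit⊎factor {[]}     _          k = inj₁ (unit-of-list {k} [] λ ())
unit⊎factor {p ∷ ps} (pp ∷ pps) k with unit⊎∣ pp k | unit⊎factor pps k
... | inj₂ p∣k | _                    = inj₂ (p , here refl , p∣k)
... | inj₁ _   | inj₂ (q , q∈ , q∣k) = inj₂ (q , there q∈ , q∣k)
... | inj₁ up  | inj₁ ups             =
  inj₁ (subst (λ m → Unit m k) (≡.sym (ℤₚ.pos-* p (product ps))) (unit-product {u = k} up ups))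

-- The Chinese remainder idempotent at p: adding e to an exponent moves its component modulo p by
-- one and leaves the components at the other primes alone. When p is one of the `ps`, x^e is
-- accordingly a primitive p-th root of unity.
IsIdempotent : List ℕ → ℕ → ℤ → Set
IsIdempotent ps p e = + p ∣ e - + 1 × (∀ {q} → q ∈ ps → p ≢ q → + q ∣ e)

idempotent : ∀ {p ps} → Prime p → All Prime ps → ∃ (IsIdempotent ps p)
idempotent {p} {[]}     pp _          = + 1 , divides (+ 0) refl , λ ()
idempotent {p} {q ∷ ps} pp (pq ∷ pps) with idempotent {p} {ps} pp pps | p ℕ.≟ q
... | e , p∣e-1 , ps∣e | yes refl = e , p∣e-1 , λ { (here refl) p≢p → contradiction refl p≢p ; (there q∈) → ps∣e q∈ }
... | e , p∣e-1 , ps∣e | no p≢q with distinct-primes pp pq p≢q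
...   | v , p∣ = + q * v * e , ∣-by₂ (+ q * v) (+ 1) p∣e-1 p∣ (eq (+ q) v e) ,
        λ { (here refl) _ → ∣-by (v * e) ∣-refl (eq′ (+ q) v e) ; (there q∈) p≢ → ∣-by (+ q * v) (ps∣e q∈ p≢) refl }
  where
  eq : ∀ q v e → q * v * e - + 1 ≡ q * v * (e - + 1) + + 1 * (q * v - + 1)
  eq = solve-∀
  eq′ : ∀ q v e → q * v * e ≡ v * e * q
  eq′ = solve-∀

squareFree⇒Unique : ∀ ps → All Prime ps → (∀ p → Prime p → ¬ (p ℕ.* p ℕ∣.∣ product ps)) → Unique ps
squareFree⇒Unique []       _          _  = []
squareFree⇒Unique (p ∷ ps) (pp ∷ pps) sf =
  All.tabulate (λ { q∈ refl → sf p pp (ℕ∣.*-monoʳ-∣ p (ListAction.∈⇒∣product q∈)) }) ∷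
  squareFree⇒Unique ps pps (λ q pq q²∣ → sf q pq (ℕ∣.∣n⇒∣m*n p q²∣))

-- Indicator functions and the weight Ψ.

ind : ℤ → ℤ → ℤ
ind m k with m ∣? k
... | yes _ = + 1
... | no  _ = + 0

ind-yes : ∀ {m k} → m ∣ k → ind m k ≡ + 1
ind-yes {m} {k} m∣k with m ∣? k
... | yes _   = refl
... | no  m∤k = contradiction m∣k m∤k

ind-no : ∀ {m k} → ¬ m ∣ k → ind m k ≡ + 0
ind-no {m} {k} m∤k with m ∣? k
... | yes m∣k = contradiction m∣k m∤k
... | no  _   = refl

ind-⇔ : ∀ {m a b} → (m ∣ a → m ∣ b) → (m ∣ b → m ∣ a) → ind m a ≡ ind m b
ind-⇔ {m} {a} {b} to from with m ∣? a
... | yes m∣a = ≡.sym (ind-yes (to m∣a))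
... | no  m∤a = ≡.sym (ind-no (m∤a ∘ from))

ind-cong : ∀ {m} a b → m ∣ a - b → ind m a ≡ ind m b
ind-cong {m} a b m∣ = ind-⇔ (λ m∣a → ∣-by₂ (+ 1) (- + 1) m∣a m∣ (eq a b)) (λ m∣b → ∣-by₂ (+ 1) (+ 1) m∣b m∣ (eq′ a b))
  where
  eq : ∀ a b → b ≡ + 1 * a + - + 1 * (a - b)
  eq = solve-∀
  eq′ : ∀ a b → a ≡ + 1 * b + + 1 * (a - b)
  eq′ = solve-∀

-∣-cong : ∀ {m} c a b → m ∣ a - b → m ∣ (a - c) - (b - c)
-∣-cong c a b = subst (_ ∣_) (eq a b c)
  where
  eq : ∀ a b c → a - b ≡ (a - c) - (b - c)
  eq = solve-∀

-- Ψ is the tensor product over p ∈ ps of δ_0 - δ_1 on ℤ/p: annihilating it kills exactly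
-- the relations Σ_j x^(j n/p) = 0 of a primitive n-th root of unity x.
diff : ℕ → ℤ → ℤ
diff p k = ind (+ p) k - ind (+ p) (k - + 1)

Ψ : List ℕ → ℤ → ℤ
Ψ []       k = + 1
Ψ (p ∷ ps) k = diff p k * Ψ ps k

diff-cong : ∀ {p} a b → + p ∣ a - b → diff p a ≡ diff p b
diff-cong a b p∣ = cong₂ _-_ (ind-cong a b p∣) (ind-cong (a - + 1) (b - + 1) (-∣-cong (+ 1) a b p∣))

Ψ-cong : ∀ ps {a b} → (∀ {q} → q ∈ ps → + q ∣ a - b) → Ψ ps a ≡ Ψ ps b
Ψ-cong []               ps∣ = refl
Ψ-cong (p ∷ ps) {a} {b} ps∣ = cong₂ _*_ (diff-cong a b (ps∣ (here refl))) (Ψ-cong ps (λ q∈ → ps∣ (there q∈)))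

Ψ-0 : ∀ {ps} → All Prime ps → Ψ ps (+ 0) ≡ + 1
Ψ-0 []         = refl
Ψ-0 {p ∷ _} (pp ∷ pps) = cong₂ _*_ (cong₂ _-_ (ind-yes {+ p} (divides (+ 0) refl)) (ind-no {+ p} {+ 0 - + 1}
  (λ p∣ → prime∤1 pp (∣-by (- + 1) p∣ refl)))) (Ψ-0 pps)

k-[k-e] : ∀ k e → k - (k - e) ≡ e
k-[k-e] = solve-∀

-- At p the factor δ_0 - δ_1 is δ_0 minus its translate by one, and translation by e affects no
-- other factor. With G obtained by putting δ_0 in place of the factor at p, Ψ = (1 - x^e) G; so
-- whatever is fixed by x^e annihilates Ψ.
Ψ-coboundary : ∀ {ps p e} → Unique ps → p ∈ ps → IsIdempotent ps p e →
  ∃ λ (G : ℤ → ℤ) → (∀ {a b} → (∀ {q} → q ∈ ps → + q ∣ a - b) → G a ≡ G b) × (∀ k → Ψ ps k ≡ G k - G (k - e))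
Ψ-coboundary {p ∷ ps} {.p} {e} (p∉ps ∷ _) (here refl) (p∣e-1 , ps∣e) = G , G-cong , G-diff
  where
  G : ℤ → ℤ
  G k = ind (+ p) k * Ψ ps k

  G-cong : ∀ {a b} → (∀ {q} → q ∈ p ∷ ps → + q ∣ a - b) → G a ≡ G b
  G-cong {a} {b} ps∣ = cong₂ _*_ (ind-cong a b (ps∣ (here refl))) (Ψ-cong ps (λ q∈ → ps∣ (there q∈)))

  G-diff : ∀ k → Ψ (p ∷ ps) k ≡ G k - G (k - e)
  G-diff k = ≡.trans (eq (ind (+ p) k) (ind (+ p) (k - + 1)) (Ψ ps k)) (cong (_-_ (G k)) (cong₂ _*_
    (ind-cong (k - + 1) (k - e) (subst (+ p ∣_) (eq′ k e) p∣e-1))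
    (Ψ-cong ps (λ q∈ → subst (_ ∣_) (≡.sym (k-[k-e] k e)) (ps∣e (there q∈) (All.lookup p∉ps q∈))))))
    where
    eq : ∀ x y z → (x - y) * z ≡ x * z - y * z
    eq = solve-∀
    eq′ : ∀ k e → e - + 1 ≡ (k - + 1) - (k - e)
    eq′ = solve-∀
Ψ-coboundary {q ∷ ps} {p} {e} (q∉ps ∷ ps!) (there p∈ps) (p∣e-1 , qps∣e)
  with Ψ-coboundary ps! p∈ps (p∣e-1 , qps∣e ∘ there)
... | G , G-cong , G-diff = G′ , G′-cong , G′-diff
  where
  G′ : ℤ → ℤ
  G′ k = diff q k * G k

  G′-cong : ∀ {a b} → (∀ {q′} → q′ ∈ q ∷ ps → + q′ ∣ a - b) → G′ a ≡ G′ b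
  G′-cong {a} {b} ps∣ = cong₂ _*_ (diff-cong a b (ps∣ (here refl))) (G-cong (λ q∈ → ps∣ (there q∈)))

  G′-diff : ∀ k → Ψ (q ∷ ps) k ≡ G′ k - G′ (k - e)
  G′-diff k = ≡.trans (cong (diff q k *_) (G-diff k)) (≡.trans (eq (diff q k) (G k) (G (k - e)))
    (cong (λ t → diff q k * G k - t * G (k - e)) (diff-cong k (k - e) (subst (+ q ∣_) (≡.sym (k-[k-e] k e))
      (qps∣e (here refl) (λ { refl → All.lookup q∉ps p∈ps refl }))))))
    where
    eq : ∀ x y z → x * (y - z) ≡ x * y - x * z
    eq = solve-∀

-- Formal sums Σ c x^e, acting on functions on ℤ with x acting as a shift.  For an n-periodic weight w, the
-- quotient by the annihilator of w is a quotient of ℤ[ℤ/n].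

Elt : Set
Elt = List (ℤ × ℤ)

act : Elt → (ℤ → ℤ) → ℤ → ℤ
act []            w k = + 0
act ((c , e) ∷ f) w k = c * w (k - e) + act f w k

infixl 7 _⊗_
infixr 8 _·_

_·_ : ℤ × ℤ → Elt → Elt
(c , e) · f = map (λ (c′ , e′) → c * c′ , e + e′) f

_⊗_ : Elt → Elt → Elt
[]      ⊗ g = []
(t ∷ f) ⊗ g = t · g ++ f ⊗ g

⊖_ : Elt → Elt
⊖ f = map (λ (c , e) → - c , e) f

const : ℤ → Elt
const c = (c , + 0) ∷ []

x^_ : ℤ → Elt
x^ e = (+ 1 , e) ∷ []

pair : ℤ → Elt
pair a = const (+ 2) ++ (x^ a ++ x^ (- a))

module _ (w : ℤ → ℤ) where

  act-++ : ∀ f g k → act (f ++ g) w k ≡ act f w k + act g w k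
  act-++ []            g k = ≡.sym (ℤₚ.+-identityˡ _)
  act-++ ((c , e) ∷ f) g k = ≡.trans (cong (_+_ (c * w (k - e))) (act-++ f g k)) (≡.sym (ℤₚ.+-assoc (c * w (k - e)) _ _))

  act-⊖ : ∀ f k → act (⊖ f) w k ≡ - act f w k
  act-⊖ []            k = refl
  act-⊖ ((c , e) ∷ f) k = ≡.trans (cong (_+_ (- c * w (k - e))) (act-⊖ f k)) (eq c (w (k - e)) (act f w k))
    where
    eq : ∀ c w a → - c * w + - a ≡ - (c * w + a)
    eq = solve-∀

  act-· : ∀ c e f k → act ((c , e) · f) w k ≡ c * act f w (k - e)
  act-· c e []              k = ≡.sym (ℤₚ.*-zeroʳ c)
  act-· c e ((c′ , e′) ∷ f) k = ≡.trans
    (cong₂ _+_ (cong (λ i → c * c′ * w i) (eq k e e′)) (act-· c e f k))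
    (eq′ c c′ (w (k - e - e′)) (act f w (k - e)))
    where
    eq : ∀ k e e′ → k - (e + e′) ≡ k - e - e′
    eq = solve-∀
    eq′ : ∀ c c′ w a → c * c′ * w + c * a ≡ c * (c′ * w + a)
    eq′ = solve-∀

  act-⊗ : ∀ f g k → act (f ⊗ g) w k ≡ act f (act g w) k
  act-⊗ []            g k = refl
  act-⊗ ((c , e) ∷ f) g k = ≡.trans (act-++ ((c , e) · g) (f ⊗ g) k) (cong₂ _+_ (act-· c e g k) (act-⊗ f g k))

act-cong : ∀ {w w′} f → (∀ k → w k ≡ w′ k) → ∀ k → act f w k ≡ act f w′ k
act-cong []            w≡w′ k = refl
act-cong ((c , e) ∷ f) w≡w′ k = cong₂ _+_ (cong (c *_) (w≡w′ (k - e))) (act-cong f w≡w′ k)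

act-0 : ∀ f k → act f (λ _ → + 0) k ≡ + 0
act-0 []            k = refl
act-0 ((c , e) ∷ f) k = cong₂ _+_ (ℤₚ.*-zeroʳ c) (act-0 f k)

act-linear : ∀ g c e w v k → act g (λ i → c * w (i - e) + v i) k ≡ c * act g w (k - e) + act g v k
act-linear []              c e w v k = ≡.sym (≡.trans (cong (_+ + 0) (ℤₚ.*-zeroʳ c)) refl)
act-linear ((c′ , e′) ∷ g) c e w v k = ≡.trans
  (cong₂ (λ i a → c′ * (c * w i + v (k - e′)) + a) (eq k e e′) (act-linear g c e w v k))
  (eq′ c c′ (w (k - e - e′)) (v (k - e′)) (act g w (k - e)) (act g v k))
  where
  eq : ∀ k e e′ → k - e′ - e ≡ k - e - e′
  eq = solve-∀
  eq′ : ∀ c c′ w v a b → c′ * (c * w + v) + (c * a + b) ≡ c * (c′ * w + a) + (c′ * v + b)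
  eq′ = solve-∀

-- Translations commute, hence so do their integral combinations. Both the commutativity of `⊗` and
-- its compatibility with equality under a weight come from here.
act-comm : ∀ f g w k → act f (act g w) k ≡ act g (act f w) k
act-comm []            g w k = ≡.sym (act-0 g k)
act-comm ((c , e) ∷ f) g w k = ≡.trans
  (cong (_+_ (c * act g w (k - e))) (act-comm f g w k))
  (≡.sym (act-linear g c e w (act f w) k))

module _ (w : ℤ → ℤ) where

  infix 4 _≈ʷ_
  record _≈ʷ_ (f g : Elt) : Set where
    constructor mk≈
    field act≡ : ∀ k → act f w k ≡ act g w k
  open _≈ʷ_

  -- Two elements are equal when they agree on the single function w. Since f (g w) = g (f w), the
  -- elements that kill w form an ideal, so this is a quotient ring; being a ring of integer-valued
  -- functions, it has no torsion.
  weightedAlgebra : ℤAlgebra _ _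
  weightedAlgebra = record
    { commutativeRing = record
      { Carrier = Elt
      ; _≈_ = _≈ʷ_
      ; _+_ = _++_
      ; _*_ = _⊗_
      ; -_  = ⊖_
      ; 0#  = []
      ; 1#  = const (+ 1)
      ; isCommutativeRing = record
        { isRing = record
          { +-isAbelianGroup = record
            { isGroup = record
              { isMonoid = record
                { isSemigroup = record
                  { isMagma = record
                    { isEquivalence = isEquivalence
                    ; ∙-cong = λ {f} {f′} {g} {g′} p q → mk≈ λ k →
                        ≡.trans (act-++ w f g k) (≡.trans (cong₂ _+_ (act≡ p k) (act≡ q k)) (≡.sym (act-++ w f′ g′ k)))
                    }
                  ; assoc = λ f g h → mk≈ λ k → cong (λ l → act l w k) (Listₚ.++-assoc f g h)
                  }
                ; identity = (λ f → mk≈ λ k → refl) , (λ f → mk≈ λ k → cong (λ l → act l w k) (Listₚ.++-identityʳ f))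
                }
              ; inverse = (λ f → mk≈ λ k → ≡.trans (act-++ w (⊖ f) f k) (≡.trans (cong (_+ act f w k) (act-⊖ w f k)) (ℤₚ.+-inverseˡ (act f w k)))) ,
                          (λ f → mk≈ λ k → ≡.trans (act-++ w f (⊖ f) k) (≡.trans (cong (_+_ (act f w k)) (act-⊖ w f k)) (ℤₚ.+-inverseʳ (act f w k))))
              ; ⁻¹-cong = λ {f} {g} p → mk≈ λ k → ≡.trans (act-⊖ w f k) (≡.trans (cong -_ (act≡ p k)) (≡.sym (act-⊖ w g k)))
              }
            ; comm = λ f g → mk≈ λ k → ≡.trans (act-++ w f g k) (≡.trans (ℤₚ.+-comm (act f w k) (act g w k)) (≡.sym (act-++ w g f k)))
            }
          ; *-cong = λ {f} {f′} {g} {g′} p q → mk≈ (⊗-cong p q)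
          ; *-assoc = λ f g h → mk≈ λ k → ≡.trans (act-⊗ w (f ⊗ g) h k) (≡.trans (act-⊗ (act h w) f g k)
              (≡.sym (≡.trans (act-⊗ w f (g ⊗ h) k) (act-cong f (act-⊗ w g h) k))))
          ; *-identity = (λ f → mk≈ λ k → ≡.trans (act-⊗ w (const (+ 1)) f k) (act-const-1 (act f w) k)) ,
                         (λ f → mk≈ λ k → ≡.trans (act-⊗ w f (const (+ 1)) k) (act-cong f (act-const-1 w) k))
          ; distrib = (λ f g h → mk≈ λ k → ≡.trans (⊗-comm f (g ++ h) k) (≡.trans (⊗-distribʳ f g h k)
                         (≡.trans (act-++ w (g ⊗ f) (h ⊗ f) k) (≡.trans (cong₂ _+_ (⊗-comm g f k) (⊗-comm h f k)) (≡.sym (act-++ w (f ⊗ g) (f ⊗ h) k)))))) ,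
                      (λ f g h → mk≈ (⊗-distribʳ f g h))
          }
        ; *-comm = λ f g → mk≈ (⊗-comm f g)
        }
      }
    ; ι     = const
    ; ι-+   = λ a b → mk≈ λ k → ≡.trans (ℤₚ.+-identityʳ _) (≡.trans (ℤₚ.*-distribʳ-+ (w (k - + 0)) a b)
                (cong (_+_ (a * w (k - + 0))) (≡.sym (ℤₚ.+-identityʳ _))))
    ; ι-*   = λ a b → mk≈ λ k → refl
    ; ι-neg = λ a → mk≈ λ k → refl
    ; ι-0   = mk≈ λ k → refl
    ; ι-1   = mk≈ λ k → refl
    }
    where
    isEquivalence : IsEquivalence _≈ʷ_
    isEquivalence = record
      { refl  = mk≈ λ k → refl
      ; sym   = λ p → mk≈ λ k → ≡.sym (act≡ p k)
      ; trans = λ p q → mk≈ λ k → ≡.trans (act≡ p k) (act≡ q k)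
      }

    ⊗-cong : ∀ {f f′ g g′} → f ≈ʷ f′ → g ≈ʷ g′ → ∀ k → act (f ⊗ g) w k ≡ act (f′ ⊗ g′) w k
    ⊗-cong {f} {f′} {g} {g′} p q k = ≡.trans (act-⊗ w f g k) (≡.trans (act-cong f (act≡ q) k) (≡.trans (act-comm f g′ w k)
      (≡.trans (act-cong g′ (act≡ p) k) (≡.trans (act-comm g′ f′ w k) (≡.sym (act-⊗ w f′ g′ k))))))

    ⊗-comm : ∀ f g k → act (f ⊗ g) w k ≡ act (g ⊗ f) w k
    ⊗-comm f g k = ≡.trans (act-⊗ w f g k) (≡.trans (act-comm f g w k) (≡.sym (act-⊗ w g f k)))

    act-const-1 : ∀ w k → act (const (+ 1)) w k ≡ w k
    act-const-1 w k = ≡.trans (ℤₚ.+-identityʳ _) (≡.trans (ℤₚ.*-identityˡ _) (cong w (ℤₚ.+-identityʳ k)))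

    ⊗-distribʳ : ∀ f g h k → act ((g ++ h) ⊗ f) w k ≡ act (g ⊗ f ++ h ⊗ f) w k
    ⊗-distribʳ f g h k = ≡.trans (act-⊗ w (g ++ h) f k) (≡.trans (act-++ (act f w) g h k)
      (≡.sym (≡.trans (act-++ w (g ⊗ f) (h ⊗ f) k) (cong₂ _+_ (act-⊗ w g f k) (act-⊗ w h f k)))))

-- The substitution x ↦ x^u, for any integer u. It respects sums and products of formal sums
-- literally; with equality it is compatible in the form of `σ-determines`, for representatives with
-- equal coefficients modulo n.
σ : ℤ → Elt → Elt
σ u = map (λ (c , e) → c , u * e)

σ-++ : ∀ u f g → σ u (f ++ g) ≡ σ u f ++ σ u g
σ-++ u f g = Listₚ.map-++ _ f g

σ-⊖ : ∀ u f → σ u (⊖ f) ≡ ⊖ σ u f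
σ-⊖ u []      = refl
σ-⊖ u (t ∷ f) = cong (_ ∷_) (σ-⊖ u f)

σ-⊗ : ∀ u f g → σ u (f ⊗ g) ≡ σ u f ⊗ σ u g
σ-⊗ u []            g = refl
σ-⊗ u ((c , e) ∷ f) g = ≡.trans (σ-++ u ((c , e) · g) (f ⊗ g)) (cong₂ _++_ (σ-· g) (σ-⊗ u f g))
  where
  σ-· : ∀ g → σ u ((c , e) · g) ≡ (c , u * e) · σ u g
  σ-· []              = refl
  σ-· ((c′ , e′) ∷ g) = cong₂ _∷_ (cong (c * c′ ,_) (ℤₚ.*-distribˡ-+ u e e′)) (σ-· g)

σ-σ : ∀ u v f → σ u (σ v f) ≡ σ (u * v) f
σ-σ u v []            = refl
σ-σ u v ((c , e) ∷ f) = cong₂ _∷_ (cong (c ,_) (≡.sym (ℤₚ.*-assoc u v e))) (σ-σ u v f)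

-- Moves the substitution from the element to the weight, where it is an affine change of variable
-- that preserves periodicity.
act-σ : ∀ b f w k → act (σ b f) w k ≡ act f (λ j → w (k + b * j)) (+ 0)
act-σ b []            w k = refl
act-σ b ((c , e) ∷ f) w k = cong₂ _+_ (cong (λ i → c * w i) (eq b e k)) (act-σ b f w k)
  where
  eq : ∀ b e k → k - b * e ≡ k + b * (+ 0 - e)
  eq = solve-∀

Periodic : ℤ → (ℤ → ℤ) → Set
Periodic m w = ∀ a b → m ∣ a - b → w a ≡ w b

act-shift : ∀ g w e k → act g (λ i → w (i - e)) k ≡ act g w (k - e)
act-shift []              w e k = refl
act-shift ((c′ , e′) ∷ g) w e k = cong₂ (λ i a → c′ * w i + a) (eq k e e′) (act-shift g w e k)
  where
  eq : ∀ k e e′ → k - e′ - e ≡ k - e - e′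
  eq = solve-∀

act-periodic : ∀ {m w} f → Periodic m w → Periodic m (act f w)
act-periodic []            per a b m∣ = refl
act-periodic ((c , e) ∷ f) per a b m∣ =
  cong₂ _+_ (cong (c *_) (per (a - e) (b - e) (-∣-cong e a b m∣))) (act-periodic f per a b m∣)

-- The group ring ℤ[ℤ/n] through coefficient functions.

module Residues (n : ℕ) .{{_ : ℕ.NonZero n}} where

  -- Acting on the indicator of the multiples of n collects the terms by exponent modulo n, so this
  -- is the coefficient at x^k in ℤ[ℤ/n].
  coeff : Elt → ℤ → ℤ
  coeff f = act f (ind (+ n))

  coeff-periodic : ∀ f → Periodic (+ n) (coeff f)
  coeff-periodic f = act-periodic f ind-cong

  coeffs-on : (ℤ → ℤ) → List ℕ → Elt
  coeffs-on g = map (λ j → g (+ j) , + j)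

  ⟦_⟧ : (ℤ → ℤ) → Elt
  ⟦ g ⟧ = coeffs-on g (upTo n)

  residue∈ : ∀ k → (k %ℕ n) ∈ upTo n
  residue∈ k = ∈ₚ.∈-upTo⁺ (n%ℕd<d k n)

  coeff-⟦⟧ : ∀ {g} → Periodic (+ n) g → ∀ k → coeff ⟦ g ⟧ k ≡ g k
  coeff-⟦⟧ {g} per k = ≡.trans
    (present (upTo n) (Uniqueₚ.upTo⁺ n) ∈ₚ.∈-upTo⁻ (residue∈ k))
    (≡.sym (per k (+ r) (%ℕ-cong k n)))
    where
    r : ℕ
    r = k %ℕ n

    zero-term : ∀ {j} → j < n → j ≢ r → g (+ j) * ind (+ n) (k - + j) ≡ + 0
    zero-term {j} j<n j≢r = ≡.trans (cong (g (+ j) *_) (ind-no λ n∣k-j →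
      j≢r (residue-unique j<n (n%ℕd<d k n) (∣-by₂ (+ 1) (- + 1) (%ℕ-cong k n) n∣k-j (eq k (+ r) (+ j)))))) (ℤₚ.*-zeroʳ (g (+ j)))
      where
      eq : ∀ k r j → j - r ≡ + 1 * (k - r) + - + 1 * (k - j)
      eq = solve-∀

    absent : ∀ l → (∀ {j} → j ∈ l → j < n) → (∀ {j} → j ∈ l → j ≢ r) → coeff (coeffs-on g l) k ≡ + 0
    absent []      _  _   = refl
    absent (j ∷ l) <n ≢r = cong₂ _+_ (zero-term (<n (here refl)) (≢r (here refl))) (absent l (λ j∈ → <n (there j∈)) (λ j∈ → ≢r (there j∈)))

    present : ∀ l → Unique l → (∀ {j} → j ∈ l → j < n) → r ∈ l → coeff (coeffs-on g l) k ≡ g (+ r)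
    present (j ∷ l) (r∉ ∷ _) <n (here refl) = ≡.trans
      (cong₂ _+_ (≡.trans (cong (g (+ r) *_) (ind-yes (%ℕ-cong k n))) (ℤₚ.*-identityʳ (g (+ r))))
        (absent l (λ j∈ → <n (there j∈)) (λ j∈ j≡r → All.lookup r∉ j∈ (≡.sym j≡r))))
      (ℤₚ.+-identityʳ (g (+ r)))
    present (j ∷ l) (j∉ ∷ l!) <n (there r∈) = ≡.trans
      (cong₂ _+_ (zero-term (<n (here refl)) (λ { refl → All.lookup j∉ r∈ refl })) (present l l! (λ j∈ → <n (there j∈)) r∈))
      (ℤₚ.+-identityˡ (g (+ r)))

  -- A periodic w is itself `⟦ w ⟧` applied to the indicator δ of the multiples of n, so f w = f ⟦w⟧
  -- δ = ⟦w⟧ (f δ). Hence f acts on w through its coefficients modulo n alone.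
  act-coeff : ∀ {w} → Periodic (+ n) w → ∀ f k → act f w k ≡ act ⟦ w ⟧ (coeff f) k
  act-coeff {w} per f k = ≡.trans
    (act-cong f (λ i → ≡.sym (coeff-⟦⟧ per i)) k) (act-comm f ⟦ w ⟧ (ind (+ n)) k)

  coeff-determines : ∀ {w} → Periodic (+ n) w → ∀ f g → (∀ k → coeff f k ≡ coeff g k) → ∀ k → act f w k ≡ act g w k
  coeff-determines {w} per f g f≡g k = ≡.trans (act-coeff per f k)
    (≡.trans (act-cong ⟦ w ⟧ f≡g k) (≡.sym (act-coeff per g k)))

  -- f w = f (1 - x^e) G = ((1 - x^e) f) G, and (1 - x^e) f has zero coefficients.
  annihilate : ∀ {w G e} → Periodic (+ n) G → (∀ k → w k ≡ G k - G (k - e)) →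
    ∀ f → (∀ k → coeff f (k - e) ≡ coeff f k) → ∀ k → act f w k ≡ + 0
  annihilate {w} {G} {e} per w≡ f inv k = ≡.trans
    (act-cong f (λ i → ≡.trans (w≡ i) (eq (G i) (G (i - e)))) k)
    (≡.trans (act-linear f (- + 1) e G G k)
    (≡.trans (cong (λ a → - + 1 * a + act f G k) invariant) (eq′ (act f G k))))
    where
    eq : ∀ a b → a - b ≡ - + 1 * b + a
    eq = solve-∀
    eq′ : ∀ a → - + 1 * a + a ≡ + 0
    eq′ = solve-∀

    invariant : act f G (k - e) ≡ act f G k
    invariant = ≡.trans (act-coeff per f (k - e)) (≡.trans (≡.sym (act-shift ⟦ G ⟧ (coeff f) e k))
      (≡.trans (act-cong ⟦ G ⟧ inv k) (≡.sym (act-coeff per f k))))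

  σ-periodic : ∀ {w} → Periodic (+ n) w → ∀ b k → Periodic (+ n) (λ j → w (k + b * j))
  σ-periodic per b k i j n∣ = per (k + b * i) (k + b * j) (∣-by b n∣ (eq k b i j))
    where
    eq : ∀ k b i j → k + b * i - (k + b * j) ≡ b * (i - j)
    eq = solve-∀

  -- The function j ↦ w (k + b j) is again periodic, so equality in ℤ[ℤ/n] survives the substitution
  -- for every b, unit or not.
  σ-determines : ∀ {w} → Periodic (+ n) w → ∀ b f g → (∀ k → coeff f k ≡ coeff g k) → ∀ k → act (σ b f) w k ≡ act (σ b g) w k
  σ-determines {w} per b f g f≡g k = ≡.trans (act-σ b f w k)
    (≡.trans (coeff-determines (σ-periodic per b k) f g f≡g (+ 0)) (≡.sym (act-σ b g w k)))

  σ-cong : ∀ {w} → Periodic (+ n) w → ∀ b b′ → + n ∣ b - b′ → ∀ f k → act (σ b f) w k ≡ act (σ b′ f) w k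
  σ-cong {w} per b b′ n∣ f k = ≡.trans (act-σ b f w k) (≡.trans
    (act-cong f (λ j → per (k + b * j) (k + b′ * j) (∣-by j n∣ (eq k b b′ j))) (+ 0)) (≡.sym (act-σ b′ f w k)))
    where
    eq : ∀ k b b′ j → k + b * j - (k + b′ * j) ≡ j * (b - b′)
    eq = solve-∀

  coeff-σ : ∀ u → Unit (+ n) u → ∀ f k → coeff (σ u f) (u * k) ≡ coeff f k
  coeff-σ u unit []            k = refl
  coeff-σ u unit ((c , e) ∷ f) k = cong₂ _+_
    (cong (c *_) (ind-⇔ (λ n∣ → unit-cancel u unit (subst (+ n ∣_) (eq u k e) n∣))
                         (λ n∣ → subst (+ n ∣_) (≡.sym (eq u k e)) (∣n⇒∣m*n u n∣))))
    (coeff-σ u unit f k)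
    where
    eq : ∀ u k e → u * k - u * e ≡ u * (k - e)
    eq = solve-∀

AllPairs-map : ∀ {a b r} {A : Set a} {B : Set b} {R : B → B → Set r} {f : A → B} {l} →
  (∀ {x y} → x ∈ l → y ∈ l → x ≢ y → R (f x) (f y)) → Unique l → AllPairs R (map f l)
AllPairs-map h []        = []
AllPairs-map {l = x ∷ l} h (x∉ ∷ l!) =
  Allₚ.map⁺ (All.tabulate λ y∈ → h (here refl) (there y∈) (All.lookup x∉ y∈)) ∷
  AllPairs-map (λ x∈ y∈ → h (there x∈) (there y∈)) l!

-- Quadratic residues.

record _≡_[mod_] (a b m : ℤ) : Set where
  constructor mod
  field ∣- : m ∣ a - b
open _≡_[mod_] using (∣-)

integersMod : ℤ → ℤAlgebra _ _
integersMod m = record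
  { commutativeRing = record
    { Carrier = ℤ ; _≈_ = _≡_[mod m ] ; _+_ = _+_ ; _*_ = _*_ ; -_ = -_ ; 0# = + 0 ; 1# = + 1
    ; isCommutativeRing = record
      { isRing = record
        { +-isAbelianGroup = record
          { isGroup = record
            { isMonoid = record
              { isSemigroup = record
                { isMagma = record
                  { isEquivalence = record
                    { refl  = of refl
                    ; sym   = λ {a} {b} p → mod (∣-sym a b (∣- p))
                    ; trans = λ {a} {b} {c} p q → mod (∣-by₂ (+ 1) (+ 1) (∣- p) (∣- q) (eq-trans a b c))
                    }
                  ; ∙-cong = λ {a} {a′} {b} {b′} p q → mod (∣-by₂ (+ 1) (+ 1) (∣- p) (∣- q) (eq-+ a a′ b b′))
                  }
                ; assoc = λ a b c → of (ℤₚ.+-assoc a b c)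
                }
              ; identity = (λ a → of (ℤₚ.+-identityˡ a)) , (λ a → of (ℤₚ.+-identityʳ a))
              }
            ; inverse = (λ a → of (ℤₚ.+-inverseˡ a)) , (λ a → of (ℤₚ.+-inverseʳ a))
            ; ⁻¹-cong = λ {a} {b} p → mod (∣-by (- + 1) (∣- p) (eq-neg a b))
            }
          ; comm = λ a b → of (ℤₚ.+-comm a b)
          }
        ; *-cong = λ {a} {a′} {b} {b′} p q → mod (∣-by₂ b a′ (∣- p) (∣- q) (eq-* a a′ b b′))
        ; *-assoc = λ a b c → of (ℤₚ.*-assoc a b c)
        ; *-identity = (λ a → of (ℤₚ.*-identityˡ a)) , (λ a → of (ℤₚ.*-identityʳ a))
        ; distrib = (λ a b c → of (ℤₚ.*-distribˡ-+ a b c)) , (λ a b c → of (ℤₚ.*-distribʳ-+ a b c))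
        }
      ; *-comm = λ a b → of (ℤₚ.*-comm a b)
      }
    }
  ; ι = id ; ι-+ = λ _ _ → of refl ; ι-* = λ _ _ → of refl ; ι-neg = λ _ → of refl ; ι-0 = of refl ; ι-1 = of refl
  }
  where
  of : ∀ {a b} → a ≡ b → a ≡ b [mod m ]
  of a≡b = mod (≡⇒∣ m a≡b)
  eq-trans : ∀ a b c → a - c ≡ + 1 * (a - b) + + 1 * (b - c)
  eq-trans = solve-∀
  eq-+ : ∀ a a′ b b′ → a + b - (a′ + b′) ≡ + 1 * (a - a′) + + 1 * (b - b′)
  eq-+ = solve-∀
  eq-neg : ∀ a b → - a - - b ≡ - + 1 * (a - b)
  eq-neg = solve-∀
  eq-* : ∀ a a′ b b′ → a * b - a′ * b′ ≡ b * (a - a′) + a′ * (b - b′)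
  eq-* = solve-∀

mod-zero : ∀ {m a} → a ≡ + 0 [mod m ] → m ∣ a
mod-zero {m} {a} p = subst (m ∣_) (ℤₚ.+-identityʳ a) (∣- p)

zero-mod : ∀ {m a} → m ∣ a → a ≡ + 0 [mod m ]
zero-mod {m} {a} p = mod (subst (m ∣_) (≡.sym (ℤₚ.+-identityʳ a)) p)

data Sign : ℤ → Set where
  zero : Sign (+ 0)
  plus : Sign (+ 1)
  minus : Sign (- + 1)

sign-* : ∀ {a b} → Sign a → Sign b → Sign (a * b)
sign-* zero  b     = zero
sign-* plus  zero  = zero
sign-* plus  plus  = plus
sign-* plus  minus = minus
sign-* minus zero  = zero
sign-* minus plus  = minus
sign-* minus minus = plus

-- Two signs differ by at most 2, so a congruence modulo p > 2 between them is an equality. This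
-- turns Euler's congruence into identities between integers.
sign-unique : ∀ {p a b} → 2 < p → Sign a → Sign b → a ≡ b [mod + p ] → a ≡ b
sign-unique {p} {a} {b} 2<p sa sb a≡b = ℤₚ.i-j≡0⇒i≡j a b (small-multiple (a - b) (∣- a≡b) (ℕₚ.≤-<-trans (bound sa sb) 2<p))
  where
  bound : ∀ {a b} → Sign a → Sign b → ℤ.∣ a - b ∣ ≤ 2
  bound zero  zero  = z≤n
  bound zero  plus  = s≤s z≤n
  bound zero  minus = s≤s z≤n
  bound plus  zero  = s≤s z≤n
  bound plus  plus  = z≤n
  bound plus  minus = s≤s (s≤s z≤n)
  bound minus zero  = s≤s z≤n
  bound minus plus  = s≤s (s≤s z≤n)
  bound minus minus = z≤n

module Legendre (p h : ℕ) (pp : Prime p) (p≡ : p ≡ suc (suc h ℕ.+ suc h)) where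

  private
    instance
      _ : ℕ.NonZero p
      _ = Prime.prime⇒nonZero pp

    <p : ∀ {j} → j < suc h ℕ.+ suc h → suc j < p
    <p j< = subst (_ <_) (≡.sym p≡) (s≤s j<)

    2<p : 2 < p
    2<p = <p (s≤s (ℕₚ.≤-trans (s≤s z≤n) (ℕₚ.m≤n+m (suc h) h)))

    ≤m : suc (suc h) ≤ suc h ℕ.+ suc h
    ≤m = s≤s (ℕₚ.m≤n+m (suc h) h)

  open ℤAlgebra (integersMod (+ p)) using (_≈_; ≈-refl; reflexive; sym; trans; *-cong; *-congˡ; +-cong; setoid)
  open Evaluation (integersMod (+ p)) using (_^_; ^-cong; ^-+; ^-*)
  open SetoidReasoning setoid

  private
    prodℤ : List ℕ → ℤ
    prodℤ = foldr (λ j → + j *_) (+ 1)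

    prodℤ-↭ : ∀ {l l′} → l ↭ l′ → prodℤ l ≡ prodℤ l′
    prodℤ-↭ ↭.refl = refl
    prodℤ-↭ (↭.prep x q) = cong (+ x *_) (prodℤ-↭ q)
    prodℤ-↭ (↭.swap {xs} {ys} x y q) = ≡.trans (swap (+ x) (+ y) (prodℤ xs)) (cong (λ z → + y * (+ x * z)) (prodℤ-↭ q))
      where
      swap : ∀ x y z → x * (y * z) ≡ y * (x * z)
      swap = solve-∀
    prodℤ-↭ (↭.trans q q′) = ≡.trans (prodℤ-↭ q) (prodℤ-↭ q′)

    nonzero : List ℕ
    nonzero = applyUpTo suc (suc h ℕ.+ suc h)

    nonzero! : Unique nonzero
    nonzero! = Uniqueₚ.applyUpTo⁺₁ suc _ (λ i<j _ → ℕₚ.<⇒≢ (s≤s i<j))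

    nonzero⁻ : ∀ {j} → j ∈ nonzero → j < p × Unit (+ p) (+ j)
    nonzero⁻ j∈ with ∈ₚ.∈-applyUpTo⁻ suc j∈
    ... | i , i<2h , refl with unit⊎∣ pp (+ suc i)
    ...   | inj₁ unit = <p i<2h , unit
    ...   | inj₂ p∣j  = contradiction (∣⇒∣ᵤ p∣j) (ℕ∣.>⇒∤ (<p i<2h))

    nonzero⁺ : ∀ {j} → j < p → Unit (+ p) (+ j) → j ∈ nonzero
    nonzero⁺ {zero}  _         unit = contradiction (divides (+ 0) refl) (unit⇒∤ pp unit)
    nonzero⁺ {suc j} j<p       _    = ∈ₚ.∈-applyUpTo⁺ suc (ℕ.s≤s⁻¹ (subst (suc j <_) p≡ j<p))

    module _ (u v : ℤ) (p∣uv-1 : + p ∣ u * v - + 1) where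
      times : ℤ → ℕ → ℕ
      times w j = (w * + j) %ℕ p

      residue : ∀ k → + (k %ℕ p) ≈ k
      residue k = mod (∣-sym k _ (%ℕ-cong k p))

      times∈ : ∀ w {j} → Unit (+ p) w → j ∈ nonzero → times w j ∈ nonzero
      times∈ w {j} uw j∈ = nonzero⁺ (n%ℕd<d (w * + j) p)
        (unit-cong (w * + j) _ (%ℕ-cong (w * + j) p) (unit-* {u = w} uw (proj₂ (nonzero⁻ j∈))))

      times-inverse : ∀ w w′ → + p ∣ w * w′ - + 1 → ∀ {j} → j ∈ nonzero → times w (times w′ j) ≡ j
      times-inverse w w′ inv {j} j∈ = residue-unique (n%ℕd<d (w * + times w′ j) p) (proj₁ (nonzero⁻ j∈)) (∣- (begin
        + times w (times w′ j)  ≈⟨ residue (w * + times w′ j) ⟩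
        w * + times w′ j        ≈⟨ *-congˡ {w} (residue (w′ * + j)) ⟩
        w * (w′ * + j)          ≈⟨ mod (∣-by (+ j) inv (eq w w′ (+ j))) ⟩
        + j                     ∎))
        where
        eq : ∀ w w′ j → w * (w′ * j) - j ≡ j * (w * w′ - + 1)
        eq = solve-∀

      times-↭ : map (times u) nonzero ↭ nonzero
      times-↭ = map-↭ {π′ = times v} nonzero! nonzero!
        (λ j∈ → times∈ u (v , p∣uv-1) j∈ , times-inverse v u (subst (λ c → + p ∣ c - + 1) (ℤₚ.*-comm u v) p∣uv-1) j∈)
        (λ j∈ → times∈ v (unit-inverse {u = u} (v , p∣uv-1)) j∈ , times-inverse u v p∣uv-1 j∈)

      prod-times : ∀ l → prodℤ (map (times u) l) ≈ u ^ length l * prodℤ l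
      prod-times []      = ≈-refl
      prod-times (j ∷ l) = trans (*-cong (residue (u * + j)) (prod-times l)) (reflexive (eq u (+ j) (u ^ length l) (prodℤ l)))
        where
        eq : ∀ u j a b → u * j * (a * b) ≡ u * a * (j * b)
        eq = solve-∀

    prod-unit : ∀ l → (∀ {j} → j ∈ l → Unit (+ p) (+ j)) → Unit (+ p) (prodℤ l)
    prod-unit []      units = unit-1 (+ p)
    prod-unit (j ∷ l) units = unit-* {u = + j} (units (here refl)) (prod-unit l (λ j∈ → units (there j∈)))

    -- Multiplication by u permutes the residues 1, ..., p - 1; comparing the two products and
    -- cancelling their common value gives u^(p-1) ≡ 1.
    fermat : ∀ {u} → Unit (+ p) u → u ^ (suc h ℕ.+ suc h) ≈ + 1
    fermat {u} (v , inv) = mod (unit-cancel (prodℤ nonzero) (prod-unit nonzero (λ j∈ → proj₂ (nonzero⁻ j∈)))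
      (subst (+ p ∣_) (eq (u ^ (suc h ℕ.+ suc h)) (prodℤ nonzero)) (∣- (begin
        u ^ (suc h ℕ.+ suc h) * prodℤ nonzero ≡⟨ cong (λ i → u ^ i * prodℤ nonzero) (Listₚ.length-applyUpTo suc (suc h ℕ.+ suc h)) ⟨
        u ^ length nonzero * prodℤ nonzero    ≈⟨ prod-times u v inv nonzero ⟨
        prodℤ (map (times u v inv u) nonzero) ≡⟨ prodℤ-↭ (times-↭ u v inv) ⟩
        prodℤ nonzero                         ∎))))
      where
      eq : ∀ a b → a * b - b ≡ b * (a - + 1)
      eq = solve-∀

  private
    symbol : ∀ {a b} {A : Set a} {B : Set b} → Dec A → Dec B → ℤ
    symbol (yes _) _       = + 0
    symbol (no _)  (yes _) = + 1
    symbol (no _)  (no _)  = - + 1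

    sign-symbol : ∀ {a b} {A : Set a} {B : Set b} (a? : Dec A) (b? : Dec B) → Sign (symbol a? b?)
    sign-symbol (yes _) _       = zero
    sign-symbol (no _)  (yes _) = plus
    sign-symbol (no _)  (no _)  = minus

    -- Only the value -1 needs an argument: with A = a^((p-1)/2), Fermat gives (A - 1)(A + 1) ≡ 0,
    -- and the first factor is excluded.
    euler-symbol : ∀ a (a? : Dec (+ p ∣ a)) (b? : Dec (+ p ∣ a ^ suc h - + 1)) → symbol a? b? ≈ a ^ suc h
    euler-symbol a (yes p∣a) _        = sym (zero-mod (∣m⇒∣m*n (a ^ h) p∣a))
    euler-symbol a (no _)    (yes p∣) = sym (mod p∣)
    euler-symbol a (no p∤a)  (no p∤)  = half (unit⊎∣ pp a)
      where
      eq : ∀ A → A * A - + 1 ≡ (A - + 1) * (A + + 1)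
      eq = solve-∀

      root : + p ∣ a ^ suc h - + 1 ⊎ + p ∣ a ^ suc h + + 1 → - + 1 ≈ a ^ suc h
      root (inj₁ p∣A-1) = contradiction p∣A-1 p∤
      root (inj₂ p∣A+1) = sym (mod p∣A+1)

      half : Unit (+ p) a ⊎ + p ∣ a → - + 1 ≈ a ^ suc h
      half (inj₂ p∣a)  = contradiction p∣a p∤a
      half (inj₁ unit) = root (prime-∣* pp (a ^ suc h - + 1) (a ^ suc h + + 1)
        (subst (+ p ∣_) (eq (a ^ suc h)) (∣- (trans (sym (^-+ a (suc h) (suc h))) (fermat {a} unit)))))

  abstract
    -- Euler's criterion taken as the definition, with `suc h` = (p - 1)/2. Multiplicativity,
    -- periodicity and the value at -1 then follow from properties of powers.
    legendre : ℤ → ℤ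
    legendre a = symbol (+ p ∣? a) (+ p ∣? a ^ suc h - + 1)

    sign-legendre : ∀ a → Sign (legendre a)
    sign-legendre a = sign-symbol (+ p ∣? a) (+ p ∣? a ^ suc h - + 1)

    euler : ∀ a → legendre a ≈ a ^ suc h
    euler a = euler-symbol a (+ p ∣? a) (+ p ∣? a ^ suc h - + 1)

  legendre-* : ∀ a b → legendre (a * b) ≡ legendre a * legendre b
  legendre-* a b = sign-unique 2<p (sign-legendre _) (sign-* (sign-legendre a) (sign-legendre b)) (begin
    legendre (a * b)        ≈⟨ euler (a * b) ⟩
    (a * b) ^ suc h         ≈⟨ ^-* a b (suc h) ⟩
    a ^ suc h * b ^ suc h   ≈⟨ *-cong (sym (euler a)) (sym (euler b)) ⟩
    legendre a * legendre b ∎)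

  legendre-cong : ∀ a b → + p ∣ a - b → legendre a ≡ legendre b
  legendre-cong a b p∣ = sign-unique 2<p (sign-legendre a) (sign-legendre b)
    (trans (euler a) (trans (^-cong {a} {b} (suc h) (mod p∣)) (sym (euler b))))

  legendre-zero : ∀ {a} → + p ∣ a → legendre a ≡ + 0
  legendre-zero {a} p∣a = sign-unique 2<p (sign-legendre a) zero (trans (euler a) (zero-mod (∣m⇒∣m*n (a ^ h) p∣a)))

  legendre-unit : ∀ {a} → Unit (+ p) a → legendre a * legendre a ≡ + 1
  legendre-unit {a} unit = sign-unique 2<p (sign-* (sign-legendre a) (sign-legendre a)) plus
    (trans (*-cong (euler a) (euler a)) (trans (sym (^-+ a (suc h) (suc h))) (fermat {a} unit)))

  legendre-neg-1 : legendre (- + 1) ≡ (- + 1) ^ suc h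
  legendre-neg-1 = sign-unique 2<p (sign-legendre (- + 1)) (sign-^ (suc h)) (euler (- + 1))
    where
    sign-^ : ∀ k → Sign ((- + 1) ^ k)
    sign-^ zero    = plus
    sign-^ (suc k) = sign-* minus (sign-^ k)

  private
    candidates : List ℕ
    candidates = applyUpTo suc (suc (suc h))

    candidate : ∀ {j} → j ∈ candidates → j < p
    candidate j∈ with ∈ₚ.∈-applyUpTo⁻ suc j∈
    ... | i , i< , refl = <p (ℕₚ.<-≤-trans i< ≤m)

    candidate-unit : ∀ {j} → j ∈ candidates → Unit (+ p) (+ j)
    candidate-unit j∈ with ∈ₚ.∈-applyUpTo⁻ suc j∈
    ... | i , i< , refl = proj₂ (nonzero⁻ (∈ₚ.∈-applyUpTo⁺ suc (ℕₚ.<-≤-trans i< ≤m)))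

    minus-one : ∀ {z} → Sign z → z * z ≡ + 1 → z ≢ + 1 → z ≡ - + 1
    minus-one plus  _ ≢1 = contradiction refl ≢1
    minus-one minus _ _  = refl

  -- The polynomial z^((p-1)/2) - 1 cannot have (p+1)/2 distinct roots.
  not-all-residues : ¬ All (λ j → legendre (+ j) ≡ + 1) candidates
  not-all-residues all = prime∤1 pp (mod-zero (too-many-roots l f f-deg f-roots distinct (λ ()) 0))
    where
    open Series (integersMod (+ p))

    l : List ℤ
    l = map +_ candidates

    length-l : length l ≡ suc (suc h)
    length-l = ≡.trans (Listₚ.length-map +_ candidates) (Listₚ.length-applyUpTo suc (suc (suc h)))

    -- The series 1 - y^(h+1), whose reversal is z^(h+1) - 1. The conclusion `f 0 ≈ 0` reads 1 ≡ 0
    -- modulo p.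
    f : ℕ → ℤ
    f zero = + 1
    f (suc j) with j ℕ.≟ h
    ... | yes _ = - + 1
    ... | no  _ = + 0

    f-deg : ∀ j → length l ≤ j → f j ≈ + 0
    f-deg j l≤j with subst (_≤ j) length-l l≤j
    f-deg (suc j) _ | s≤s h<j with j ℕ.≟ h
    ... | yes refl = contradiction h<j (ℕₚ.<-irrefl refl)
    ... | no _     = ≈-refl

    f-low : ∀ a j → j ≤ h → ev a f j ≈ a ^ j
    f-low a zero    _   = ≈-refl
    f-low a (suc j) j<h with j ℕ.≟ h
    ... | yes refl = contradiction j<h (ℕₚ.<-irrefl refl)
    ... | no _     = trans (reflexive (ℤₚ.+-identityˡ (a * ev a f j))) (*-congˡ {a} (f-low a j (ℕₚ.<⇒≤ j<h)))

    f-top : ∀ a → ev a f (suc h) ≈ a ^ suc h - + 1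
    f-top a with h ℕ.≟ h
    ... | no h≢h = contradiction refl h≢h
    ... | yes _  = trans (reflexive (ℤₚ.+-comm (- + 1) (a * ev a f h))) (+-cong (*-congˡ {a} (f-low a h ℕₚ.≤-refl)) ≈-refl)

    f-roots : All (λ a → ev a f (ℕ.pred (length l)) ≈ + 0) l
    f-roots = Allₚ.map⁺ (All.map (λ {j} leg≡1 → trans (reflexive (cong (λ i → ev (+ j) f (ℕ.pred i)) length-l))
      (trans (f-top (+ j)) (+-cong {y = + 1} (trans (sym (euler (+ j))) (reflexive leg≡1)) (≈-refl { - + 1})))) all)

    distinct : AllPairs (λ t u → Regular (u - t)) l
    distinct = AllPairs-map (λ x∈ y∈ x≢y b p∣ → zero-mod (regular x∈ y∈ x≢y b (mod-zero p∣)))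
      (Uniqueₚ.applyUpTo⁺₁ suc (suc (suc h)) (λ i<j _ → ℕₚ.<⇒≢ (s≤s i<j)))
      where
      regular : ∀ {x y} → x ∈ candidates → y ∈ candidates → x ≢ y → ∀ b → + p ∣ (+ y - + x) * b → + p ∣ b
      regular {x} {y} x∈ y∈ x≢y b p∣ with prime-∣* pp (+ y - + x) b p∣
      ... | inj₂ p∣b = p∣b
      ... | inj₁ p∣y-x = contradiction (≡.sym (residue-unique (candidate y∈) (candidate x∈) p∣y-x)) x≢y

  nonresidue : ∃ λ u → legendre u ≡ - + 1
  nonresidue = + proj₁ found , minus-one (sign-legendre (+ proj₁ found)) (legendre-unit {+ proj₁ found} (candidate-unit (proj₁ (proj₂ found)))) (proj₂ (proj₂ found))
    where
    found : ∃ λ j → j ∈ candidates × legendre (+ j) ≢ + 1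
    found = find (Allₚ.¬All⇒Any¬ (λ j → legendre (+ j) ℤ.≟ + 1) candidates not-all-residues)

-- `symbol-neg-1` is the first supplementary law in the form p ≡ (-1/p) modulo 4. In this form it
-- can be multiplied over the primes dividing n, without counting those that are 3 modulo 4.
record QuadraticSymbol (p : ℕ) : Set where
  field
    symbol      : ℤ → ℤ
    symbol-sign : ∀ a → Sign (symbol a)
    symbol-*    : ∀ a b → symbol (a * b) ≡ symbol a * symbol b
    symbol-cong : ∀ a b → + p ∣ a - b → symbol a ≡ symbol b
    symbol-zero : ∀ a → + p ∣ a → symbol a ≡ + 0
    symbol-unit : ∀ a → Unit (+ p) a → symbol a * symbol a ≡ + 1
    symbol-neg-1 : + 4 ∣ + p - symbol (- + 1)
    nonresidue  : ∃ λ u → symbol u ≡ - + 1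

  symbol-1 : symbol (+ 1) ≡ + 1
  symbol-1 = ≡.trans (symbol-* (+ 1) (+ 1)) (symbol-unit (+ 1) (unit-1 (+ p)))

odd-half : ∀ p → ¬ 2 ℕ∣.∣ p → 1 < p → ∃ λ h → p ≡ suc (suc h ℕ.+ suc h)
odd-half zero 2∤p _ = contradiction (ℕ∣._∣0 2) 2∤p
odd-half (suc zero) _ (s≤s ())
odd-half (suc (suc zero)) 2∤2 _ = contradiction ℕ∣.∣-refl 2∤2
odd-half (suc (suc (suc zero))) _ _ = 0 , refl
odd-half (suc (suc (suc (suc p)))) 2∤p _ with odd-half (suc (suc p)) (λ 2∣p → 2∤p (ℕ∣.∣m∣n⇒∣m+n (ℕ∣.∣-refl {2}) 2∣p)) (s≤s (s≤s z≤n))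
... | h , eq = suc h , cong (suc ∘ suc) (≡.trans eq (cong suc (≡.sym (ℕₚ.+-suc h (suc h)))))

legendreSymbol : ∀ {p} → Prime p → ¬ 2 ℕ∣.∣ p → QuadraticSymbol p
legendreSymbol {p} pp 2∤p with odd-half p 2∤p (1<prime pp)
... | h , p≡ = record
  { symbol      = legendre
  ; symbol-sign = sign-legendre
  ; symbol-*    = legendre-*
  ; symbol-cong = legendre-cong
  ; symbol-zero = λ a → legendre-zero {a}
  ; symbol-unit = λ a → legendre-unit {a}
  ; symbol-neg-1 = subst (+ 4 ∣_) (cong₂ (λ x y → + x - y) (≡.sym p≡) (≡.sym legendre-neg-1)) (alternate (suc h))
  ; nonresidue  = nonresidue
  }
  where
  open Legendre p h pp p≡
  open Evaluation (integersMod (+ p)) using (_^_)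

  -- At k = (p - 1)/2 this is p ≡ (-1)^k modulo 4; raising k by 2 adds 4 to the left term and
  -- preserves the sign.
  alternate : ∀ k → + 4 ∣ + suc (k ℕ.+ k) - (- + 1) ^ k
  alternate zero          = divides (+ 0) refl
  alternate (suc zero)    = divides (+ 1) refl
  alternate (suc (suc k)) = ∣-by₂ (+ 1) (+ 1) (alternate k) ∣-refl (≡.trans
    (cong (λ i → + suc (suc (suc i)) - - + 1 * (- + 1 * (- + 1) ^ k)) (≡.trans (ℕₚ.+-suc k (suc k)) (cong suc (ℕₚ.+-suc k k))))
    (eq (+ suc (k ℕ.+ k)) ((- + 1) ^ k)))
    where
    eq : ∀ a b → + 4 + a - - + 1 * (- + 1 * b) ≡ + 1 * (a - b) + + 1 * + 4
    eq = solve-∀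

-- The Jacobi symbol.

Symbols : List ℕ → Set
Symbols = All QuadraticSymbol

module _ where
  open QuadraticSymbol

  jacobi : ∀ {ps} → Symbols ps → ℤ → ℤ
  jacobi []       a = + 1
  jacobi (s ∷ ss) a = symbol s a * jacobi ss a

  private
    interchange : ∀ a b c d → a * b * (c * d) ≡ a * c * (b * d)
    interchange = solve-∀

  jacobi-sign : ∀ {ps} (ss : Symbols ps) a → Sign (jacobi ss a)
  jacobi-sign []       a = plus
  jacobi-sign (s ∷ ss) a = sign-* (symbol-sign s a) (jacobi-sign ss a)

  jacobi-* : ∀ {ps} (ss : Symbols ps) a b → jacobi ss (a * b) ≡ jacobi ss a * jacobi ss b
  jacobi-* []       a b = refl
  jacobi-* (s ∷ ss) a b = ≡.trans (cong₂ _*_ (symbol-* s a b) (jacobi-* ss a b))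
    (interchange (symbol s a) (symbol s b) (jacobi ss a) (jacobi ss b))

  jacobi-cong : ∀ {ps} (ss : Symbols ps) a b → (∀ {q} → q ∈ ps → + q ∣ a - b) → jacobi ss a ≡ jacobi ss b
  jacobi-cong []       a b ps∣ = refl
  jacobi-cong (s ∷ ss) a b ps∣ = cong₂ _*_ (symbol-cong s a b (ps∣ (here refl))) (jacobi-cong ss a b (λ q∈ → ps∣ (there q∈)))

  jacobi-zero : ∀ {ps} (ss : Symbols ps) {p} → p ∈ ps → ∀ a → + p ∣ a → jacobi ss a ≡ + 0
  jacobi-zero (s ∷ ss) (here refl) a p∣a = ≡.trans (cong (_* jacobi ss a) (symbol-zero s a p∣a)) (ℤₚ.*-zeroˡ (jacobi ss a))
  jacobi-zero (s ∷ ss) (there p∈)  a p∣a = ≡.trans (cong (symbol s a *_) (jacobi-zero ss p∈ a p∣a)) (ℤₚ.*-zeroʳ (symbol s a))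

  jacobi-unit : ∀ {ps} (ss : Symbols ps) a → (∀ {q} → q ∈ ps → Unit (+ q) a) → jacobi ss a * jacobi ss a ≡ + 1
  jacobi-unit []       a units = refl
  jacobi-unit (s ∷ ss) a units = ≡.trans (interchange (symbol s a) (jacobi ss a) (symbol s a) (jacobi ss a))
    (cong₂ _*_ (symbol-unit s a (units (here refl))) (jacobi-unit ss a (λ q∈ → units (there q∈))))

  jacobi-neg-1 : ∀ {ps} (ss : Symbols ps) → + 4 ∣ + product ps - jacobi ss (- + 1)
  jacobi-neg-1 []                = divides (+ 0) refl
  jacobi-neg-1 {p ∷ ps} (s ∷ ss) = subst (λ m → + 4 ∣ m - symbol s (- + 1) * jacobi ss (- + 1)) (≡.sym (ℤₚ.pos-* p (product ps)))
    (∣-by₂ (+ product ps) (symbol s (- + 1)) (symbol-neg-1 s) (jacobi-neg-1 ss) (eq (+ p) (+ product ps) (symbol s (- + 1)) (jacobi ss (- + 1))))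
    where
    eq : ∀ p n a b → p * n - a * b ≡ n * (p - a) + a * (n - b)
    eq = solve-∀

  jacobi-at : ∀ {ps} (ss : Symbols ps) {p} → Unique ps → (p∈ : p ∈ ps) → ∀ a →
    (∀ {q} → q ∈ ps → p ≢ q → + q ∣ a - + 1) → jacobi ss a ≡ symbol (All.lookup ss p∈) a
  jacobi-at (s ∷ ss) (p∉ ∷ _) (here refl) a ps∣ = ≡.trans (cong (symbol s a *_)
    (≡.trans (jacobi-cong ss a (+ 1) (λ q∈ → ps∣ (there q∈) (All.lookup p∉ q∈))) (jacobi-1 ss))) (ℤₚ.*-identityʳ (symbol s a))
    where
    jacobi-1 : ∀ {ps} (ss : Symbols ps) → jacobi ss (+ 1) ≡ + 1
    jacobi-1 []       = refl
    jacobi-1 (s ∷ ss) = cong₂ _*_ (symbol-1 s) (jacobi-1 ss)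
  jacobi-at (s ∷ ss) {p} (q∉ ∷ ps!) (there p∈) a ps∣ = ≡.trans (cong₂ _*_
    (≡.trans (symbol-cong s a (+ 1) (ps∣ (here refl) (λ { refl → All.lookup q∉ p∈ refl }))) (symbol-1 s))
    (jacobi-at ss ps! p∈ a (λ q∈ → ps∣ (there q∈)))) (ℤₚ.*-identityˡ (symbol (All.lookup ss p∈) a))

  -- Primitivity of the character. By the Chinese remainder theorem, u = 1 + e (u₀ - 1) is a
  -- nonresidue u₀ modulo p and 1 modulo every other prime, so that only the symbol at p
  -- contributes.
  jacobi-primitive : ∀ {ps} (ss : Symbols ps) → All Prime ps → Unique ps → ∀ {p} → p ∈ ps →
    ∃ λ u → Unit (+ product ps) u × jacobi ss u ≡ - + 1 × (∀ {q} → q ∈ ps → p ≢ q → + q ∣ u - + 1)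
  jacobi-primitive {ps} ss pps ps! {p} p∈ = u , unit-of-list {u} ps unit , ≡.trans (jacobi-at ss ps! p∈ u u≡1)
      (≡.trans (symbol-cong s u u₀ p∣u-u₀) u₀-nonresidue) , λ q∈ p≢q → u≡1 q∈ p≢q
    where
    s : QuadraticSymbol p
    s = All.lookup ss p∈

    u₀ : ℤ
    u₀ = proj₁ (nonresidue s)

    u₀-nonresidue : symbol s u₀ ≡ - + 1
    u₀-nonresidue = proj₂ (nonresidue s)

    e : ℤ
    e = proj₁ (idempotent (All.lookup pps p∈) pps)

    e-idempotent : IsIdempotent ps p e
    e-idempotent = proj₂ (idempotent (All.lookup pps p∈) pps)

    u : ℤ
    u = + 1 + e * (u₀ - + 1)

    u≡1 : ∀ {q} → q ∈ ps → p ≢ q → + q ∣ u - + 1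
    u≡1 q∈ p≢q = ∣-by (u₀ - + 1) (proj₂ e-idempotent q∈ p≢q) (eq e u₀)
      where
      eq : ∀ e u₀ → + 1 + e * (u₀ - + 1) - + 1 ≡ (u₀ - + 1) * e
      eq = solve-∀

    p∣u-u₀ : + p ∣ u - u₀
    p∣u-u₀ = ∣-by (u₀ - + 1) (proj₁ e-idempotent) (eq e u₀)
      where
      eq : ∀ e u₀ → + 1 + e * (u₀ - + 1) - u₀ ≡ (u₀ - + 1) * (e - + 1)
      eq = solve-∀

    u₀-unit : Unit (+ p) u₀
    u₀-unit with unit⊎∣ (All.lookup pps p∈) u₀
    ... | inj₁ unit = unit
    ... | inj₂ p∣u₀ with ≡.trans (≡.sym u₀-nonresidue) (symbol-zero s u₀ p∣u₀)
    ...   | ()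

    unit : ∀ {q} → q ∈ ps → Unit (+ q) u
    unit {q} q∈ with p ℕ.≟ q
    ... | yes refl = unit-cong u₀ u (∣-sym u u₀ p∣u-u₀) u₀-unit
    ... | no p≢q   = unit-cong (+ 1) u (∣-sym u (+ 1) (u≡1 q∈ p≢q)) (unit-1 (+ q))

-- `jacobi-neg`, the evenness of χ, expresses n ≡ 1 (mod 4): it lets χ be read on pairs ±a, and it
-- gives τ² the sign +n. The equation n = 1 + 2h provides 1, ..., h as representatives of the
-- nonzero residues up to sign.
record Modulus : Set where
  field
    {ps}       : List ℕ
    pps        : All Prime ps
    ps!        : Unique ps
    n          : ℕ
    {{n≢0}}    : ℕ.NonZero n
    n≡         : product ps ≡ n
    2≤n        : 2 ≤ n
    h          : ℕ
    n≡1+2h     : n ≡ suc (h ℕ.+ h)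
    ss         : Symbols ps
    jacobi-neg : jacobi ss (- + 1) ≡ + 1

-- The ring ℤ[x] and descent to its normal basis.

module RootOfUnity (S : Modulus) where

  open Modulus S
  open Residues n public

  n∣⇒p∣ : ∀ {c p} → p ∈ ps → + n ∣ c → + p ∣ c
  n∣⇒p∣ {c} p∈ n∣c = ∣-trans (∈⇒∣product p∈) (subst (λ m → + m ∣ c) (≡.sym n≡) n∣c)

  p∣⇒n∣ : ∀ {c} → (∀ {p} → p ∈ ps → + p ∣ c) → + n ∣ c
  p∣⇒n∣ {c} ps∣c = subst (λ m → + m ∣ c) n≡ (product∣-list pps ps! ps∣c)

  nonunit-factor : ∀ k → Unit (+ n) k ⊎ ∃ λ p → p ∈ ps × + p ∣ k
  nonunit-factor k with unit⊎factor pps k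
  ... | inj₁ unit = inj₁ (subst (λ m → Unit (+ m) k) n≡ unit)
  ... | inj₂ fac  = inj₂ fac

  w : ℤ → ℤ
  w = Ψ ps

  w-periodic : Periodic (+ n) w
  w-periodic a b n∣ = Ψ-cong ps (λ p∈ → n∣⇒p∣ p∈ n∣)

  w-0 : w (+ 0) ≡ + 1
  w-0 = Ψ-0 pps

  R : ℤAlgebra _ _
  R = weightedAlgebra w

  open ℤAlgebra R public using (_≈_; ≈-refl; reflexive; sym; trans; setoid; +-cong; +-congˡ; +-congʳ;
    *-cong; *-congˡ; *-congʳ; *-assoc; *-identityˡ; distribʳ; ι-+; ι-*; ι-neg; ι-0)
  open SetoidReasoning setoid
  open _≈ʷ_ public

  of-coeff : ∀ f g → (∀ k → coeff f k ≡ coeff g k) → f ≈ g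
  of-coeff f g f≡g = mk≈ (coeff-determines w-periodic f g f≡g)

  -- Since Ψ(0) = 1, a constant is recovered as the value at 0 of its action. All identities between
  -- integers are extracted from the ring in this way.
  const-injective : ∀ a b → const a ≈ const b → a ≡ b
  const-injective a b a≈b = ≡.trans (≡.sym (at a)) (≡.trans (act≡ a≈b (+ 0)) (at b))
    where
    at : ∀ c → act (const c) w (+ 0) ≡ c
    at c = ≡.trans (ℤₚ.+-identityʳ (c * w (+ 0))) (≡.trans (cong (c *_) w-0) (ℤₚ.*-identityʳ c))

  act-const⊗ : ∀ c f v k → act (const c ⊗ f) v k ≡ c * act f v k
  act-const⊗ c f v k = ≡.trans (act-⊗ v (const c) f k) (≡.trans (ℤₚ.+-identityʳ (c * act f v (k - + 0)))
    (cong (λ i → c * act f v i) (ℤₚ.+-identityʳ k)))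

  module _ {p} (p∈ : p ∈ ps) where

    e : ℤ
    e = proj₁ (idempotent (All.lookup pps p∈) pps)

    e-idempotent : IsIdempotent ps p e
    e-idempotent = proj₂ (idempotent (All.lookup pps p∈) pps)

    e-cong : ∀ a → + p ∣ a → + n ∣ e * a
    e-cong a p∣a = p∣⇒n∣ λ q∈ → divides-at q∈
      where
      divides-at : ∀ {q} → q ∈ ps → + q ∣ e * a
      divides-at {q} q∈ with p ℕ.≟ q
      ... | yes refl = ∣n⇒∣m*n e p∣a
      ... | no p≢q   = ∣m⇒∣m*n a (proj₂ e-idempotent q∈ p≢q)

    e-e² : + n ∣ (+ 1 - e) * e
    e-e² = subst (+ n ∣_) (eq e) (e-cong (- (e - + 1)) (∣-by (- + 1) (proj₁ e-idempotent) (eq′ e)))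
      where
      eq : ∀ e → e * - (e - + 1) ≡ (+ 1 - e) * e
      eq = solve-∀
      eq′ : ∀ e → - (e - + 1) ≡ - + 1 * (e - + 1)
      eq′ = solve-∀

    -- Coefficients invariant under translation by e make f a multiple of Σ_j x^(j e), the sum of
    -- the p-th roots of unity. It acts as zero because Ψ = (1 - x^e) G.
    invariant⇒0 : ∀ f → (∀ k → coeff f (k - e) ≡ coeff f k) → f ≈ []
    invariant⇒0 f inv with Ψ-coboundary ps! p∈ e-idempotent
    ... | G , G-cong , w≡ = mk≈ (annihilate {G = G} (λ a b n∣ → G-cong (λ q∈ → n∣⇒p∣ q∈ n∣)) w≡ f inv)

  -- Descent to a normal basis: the pull-back of a coefficient function g along the projection k ↦ (1 - e) k onto the
  -- multiples of q represents 0, so it may be subtracted from g; doing this for all q leaves a function supported on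
  -- the units.

  act-coeffs-lin : ∀ a g h v l k → act (coeffs-on (λ j → g j + a * h j) l) v k ≡ act (coeffs-on g l) v k + a * act (coeffs-on h l) v k
  act-coeffs-lin a g h v []      k = ≡.sym (≡.trans (ℤₚ.+-identityˡ (a * + 0)) (ℤₚ.*-zeroʳ a))
  act-coeffs-lin a g h v (j ∷ l) k = ≡.trans (cong (_+_ ((g (+ j) + a * h (+ j)) * v (k - + j))) (act-coeffs-lin a g h v l k))
    (eq a (g (+ j)) (h (+ j)) (v (k - + j)) _ _)
    where
    eq : ∀ a g h v x y → (g + a * h) * v + (x + a * y) ≡ g * v + x + a * (h * v + y)
    eq = solve-∀

  Equivariant : (ℤ → ℤ) → (ℤ → ℤ) → Set
  Equivariant θ g = ∀ u → Unit (+ n) u → ∀ k → g (u * k) ≡ θ u * g k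

  module _ (θ : ℤ → ℤ) where

    trim : ∀ {g} → Periodic (+ n) g → Equivariant θ g → ∀ qs → (∀ {q} → q ∈ qs → q ∈ ps) →
      ∃ λ (g′ : ℤ → ℤ) → Periodic (+ n) g′ × Equivariant θ g′ × (∀ {q} → q ∈ qs → ∀ k → + q ∣ k → g′ k ≡ + 0) × ⟦ g ⟧ ≈ ⟦ g′ ⟧
    trim {g} per eqv []       qs⊆ = g , per , eqv , (λ ()) , ≈-refl
    trim {g} per eqv (q ∷ qs) qs⊆ with trim per eqv qs (λ q∈ → qs⊆ (there q∈))
    ... | g₁ , per₁ , eqv₁ , vanish₁ , g≈g₁ = g₂ , per₂ , eqv₂ , vanish₂ , trans g≈g₁ g₁≈g₂
      where
      e₁ : ℤ
      e₁ = e (qs⊆ (here refl))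

      f : ℤ → ℤ
      f k = (+ 1 - e₁) * k

      g₂ : ℤ → ℤ
      g₂ k = g₁ k + - + 1 * g₁ (f k)

      f-diff : ∀ a b → f a - f b ≡ (+ 1 - e₁) * (a - b)
      f-diff = eq (+ 1 - e₁)
        where
        eq : ∀ e a b → e * a - e * b ≡ e * (a - b)
        eq = solve-∀

      per-f : Periodic (+ n) (λ k → g₁ (f k))
      per-f a b n∣ = per₁ (f a) (f b) (∣-by (+ 1 - e₁) n∣ (f-diff a b))

      per₂ : Periodic (+ n) g₂
      per₂ a b n∣ = cong₂ (λ x y → x + - + 1 * y) (per₁ a b n∣) (per-f a b n∣)

      eqv₂ : Equivariant θ g₂
      eqv₂ u unit k = ≡.trans (cong₂ (λ x y → x + - + 1 * y) (eqv₁ u unit k)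
        (≡.trans (cong g₁ (swap (+ 1 - e₁) u k)) (eqv₁ u unit (f k)))) (eq (θ u) (g₁ k) (g₁ (f k)))
        where
        swap : ∀ e u k → e * (u * k) ≡ u * (e * k)
        swap = solve-∀
        eq : ∀ t a b → t * a + - + 1 * (t * b) ≡ t * (a + - + 1 * b)
        eq = solve-∀

      vanish₂ : ∀ {q′} → q′ ∈ q ∷ qs → ∀ k → + q′ ∣ k → g₂ k ≡ + 0
      -- Modulo n the projection fixes every multiple of q, so the two terms of `g₂` cancel there.
      -- It also preserves divisibility by the primes treated before, which keeps the earlier zeros.
      vanish₂ (here refl) k q∣k = ≡.trans (cong (λ a → g₁ k + - + 1 * a) (per₁ (f k) k
        (∣-by (- + 1) (e-cong (qs⊆ (here refl)) k q∣k) (eq e₁ k)))) (eq′ (g₁ k))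
        where
        eq : ∀ e k → (+ 1 - e) * k - k ≡ - + 1 * (e * k)
        eq = solve-∀
        eq′ : ∀ a → a + - + 1 * a ≡ + 0
        eq′ = solve-∀
      vanish₂ (there q∈) k q∣k = cong₂ (λ x y → x + - + 1 * y) (vanish₁ q∈ k q∣k) (vanish₁ q∈ (f k) (∣n⇒∣m*n (+ 1 - e₁) q∣k))

      -- The projection forgets the component at q: translating by e changes (1 - e) k by (1 - e) e,
      -- which is 0 modulo n.
      killed : ⟦ (λ k → g₁ (f k)) ⟧ ≈ []
      killed = invariant⇒0 (qs⊆ (here refl)) _ λ k → ≡.trans (coeff-⟦⟧ per-f (k - e₁))
        (≡.trans (per₁ (f (k - e₁)) (f k) (∣-by (- + 1) (e-e² (qs⊆ (here refl))) (eq k e₁))) (≡.sym (coeff-⟦⟧ per-f k)))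
        where
        eq : ∀ k e → (+ 1 - e) * (k - e) - (+ 1 - e) * k ≡ - + 1 * ((+ 1 - e) * e)
        eq = solve-∀

      g₁≈g₂ : ⟦ g₁ ⟧ ≈ ⟦ g₂ ⟧
      g₁≈g₂ = mk≈ λ k → ≡.sym (≡.trans (act-coeffs-lin (- + 1) g₁ (λ j → g₁ (f j)) w (upTo n) k)
        (≡.trans (cong (λ a → act ⟦ g₁ ⟧ w k + - + 1 * a) (act≡ killed k)) (ℤₚ.+-identityʳ _)))

    -- Once g vanishes off the units, equivariance gives g(k) = g(k * 1) = θ(k) g(1), so the single
    -- integer g(1) is the multiplier. It is applied to the trivial character and to χ.
    descent : Periodic (+ n) θ → (∀ {p} → p ∈ ps → ∀ k → + p ∣ k → θ k ≡ + 0) →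
      ∀ f → Equivariant θ (coeff f) → ∃ λ c → f ≈ const c ⊗ ⟦ θ ⟧
    descent θ-per θ-zero f eqv with trim (coeff-periodic f) eqv ps id
    ... | g , g-per , g-eqv , g-zero , f≈g = g (+ 1) , trans (of-coeff f ⟦ coeff f ⟧ (λ k → ≡.sym (coeff-⟦⟧ (coeff-periodic f) k)))
      (trans f≈g (of-coeff ⟦ g ⟧ (const (g (+ 1)) ⊗ ⟦ θ ⟧) λ k → ≡.trans (coeff-⟦⟧ g-per k)
        (≡.trans (g≡ k) (≡.sym (≡.trans (act-const⊗ (g (+ 1)) ⟦ θ ⟧ (ind (+ n)) k) (cong (g (+ 1) *_) (coeff-⟦⟧ θ-per k)))))))
      where
      g≡ : ∀ k → g k ≡ g (+ 1) * θ k
      g≡ k with nonunit-factor k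
      ... | inj₁ unit = ≡.trans (cong g (≡.sym (ℤₚ.*-identityʳ k))) (≡.trans (g-eqv k unit (+ 1)) (ℤₚ.*-comm (θ k) (g (+ 1))))
      ... | inj₂ (p , p∈ , p∣k) = ≡.trans (g-zero p∈ k p∣k) (≡.sym (≡.trans (cong (g (+ 1) *_) (θ-zero p∈ k p∣k)) (ℤₚ.*-zeroʳ (g (+ 1)))))

square-one : ∀ a b → a * b ≡ + 1 → a * a ≡ + 1
square-one a b ab≡1 = lemma a (ℕₚ.m*n≡1⇒m≡1 ℤ.∣ a ∣ ℤ.∣ b ∣ (≡.trans (≡.sym (ℤₚ.abs-* a b)) (cong ℤ.∣_∣ ab≡1)))
  where
  lemma : ∀ a → ℤ.∣ a ∣ ≡ 1 → a * a ≡ + 1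
  lemma (+ 1)        refl = refl
  lemma (ℤ.-[1+ 0 ]) refl = refl

-- The quadratic character χ, its Gauss sum, and power sums of x.

module GaussSum (S : Modulus) where

  open Modulus S
  open RootOfUnity S public
  open SetoidReasoning setoid

  χ : ℤ → ℤ
  χ = jacobi ss

  χ-* : ∀ a b → χ (a * b) ≡ χ a * χ b
  χ-* = jacobi-* ss

  χ-periodic : Periodic (+ n) χ
  χ-periodic a b n∣ = jacobi-cong ss a b (λ p∈ → n∣⇒p∣ p∈ n∣)

  χ-zero : ∀ {p} → p ∈ ps → ∀ k → + p ∣ k → χ k ≡ + 0
  χ-zero p∈ k = jacobi-zero ss p∈ k

  χ-unit : ∀ u → Unit (+ n) u → χ u * χ u ≡ + 1
  χ-unit u (v , n∣) = jacobi-unit ss u λ p∈ → v , n∣⇒p∣ p∈ n∣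

  χ-1 : χ (+ 1) ≡ + 1
  χ-1 = ≡.trans (χ-* (+ 1) (+ 1)) (χ-unit (+ 1) (unit-1 (+ n)))

  χ-neg : ∀ k → χ (- k) ≡ χ k
  χ-neg k = ≡.trans (cong χ (≡.sym (ℤₚ.-1*i≡-i k))) (≡.trans (χ-* (- + 1) k) (≡.trans (cong (_* χ k) jacobi-neg) (ℤₚ.*-identityˡ (χ k))))

  χ-inverse : ∀ u v → + n ∣ u * v - + 1 → χ v ≡ χ u
  χ-inverse u v n∣ = ≡.trans (≡.sym (ℤₚ.*-identityˡ (χ v))) (≡.trans (cong (_* χ v) (≡.sym (χ-unit u (v , n∣))))
    (≡.trans (ℤₚ.*-assoc (χ u) (χ u) (χ v)) (≡.trans (cong (χ u *_) (≡.trans (≡.sym (χ-* u v))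
      (≡.trans (χ-periodic (u * v) (+ 1) n∣) χ-1))) (ℤₚ.*-identityʳ (χ u)))))

  -- The trivial character modulo n: χ² is 1 at units and 0 elsewhere.
  principal : ℤ → ℤ
  principal k = χ k * χ k

  private
    principal-periodic : Periodic (+ n) principal
    principal-periodic a b n∣ = cong (λ x → x * x) (χ-periodic a b n∣)

    principal-zero : ∀ {p} → p ∈ ps → ∀ k → + p ∣ k → principal k ≡ + 0
    principal-zero p∈ k p∣k = cong (λ x → x * x) (χ-zero p∈ k p∣k)

    one-equivariant : Equivariant principal (coeff (const (+ 1)))
    one-equivariant u unit k = ≡.trans (cong (λ i → + 1 * i + + 0) (ind-⇔
        (λ n∣ → subst (+ n ∣_) (≡.sym (ℤₚ.+-identityʳ k)) (unit-cancel u unit (subst (+ n ∣_) (ℤₚ.+-identityʳ (u * k)) n∣)))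
        (λ n∣ → subst (+ n ∣_) (≡.sym (ℤₚ.+-identityʳ (u * k))) (∣n⇒∣m*n u (subst (+ n ∣_) (ℤₚ.+-identityʳ k) n∣)))))
      (≡.sym (≡.trans (cong (_* coeff (const (+ 1)) k) (χ-unit u unit)) (ℤₚ.*-identityˡ _)))

    -- Comparing the actions on Ψ at 0 gives an equation 1 = c s₀ in ℤ, so c = ±1 and s = c (c s) =
    -- c.
    divides-one : ∀ s c → const (+ 1) ≈ const c ⊗ s → s ≈ const c
    divides-one s c 1≈cs = begin
      s                           ≈⟨ *-identityˡ s ⟨
      const (+ 1) ⊗ s             ≡⟨ cong (λ i → const i ⊗ s) c²≡1 ⟨
      const (c * c) ⊗ s           ≈⟨ *-assoc (const c) (const c) s ⟩
      const c ⊗ (const c ⊗ s)     ≈⟨ *-congˡ {const c} (sym 1≈cs) ⟩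
      const c ⊗ const (+ 1)       ≡⟨ cong const (ℤₚ.*-identityʳ c) ⟩
      const c                     ∎
      where
      c²≡1 : c * c ≡ + 1
      c²≡1 = square-one c (act s w (+ 0)) (≡.trans (≡.sym (act-const⊗ c s w (+ 0)))
        (≡.trans (≡.sym (act≡ 1≈cs (+ 0))) (≡.trans (ℤₚ.+-identityʳ (+ 1 * w (+ 0))) (≡.trans (ℤₚ.*-identityˡ (w (+ 0))) w-0))))

  abstract
    -- The sum of the primitive n-th roots of unity is ±1: it divides 1.
    principal-integer : ∃ λ c → ⟦ principal ⟧ ≈ const c
    principal-integer = let (c , 1≈cs) = descent principal principal-periodic principal-zero (const (+ 1)) one-equivariant
                        in c , divides-one ⟦ principal ⟧ c 1≈cs

    invariant⇒integer : ∀ f → (∀ u → Unit (+ n) u → ∀ k → coeff f (u * k) ≡ coeff f k) → ∃ λ c → f ≈ const c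
    invariant⇒integer f inv = combine principal-integer (descent principal principal-periodic principal-zero f
      (λ u unit k → ≡.trans (inv u unit k) (≡.sym (≡.trans (cong (_* coeff f k) (χ-unit u unit)) (ℤₚ.*-identityˡ (coeff f k))))))
      where
      combine : ∃ (λ c → ⟦ principal ⟧ ≈ const c) → ∃ (λ b → f ≈ const b ⊗ ⟦ principal ⟧) → ∃ λ c → f ≈ const c
      combine (c , s≈c) (b , f≈bs) = b * c , trans f≈bs (trans (*-congˡ {const b} s≈c) (sym (ι-* b c)))

  τ : Elt
  τ = ⟦ χ ⟧

  abstract
    equivariant⇒multiple : ∀ f → Equivariant χ (coeff f) → ∃ λ c → f ≈ const c ⊗ τ
    equivariant⇒multiple f eqv = descent χ χ-periodic χ-zero f eqv

  private
    coeff-σ-τ : ∀ u → Unit (+ n) u → ∀ k → coeff (σ u τ) k ≡ χ u * χ k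
    coeff-σ-τ u (v , n∣) k = ≡.trans (coeff-periodic (σ u τ) k (u * (v * k)) (∣-by (- k) n∣ (eq u v k)))
      (≡.trans (coeff-σ u (v , n∣) τ (v * k)) (≡.trans (coeff-⟦⟧ χ-periodic (v * k))
        (≡.trans (χ-* v k) (cong (_* χ k) (χ-inverse u v n∣)))))
      where
      eq : ∀ u v k → k - u * (v * k) ≡ - k * (u * v - + 1)
      eq = solve-∀

    x≡-x : ∀ x → x ≡ - x → x ≡ + 0
    x≡-x x eq = case (ℤₚ.i*j≡0⇒i≡0∨j≡0 (+ 2) (≡.trans (double x) (≡.trans (cong (_+_ x) eq) (ℤₚ.+-inverseʳ x))))
      where
      double : ∀ x → + 2 * x ≡ x + x
      double = solve-∀
      case : + 2 ≡ + 0 ⊎ x ≡ + 0 → x ≡ + 0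
      case (inj₂ x≡0) = x≡0

  -- If p ∣ b, a unit u ≡ 1 modulo n/p with χ u = -1 satisfies x^(bu) = x^b, so σ b τ is its own negative.
  σ-τ : ∀ b → σ b τ ≈ const (χ b) ⊗ τ
  σ-τ b with nonunit-factor b
  ... | inj₁ unit = of-coeff (σ b τ) (const (χ b) ⊗ τ) λ k → ≡.trans (coeff-σ-τ b unit k)
        (≡.sym (≡.trans (act-const⊗ (χ b) τ (ind (+ n)) k) (cong (χ b *_) (coeff-⟦⟧ χ-periodic k))))
  ... | inj₂ (p , p∈ , p∣b) with jacobi-primitive ss pps ps! p∈
  ...   | u , unit′ , χu≡-1 , u≡1 = trans (mk≈ λ k → x≡-x _ (σ-τ-negates k))
          (sym (trans (*-congʳ {τ} (trans (reflexive (cong const (χ-zero p∈ b p∣b))) ι-0)) ≈-refl))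
    where
    unit : Unit (+ n) u
    unit = subst (λ m → Unit (+ m) u) n≡ unit′

    bu≡b : + n ∣ b * u - b
    bu≡b = p∣⇒n∣ at
      where
      eq : ∀ b u → b * (u - + 1) ≡ b * u - b
      eq = solve-∀
      at : ∀ {q} → q ∈ ps → + q ∣ b * u - b
      at {q} q∈ with p ℕ.≟ q
      ... | yes refl = subst (+ q ∣_) (eq b u) (∣m⇒∣m*n (u - + 1) p∣b)
      ... | no p≢q   = subst (+ q ∣_) (eq b u) (∣n⇒∣m*n b (u≡1 q∈ p≢q))

    τ-negated : ∀ k → coeff τ k ≡ coeff (⊖ σ u τ) k
    τ-negated k = ≡.trans (coeff-⟦⟧ χ-periodic k) (≡.sym (≡.trans (act-⊖ (ind (+ n)) (σ u τ) k)
      (≡.trans (cong -_ (≡.trans (coeff-σ-τ u unit k) (cong (_* χ k) χu≡-1))) (eq (χ k)))))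
      where
      eq : ∀ a → - (- + 1 * a) ≡ a
      eq = solve-∀

    σ-τ-negates : ∀ k → act (σ b τ) w k ≡ - act (σ b τ) w k
    σ-τ-negates k = ≡.trans (σ-determines w-periodic b τ (⊖ σ u τ) τ-negated k)
      (≡.trans (cong (λ f → act f w k) (≡.trans (σ-⊖ b (σ u τ)) (cong ⊖_ (σ-σ b u τ))))
      (≡.trans (act-⊖ w (σ (b * u) τ) k) (cong -_ (σ-cong w-periodic (b * u) b bu≡b τ k))))

  ones : ℤ → ℤ
  ones _ = + 1

  -- Some prime p of n does not divide c. With c v ≡ 1 modulo p, the reindexing b ↦ b + e v
  -- multiplies Σ_b x^(c b) by x^(c e v) = x^e, so the sum is fixed by x^e and represents 0.
  power-sum-vanishes : ∀ c → ¬ + n ∣ c → σ c ⟦ ones ⟧ ≈ []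
  power-sum-vanishes c n∤c with All.all? (λ p → + p ∣? c) ps
  ... | yes all = contradiction (p∣⇒n∣ (All.lookup all)) n∤c
  ... | no ¬all with find (Allₚ.¬All⇒Any¬ (λ p → + p ∣? c) ps ¬all)
  ...   | p , p∈ , p∤c with unit⊎∣ (All.lookup pps p∈) c
  ...     | inj₂ p∣c = contradiction p∣c p∤c
  ...     | inj₁ (v , p∣) = invariant⇒0 p∈ (σ c ⟦ ones ⟧) λ k → ≡.trans (act-σ c ⟦ ones ⟧ (ind (+ n)) (k - e p∈))
              (≡.trans (act-cong ⟦ ones ⟧ (λ j → ind-cong (k - e p∈ + c * j) (k + c * (j - e p∈ * v))
                 (subst (+ n ∣_) (eq k (e p∈) c v j) (e-cong p∈ (c * v - + 1) p∣))) (+ 0))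
              (≡.trans (act-shift ⟦ ones ⟧ (λ j → ind (+ n) (k + c * j)) (e p∈ * v) (+ 0))
              (≡.trans (translate (λ j → ind (+ n) (k + c * j)) (σ-periodic ind-cong c k) (+ 0 - e p∈ * v) (+ 0))
                (≡.sym (act-σ c ⟦ ones ⟧ (ind (+ n)) k)))))
    where
    eq : ∀ k e c v j → e * (c * v - + 1) ≡ k - e + c * j - (k + c * (j - e * v))
    eq = solve-∀

    act-const-fun : ∀ f k k′ → act f (λ _ → + 1) k ≡ act f (λ _ → + 1) k′
    act-const-fun []            k k′ = refl
    act-const-fun ((c , e) ∷ f) k k′ = cong (_+_ (c * + 1)) (act-const-fun f k k′)

    translate : ∀ v → Periodic (+ n) v → ∀ i j → act ⟦ ones ⟧ v i ≡ act ⟦ ones ⟧ v j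
    translate v per i j = ≡.trans (to-const i) (≡.trans (act-const-fun ⟦ v ⟧ i j) (≡.sym (to-const j)))
      where
      to-const : ∀ i → act ⟦ ones ⟧ v i ≡ act ⟦ v ⟧ (λ _ → + 1) i
      to-const i = ≡.trans (act-coeff per ⟦ ones ⟧ i) (act-cong ⟦ v ⟧ (coeff-⟦⟧ (λ _ _ _ → refl)) i)

  act-ones : ∀ c v → (∀ k j → v (k - c * + j) ≡ v k) → ∀ l k → act (σ c (coeffs-on ones l)) v k ≡ + length l * v k
  act-ones c v inv []      k = ≡.sym (ℤₚ.*-zeroˡ (v k))
  act-ones c v inv (j ∷ l) k = ≡.trans (cong₂ (λ x y → + 1 * x + y) (inv k j) (act-ones c v inv l k)) (eq (+ length l) (v k))
    where
    eq : ∀ l x → + 1 * x + l * x ≡ (+ 1 + l) * x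
    eq = solve-∀

  power-sum-trivial : ∀ c → + n ∣ c → σ c ⟦ ones ⟧ ≈ const (+ n)
  power-sum-trivial c n∣c = mk≈ λ k → ≡.trans
    (act-ones c w (λ k j → w-periodic (k - c * + j) k (∣-by (- + j) n∣c (eq k c (+ j)))) (upTo n) k)
    (≡.trans (cong (λ m → + m * w k) (Listₚ.length-upTo n))
      (≡.sym (≡.trans (ℤₚ.+-identityʳ _) (cong (λ i → + n * w i) (ℤₚ.+-identityʳ k)))))
    where
    eq : ∀ k c j → k - c * j - k ≡ - j * c
    eq = solve-∀

  -- If x^c f = f, then n f = (Σ_b x^(cb)) f = 0.
  regular : ∀ c → ¬ + n ∣ c → Series.Regular R (x^ c ++ ⊖ const (+ 1))
  regular c n∤c f [x^c-1]f≈0 = mk≈ λ k → cancel (ℤₚ.i*j≡0⇒i≡0∨j≡0 (+ n) (n*F≡0 k))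
    where
    F : ℤ → ℤ
    F = act f w

    F-step : ∀ k → F (k - c) ≡ F k
    F-step k = ≡.trans (eq (F (k - c)) (F (k - + 0)))
      (≡.trans (cong₂ _+_ (≡.trans (≡.sym (act-⊗ w (x^ c ++ ⊖ const (+ 1)) f k)) (act≡ [x^c-1]f≈0 k)) (cong F (ℤₚ.+-identityʳ k)))
        (ℤₚ.+-identityˡ (F k)))
      where
      eq : ∀ a b → a ≡ + 1 * a + (- + 1 * b + + 0) + b
      eq = solve-∀

    F-steps : ∀ k j → F (k - c * + j) ≡ F k
    F-steps k zero    = cong F (eq k c)
      where
      eq : ∀ k c → k - c * + 0 ≡ k
      eq = solve-∀
    F-steps k (suc j) = ≡.trans (cong F (eq k c (+ j))) (≡.trans (F-step (k - c * + j)) (F-steps k j))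
      where
      eq : ∀ k c j → k - c * (+ 1 + j) ≡ k - c * j - c
      eq = solve-∀

    n*F≡0 : ∀ k → + n * F k ≡ + 0
    n*F≡0 k = ≡.trans (cong (λ m → + m * F k) (≡.sym (Listₚ.length-upTo n)))
      (≡.trans (≡.sym (act-ones c F F-steps (upTo n) k))
      (≡.trans (act-comm (σ c ⟦ ones ⟧) f w k)
      (≡.trans (act-cong f (act≡ (power-sum-vanishes c n∤c)) k) (act-0 f k))))

    cancel : ∀ {x} → + n ≡ + 0 ⊎ x ≡ + 0 → x ≡ + 0
    cancel (inj₁ n≡0) = contradiction (ℤₚ.+-injective n≡0) (ℕ.≢-nonZero⁻¹ n)
    cancel (inj₂ x≡0) = x≡0

  private
    -- The double sum of χ(a) x^(b + a b) over b in l and a in l′, grouped by b and by a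
    -- respectively.
    columns rows : List ℕ → List ℕ → Elt
    columns []      l′ = []
    columns (b ∷ l) l′ = x^ (+ b) ⊗ σ (+ b) (coeffs-on χ l′) ++ columns l l′
    rows l []       = []
    rows l (a ∷ l′) = const (χ (+ a)) ⊗ σ (+ 1 + + a) (coeffs-on ones l) ++ rows l l′

    rows-∷ : ∀ b l l′ k → act (rows (b ∷ l) l′) w k ≡ act (σ (+ b) (coeffs-on χ l′)) w (k - + b) + act (rows l l′) w k
    rows-∷ b l []       k = refl
    rows-∷ b l (a ∷ l′) k = ≡.trans
      (≡.trans (act-++ w (const (χ (+ a)) ⊗ σ (+ 1 + + a) (coeffs-on ones (b ∷ l))) (rows (b ∷ l) l′) k)
        (cong₂ _+_ (act-const⊗ (χ (+ a)) (σ (+ 1 + + a) (coeffs-on ones (b ∷ l))) w k) (rows-∷ b l l′ k)))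
      (≡.trans (cong (λ i → χ (+ a) * (+ 1 * w i + r) + (y + z)) (eq k (+ a) (+ b)))
      (≡.trans (eq′ (χ (+ a)) (w (k - + b - + b * + a)) r y z)
        (cong (_+_ (χ (+ a) * w (k - + b - + b * + a) + y)) (≡.sym
          (≡.trans (act-++ w (const (χ (+ a)) ⊗ σ (+ 1 + + a) (coeffs-on ones l)) (rows l l′) k)
            (cong (_+ z) (act-const⊗ (χ (+ a)) (σ (+ 1 + + a) (coeffs-on ones l)) w k)))))))
      where
      r y z : ℤ
      r = act (σ (+ 1 + + a) (coeffs-on ones l)) w k
      y = act (σ (+ b) (coeffs-on χ l′)) w (k - + b)
      z = act (rows l l′) w k
      eq : ∀ k a b → k - (+ 1 + a) * b ≡ k - b - b * a
      eq = solve-∀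
      eq′ : ∀ c x r y z → c * (+ 1 * x + r) + (y + z) ≡ c * x + y + (c * r + z)
      eq′ = solve-∀

    act-x^⊗ : ∀ e f k → act (x^ e ⊗ f) w k ≡ act f w (k - e)
    act-x^⊗ e f k = ≡.trans (act-⊗ w (x^ e) f k) (eq (act f w (k - e)))
      where
      eq : ∀ a → + 1 * a + + 0 ≡ a
      eq = solve-∀

    columns≈rows : ∀ l l′ k → act (columns l l′) w k ≡ act (rows l l′) w k
    columns≈rows []      l′ k = ≡.sym (rows-[] l′ k)
      where
      rows-[] : ∀ l′ k → act (rows [] l′) w k ≡ + 0
      rows-[] []       k = refl
      rows-[] (a ∷ l′) k = rows-[] l′ k
    columns≈rows (b ∷ l) l′ k = ≡.trans (act-++ w (x^ (+ b) ⊗ σ (+ b) (coeffs-on χ l′)) (columns l l′) k)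
      (≡.trans (cong₂ _+_ (act-x^⊗ (+ b) (σ (+ b) (coeffs-on χ l′)) k) (columns≈rows l l′ k)) (≡.sym (rows-∷ b l l′ k)))

    τ⊗≈columns : ∀ l → coeffs-on χ l ⊗ τ ≈ columns l (upTo n)
    τ⊗≈columns []      = ≈-refl
    τ⊗≈columns (b ∷ l) = +-cong {(χ (+ b) , + b) · τ} {x^ (+ b) ⊗ σ (+ b) τ}
      (trans (mk≈ (λ k → ≡.trans (act-· w (χ (+ b)) (+ b) τ k)
          (≡.sym (≡.trans (act-x^⊗ (+ b) (const (χ (+ b)) ⊗ τ) k) (act-const⊗ (χ (+ b)) τ w (k - + b))))))
        (*-congˡ {x^ (+ b)} (sym (σ-τ (+ b)))))
      (τ⊗≈columns l)

    -- The inner sum over b is n or 0 according as n divides 1 + a or not. The total is n times the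
    -- coefficient at -1 of the sum of χ(a) x^a over l, a form that suits induction on l.
    rows≈const : ∀ l → rows (upTo n) l ≈ const (coeff (coeffs-on χ l) (- + 1) * + n)
    rows≈const []      = sym ι-0
    rows≈const (a ∷ l) = trans (+-cong (term (χ (+ a))) (rows≈const l))
      (trans (sym (ι-+ (χ (+ a) * ind (+ n) (- + 1 - + a) * + n) (coeff (coeffs-on χ l) (- + 1) * + n)))
        (reflexive (cong const (≡.sym (ℤₚ.*-distribʳ-+ (+ n) (χ (+ a) * ind (+ n) (- + 1 - + a)) _)))))
      where
      eq : ∀ a → - + 1 - a ≡ - (+ 1 + a)
      eq = solve-∀
      eq′ : ∀ a → + 1 + a ≡ - (- + 1 - a)
      eq′ = solve-∀

      term : ∀ c → const c ⊗ σ (+ 1 + + a) ⟦ ones ⟧ ≈ const (c * ind (+ n) (- + 1 - + a) * + n)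
      term c with + n ∣? (- + 1 - + a)
      ... | yes n∣ = trans (*-congˡ {const c} (power-sum-trivial (+ 1 + + a) (∣-by (- + 1) n∣ (≡.trans (eq′ (+ a)) (≡.sym (ℤₚ.-1*i≡-i (- + 1 - + a)))))))
        (trans (sym (ι-* c (+ n))) (reflexive (cong (λ i → const (i * + n)) (≡.sym (ℤₚ.*-identityʳ c)))))
      ... | no n∤  = trans (*-congˡ {const c} (power-sum-vanishes (+ 1 + + a) λ n∣ → n∤ (∣-by (- + 1) n∣ (≡.trans (eq (+ a)) (≡.sym (ℤₚ.-1*i≡-i (+ 1 + + a)))))))
        (trans (sym ι-0) (reflexive (cong (λ i → const (i * + n)) (≡.sym (ℤₚ.*-zeroʳ c)))))

  -- τ² = Σ_b χ(b) x^b τ = Σ_b x^b σ_b(τ) = Σ_a χ(a) Σ_b x^((1+a)b), where only a ≡ -1 contributes.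
  gauss : τ ⊗ τ ≈ const (+ n)
  gauss = begin
    τ ⊗ τ                              ≈⟨ τ⊗≈columns (upTo n) ⟩
    columns (upTo n) (upTo n)          ≈⟨ mk≈ (columns≈rows (upTo n) (upTo n)) ⟩
    rows (upTo n) (upTo n)             ≈⟨ rows≈const (upTo n) ⟩
    const (coeff τ (- + 1) * + n)      ≡⟨ cong (λ i → const (i * + n)) (≡.trans (coeff-⟦⟧ χ-periodic (- + 1)) jacobi-neg) ⟩
    const (+ 1 * + n)                  ≡⟨ cong const (ℤₚ.*-identityˡ (+ n)) ⟩
    const (+ n)                        ∎

-- Cancellable elements, and identities for r + r^-1.

module RegularElements {c ℓ} (A : ℤAlgebra c ℓ) where
  open ℤAlgebra A renaming (_+_ to _⊕_; _*_ to _⊛_; -_ to ⊝_; _-_ to _⊖′_; ι to ι′)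
  open AlgebraSolver A
  open Series A using (Regular)
  open SetoidReasoning setoid

  regular-resp : ∀ {a b} → a ≈ b → Regular a → Regular b
  regular-resp a≈b reg x bx≈0 = reg x (trans (*-congʳ a≈b) bx≈0)

  regular-* : ∀ a b → Regular a → Regular b → Regular (a ⊛ b)
  regular-* a b ra rb x abx≈0 = rb x (ra (b ⊛ x) (trans (sym (*-assoc a b x)) abx≈0))

  regular-factor : ∀ {a b} → Regular (a ⊛ b) → Regular a
  regular-factor {a} {b} rab x ax≈0 = rab x (begin
    a ⊛ b ⊛ x   ≈⟨ solve 3 (λ a b x → a :* b :* x := b :* (a :* x)) ≈-refl a b x ⟩
    b ⊛ (a ⊛ x) ≈⟨ trans (*-congˡ ax≈0) (zeroʳ b) ⟩
    0#          ∎)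

  regular-unit : ∀ {a} b → a ⊛ b ≈ 1# → Regular a
  regular-unit {a} b ab≈1 x ax≈0 = begin
    x           ≈⟨ *-identityˡ x ⟨
    1# ⊛ x      ≈⟨ *-congʳ ab≈1 ⟨
    a ⊛ b ⊛ x   ≈⟨ solve 3 (λ a b x → a :* b :* x := b :* (a :* x)) ≈-refl a b x ⟩
    b ⊛ (a ⊛ x) ≈⟨ trans (*-congˡ ax≈0) (zeroʳ b) ⟩
    0#          ∎

  product-factor : ∀ {i} {I : Set i} (v : I → Carrier) {d l} → d ∈ l → ∃ λ r → foldr _⊛_ 1# (map v l) ≈ v d ⊛ r
  product-factor v {l = _ ∷ l} (here refl) = _ , ≈-refl
  product-factor v {l = x ∷ l} (there d∈) with product-factor v d∈
  ... | r , eq = v x ⊛ r , trans (*-congˡ eq) (solve 3 (λ a b c → a :* (b :* c) := b :* (a :* c)) ≈-refl _ _ r)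

  cancel-regular : ∀ {i} {I : Set i} (v : I → Carrier) l {b} → (∀ {d} → d ∈ l → Regular (v d)) →
    foldr _⊛_ 1# (map v (l ++ b ∷ [])) ≈ 0# → v b ≈ 0#
  cancel-regular v []      regs p = trans (sym (*-identityʳ _)) p
  cancel-regular v (x ∷ l) regs p = cancel-regular v l (λ d∈ → regs (there d∈)) (regs (here refl) _ p)

  square-shift : ∀ r r′ → r ⊛ r′ ≈ 1# → (1# ⊕ r) ⊛ (1# ⊕ r) ≈ r ⊛ (ι′ (+ 2) ⊕ (r ⊕ r′))
  square-shift r r′ rr′≈1 = begin
    (1# ⊕ r) ⊛ (1# ⊕ r)                 ≈⟨ *-cong (+-congʳ (sym ι-1)) (+-congʳ (sym ι-1)) ⟩
    (ι′ (+ 1) ⊕ r) ⊛ (ι′ (+ 1) ⊕ r)     ≈⟨ solve 1 (λ r → (con (+ 1) :+ r) :* (con (+ 1) :+ r) := con (+ 1) :+ r :* (con (+ 2) :+ r)) ≈-refl r ⟩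
    ι′ (+ 1) ⊕ r ⊛ (ι′ (+ 2) ⊕ r)       ≈⟨ +-congʳ (trans ι-1 (sym rr′≈1)) ⟩
    r ⊛ r′ ⊕ r ⊛ (ι′ (+ 2) ⊕ r)         ≈⟨ solve 2 (λ r s → r :* s :+ r :* (con (+ 2) :+ r) := r :* (con (+ 2) :+ (r :+ s))) ≈-refl r r′ ⟩
    r ⊛ (ι′ (+ 2) ⊕ (r ⊕ r′))           ∎

  -- The factorisation of λ_b - λ_a, with r = x^a and s = x^b, into an invertible element and two
  -- factors of the form x^c - 1, each cancellable by `regular`.
  pair-difference : ∀ r r′ s s′ → r ⊛ r′ ≈ 1# → s ⊛ s′ ≈ 1# →
    s′ ⊛ ((s ⊛ r′ ⊕ ⊝ ι′ (+ 1)) ⊛ (s ⊛ r ⊕ ⊝ ι′ (+ 1))) ≈ (ι′ (+ 2) ⊕ (s ⊕ s′)) ⊖′ (ι′ (+ 2) ⊕ (r ⊕ r′))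
  pair-difference r r′ s s′ rr′≈1 ss′≈1 = begin
    s′ ⊛ ((s ⊛ r′ ⊕ ⊝ ι′ (+ 1)) ⊛ (s ⊛ r ⊕ ⊝ ι′ (+ 1)))
      ≈⟨ solve 4 (λ r r′ s s′ → s′ :* ((s :* r′ :+ (:- con (+ 1))) :* (s :* r :+ (:- con (+ 1))))
           := (s :* s′) :* (s :* (r :* r′) :- (r :+ r′)) :+ s′) ≈-refl r r′ s s′ ⟩
    s ⊛ s′ ⊛ (s ⊛ (r ⊛ r′) ⊖′ (r ⊕ r′)) ⊕ s′
      ≈⟨ +-congʳ (*-cong (trans ss′≈1 (sym ι-1)) (+-congʳ (*-congˡ (trans rr′≈1 (sym ι-1))))) ⟩
    ι′ (+ 1) ⊛ (s ⊛ ι′ (+ 1) ⊖′ (r ⊕ r′)) ⊕ s′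
      ≈⟨ solve 4 (λ r r′ s s′ → con (+ 1) :* (s :* con (+ 1) :- (r :+ r′)) :+ s′
           := (con (+ 2) :+ (s :+ s′)) :- (con (+ 2) :+ (r :+ r′))) ≈-refl r r′ s s′ ⟩
    (ι′ (+ 2) ⊕ (s ⊕ s′)) ⊖′ (ι′ (+ 2) ⊕ (r ⊕ r′)) ∎

-- Divisor products and the constant terms of cyclotomic polynomials.

divisors-last : ∀ n → divisors n ≡ filter (λ d → d ℕ∣.∣? n) (upTo n) ++ n ∷ []
divisors-last n = ≡.trans (cong (filter (λ d → d ℕ∣.∣? n)) (≡.sym (Listₚ.upTo-∷ʳ n)))
  (≡.trans (Listₚ.filter-++ (λ d → d ℕ∣.∣? n) (upTo n) (n ∷ []))
    (cong (filter (λ d → d ℕ∣.∣? n) (upTo n) ++_) (Listₚ.filter-accept (λ d → d ℕ∣.∣? n) {n} {[]} ℕ∣.∣-refl)))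

module ConstantTerm (Φ : ℕ → Poly₁) (Φ-cyclotomic : IsCyclotomicFamily Φ) where

  private
    prod₀ : List ℕ → ℤ
    prod₀ = foldr (λ d z → Φ d 0 * z) (+ 1)

    prod-0 : ∀ l → foldr _*₁_ one₁ (map Φ l) 0 ≡ prod₀ l
    prod-0 []      = refl
    prod-0 (d ∷ l) = cong (Φ d 0 *_) (prod-0 l)

    prod₀-++ : ∀ l l′ → prod₀ (l ++ l′) ≡ prod₀ l * prod₀ l′
    prod₀-++ []      l′ = ≡.sym (ℤₚ.*-identityˡ _)
    prod₀-++ (d ∷ l) l′ = ≡.trans (cong (Φ d 0 *_) (prod₀-++ l l′)) (≡.sym (ℤₚ.*-assoc (Φ d 0) _ _))

    prod₀-one : ∀ l → (∀ {d} → d ∈ l → Φ d 0 ≡ + 1) → prod₀ l ≡ + 1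
    prod₀-one []      _    = refl
    prod₀-one (d ∷ l) ones = cong₂ _*_ (ones (here refl)) (prod₀-one l (λ d∈ → ones (there d∈)))

    total : ∀ n → prod₀ (divisors (suc n)) ≡ - + 1
    total n = ≡.trans (≡.sym (prod-0 (divisors (suc n)))) (≡.trans (proj₂ Φ-cyclotomic (suc n) (s≤s z≤n) 0)
      (cong (_- + 1) (ℤₚ.*-zeroˡ ((q₁ ^₁ n) 0))))

    Φ₁ : Φ 1 0 * + 1 ≡ - + 1
    Φ₁ = total 0

  -- At q = 0 the product over all divisors is -1. The divisor 1 already contributes -1 and the
  -- divisors strictly between 1 and n contribute 1 by induction, which leaves 1 for n. This yields
  -- γ_0 = 1 below.
  Φ-0 : ∀ n → 2 ≤ n → Φ n 0 ≡ + 1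
  Φ-0 = <-rec _ step
    where
    step : ∀ n → (∀ {m} → m < n → 2 ≤ m → Φ m 0 ≡ + 1) → 2 ≤ n → Φ n 0 ≡ + 1
    step n@(suc (suc k)) rec _ = solve-neg (Φ n 0) (begin
      - + 1 * (Φ n 0 * + 1)                      ≡⟨ cong (_* (Φ n 0 * + 1)) proper ⟨
      prod₀ (filter ∣n? (upTo n)) * prod₀ (n ∷ []) ≡⟨ prod₀-++ (filter ∣n? (upTo n)) (n ∷ []) ⟨
      prod₀ (filter ∣n? (upTo n) ++ n ∷ [])      ≡⟨ cong prod₀ (divisors-last n) ⟨
      prod₀ (divisors n)                         ≡⟨ total (suc k) ⟩
      - + 1                                      ∎)
      where
      open ≡.≡-Reasoning
      ∣n? : ∀ d → Dec (d ℕ∣.∣ n)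
      ∣n? d = d ℕ∣.∣? n

      rest : List ℕ
      rest = applyUpTo (λ i → suc (suc i)) k

      proper : prod₀ (filter ∣n? (upTo n)) ≡ - + 1
      proper = begin
        prod₀ (filter ∣n? (0 ∷ 1 ∷ rest)) ≡⟨ cong prod₀ (Listₚ.filter-reject ∣n? {0} {1 ∷ rest} λ 0∣n → ℕₚ.1+n≢0 (ℕ∣.0∣⇒≡0 0∣n)) ⟩
        prod₀ (filter ∣n? (1 ∷ rest))     ≡⟨ cong prod₀ (Listₚ.filter-accept ∣n? {1} {rest} (ℕ∣.1∣ n)) ⟩
        Φ 1 0 * prod₀ (filter ∣n? rest)   ≡⟨ cong (Φ 1 0 *_) (prod₀-one (filter ∣n? rest) λ d∈ → small (proj₁ (∈ₚ.∈-filter⁻ ∣n? d∈))) ⟩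
        Φ 1 0 * + 1                       ≡⟨ Φ₁ ⟩
        - + 1                             ∎
        where
        small : ∀ {d} → d ∈ rest → Φ d 0 ≡ + 1
        small d∈ with ∈ₚ.∈-applyUpTo⁻ (λ i → suc (suc i)) d∈
        ... | i , i<k , refl = rec (s≤s (s≤s i<k)) (s≤s (s≤s z≤n))

      solve-neg : ∀ a → - + 1 * (a * + 1) ≡ - + 1 → a ≡ + 1
      solve-neg a eq = ≡.trans (alg a) (cong -_ eq)
        where
        alg : ∀ a → a ≡ - (- + 1 * (a * + 1))
        alg = solve-∀
    step (suc zero) _ (s≤s ())

-- The γ-expansion and its factorisation over the units up to sign.

half-double : ∀ m → (m ℕ.+ m) / 2 ≡ m
half-double m = ≡.trans (cong (_/ 2) (≡.trans (cong (m ℕ.+_) (≡.sym (ℕₚ.+-identityʳ m))) (ℕₚ.*-comm 2 m))) (m*n/n≡m m 2)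

lucasTerm : ℕ → (ℕ → ℤ) → ℕ → Poly₁
lucasTerm φ γ j = const₁ (γ j) *₁ ((q₁ ^₁ j) *₁ ((one₁ +₁ q₁) ^₁ (φ ∸ 2 ℕ.* j)))

LucasExpansion : ℕ → (ℕ → ℤ) → Poly₁
LucasExpansion φ γ = Σ₁ (φ / 2) (lucasTerm φ γ)

expansion-0 : ∀ φ γ → LucasExpansion φ γ 0 ≡ γ 0
expansion-0 φ γ = ≡.trans (only-first (φ / 2) λ j → ≡.trans (cong (γ (suc j) *_)
    (≡.trans (cong (_* ((one₁ +₁ q₁) ^₁ (φ ∸ 2 ℕ.* suc j)) 0) (ℤₚ.*-zeroˡ ((q₁ ^₁ j) 0))) (ℤₚ.*-zeroˡ (((one₁ +₁ q₁) ^₁ (φ ∸ 2 ℕ.* suc j)) 0)))) (ℤₚ.*-zeroʳ (γ (suc j))))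
  (≡.trans (cong (λ i → γ 0 * (+ 1 * i)) (pow-0 φ)) (ℤₚ.*-identityʳ (γ 0)))
  where
  only-first : ∀ m {f} → (∀ j → f (suc j) ≡ + 0) → Σ≤ m f ≡ f 0
  only-first zero    f≡0 = refl
  only-first (suc m) f≡0 = ≡.trans (cong₂ _+_ (only-first m f≡0) (f≡0 m)) (ℤₚ.+-identityʳ _)

  pow-0 : ∀ k → ((one₁ +₁ q₁) ^₁ k) 0 ≡ + 1
  pow-0 zero    = refl
  pow-0 (suc k) = ≡.trans (ℤₚ.*-identityˡ _) (pow-0 k)

module GammaProduct (S : Modulus) (Φ : ℕ → Poly₁) (Φ-cyclotomic : IsCyclotomicFamily Φ) where

  open Modulus S
  open GaussSum S public
  open Evaluation R using (Ev; Ev-exists; Ev-unique; Ev-prod; Ev-resp; Ev--; Ev-^; Ev-q; Ev-one; Ev-Σ; Ev-*; Ev-+; Ev-const; gamma-expansion)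
    renaming (_^_ to _^ᴿ_)
  open RegularElements R
  open Series R public using (Ser; Regular; roots; prod; ev)

  x^-^ : ∀ a k → (x^ a) ^ᴿ k ≈ x^ (a * + k)
  x^-^ a zero    = reflexive (cong x^_ (≡.sym (ℤₚ.*-zeroʳ a)))
  x^-^ a (suc k) = trans (*-congˡ {x^ a} (x^-^ a k)) (reflexive (cong x^_ (eq a (+ k))))
    where
    eq : ∀ a k → a + a * k ≡ a * (+ 1 + k)
    eq = solve-∀

  x^-periodic : ∀ a b → + n ∣ a - b → x^ a ≈ x^ b
  x^-periodic a b n∣ = mk≈ λ k → cong (λ i → + 1 * i + + 0) (w-periodic (k - a) (k - b) (∣-by (- + 1) n∣ (eq k a b)))
    where
    eq : ∀ k a b → k - a - (k - b) ≡ - + 1 * (a - b)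
    eq = solve-∀

  module _ (a : ℤ) (unit : Unit (+ n) a) where

    private
      value : ℕ → Elt
      value d = proj₁ (Ev-exists (x^ a) _ (Φ d) (proj₂ (proj₁ Φ-cyclotomic d)))

      value-Ev : ∀ d → Ev (x^ a) (Φ d) (value d)
      value-Ev d = proj₂ (Ev-exists (x^ a) _ (Φ d) (proj₂ (proj₁ Φ-cyclotomic d)))

      prod-values : List ℕ → Elt
      prod-values l = foldr _⊗_ (const (+ 1)) (map value l)

      product-value : ∀ d → 1 ≤ d → prod-values (divisors d) ≈ x^ (a * + d) ++ ⊖ const (+ 1)
      product-value d 1≤d = trans
        (Ev-unique (x^ a) (Ev-prod (x^ a) Φ value value-Ev (divisors d))
          (Ev-resp (x^ a) (λ i → ≡.sym (proj₂ Φ-cyclotomic d 1≤d i)) ≈-refl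
            (Ev-- (x^ a) (Ev-^ (x^ a) d (Ev-q (x^ a))) (Ev-one (x^ a)))))
        (+-congʳ {⊖ const (+ 1)} (x^-^ a d))

      proper-regular : ∀ d → 1 ≤ d → d < n → Regular (value d)
      proper-regular d 1≤d d<n = regular-factor {value d} (regular-resp
        (trans (sym (product-value d 1≤d)) (proj₂ (product-factor value {d} (∈ₚ.∈-filter⁺ (λ e → e ℕ∣.∣? d) (∈ₚ.∈-upTo⁺ ℕₚ.≤-refl) ℕ∣.∣-refl))))
        (regular (a * + d) λ n∣ → ℕ∣.>⇒∤ {{ℕ.>-nonZero 1≤d}} d<n (∣⇒∣ᵤ (unit-cancel a unit n∣))))

      value-n : value n ≈ []
      value-n = cancel-regular value (filter (λ e → e ℕ∣.∣? n) (upTo n)) {n}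
        (λ {d} d∈ → let (d∈′ , d∣n) = ∈ₚ.∈-filter⁻ (λ e → e ℕ∣.∣? n) {xs = upTo n} d∈
                    in proper-regular d (positive d d∣n) (∈ₚ.∈-upTo⁻ d∈′))
        (trans (reflexive (cong prod-values (≡.sym (divisors-last n)))) (trans (product-value n (ℕₚ.≤-trans (s≤s z≤n) 2≤n))
          (trans (+-congʳ {⊖ const (+ 1)} (x^-periodic (a * + n) (+ 0) (∣-by a ∣-refl (ℤₚ.+-identityʳ (a * + n))))) (ℤAlgebra.-‿inverseʳ R (const (+ 1))))))
        where
        positive : ∀ d → d ℕ∣.∣ n → 1 ≤ d
        positive zero    0∣n = contradiction (ℕ∣.0∣⇒≡0 0∣n) (ℕ.≢-nonZero⁻¹ n)
        positive (suc d) _   = s≤s z≤n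

    -- The product of Φ_d(x^a) over d dividing n is x^(an) - 1 = 0. For d < n the factor Φ_d(x^a)
    -- divides x^(ad) - 1, which is cancellable since n does not divide a d; so the last factor
    -- vanishes.
    Φ-root : Ev (x^ a) (Φ n) []
    Φ-root = Ev-resp (x^ a) (λ _ → refl) value-n (value-Ev n)

  x^-inverse : ∀ a → x^ a ⊗ x^ (- a) ≈ const (+ 1)
  x^-inverse a = reflexive (cong x^_ (ℤₚ.+-inverseʳ a))

  pair-regular : ∀ a b → ¬ + n ∣ b - a → ¬ + n ∣ b + a → Regular (pair b ++ ⊖ pair a)
  pair-regular a b n∤b-a n∤b+a = regular-resp
    (pair-difference (x^ a) (x^ (- a)) (x^ b) (x^ (- b)) (x^-inverse a) (x^-inverse b))
    (regular-* (x^ (- b)) ((x^ (b - a) ++ ⊖ const (+ 1)) ⊗ (x^ (b + a) ++ ⊖ const (+ 1))) (regular-unit {x^ (- b)} (x^ b) (reflexive (cong x^_ (ℤₚ.+-inverseˡ b))))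
      (regular-* (x^ (b - a) ++ ⊖ const (+ 1)) (x^ (b + a) ++ ⊖ const (+ 1)) (regular (b - a) n∤b-a) (regular (b + a) n∤b+a)))

  module _ (γ : ℕ → ℤ) (m : ℕ) (lucas : Φ n ≈₁ LucasExpansion (m ℕ.+ m) γ) where

    -- By the γ-expansion, 0 = Φ_n(x^a) = x^(am) Σ γ_j λ_a^(m-j), and x^(am) is invertible.
    pair-root : ∀ a → Unit (+ n) a → ev (pair a) (λ j → const (γ j)) m ≈ []
    pair-root a unit = regular-unit {r ^ᴿ m} ((x^ (- a)) ^ᴿ m) inverse-pow _ (begin
      r ^ᴿ m ⊗ ev (pair a) (λ j → const (γ j)) m                    ≈⟨ *-congˡ {r ^ᴿ m} (sym (*-identityˡ _)) ⟩
      r ^ᴿ m ⊗ (const (+ 1) ⊗ ev (pair a) (λ j → const (γ j)) m)    ≈⟨ gamma-expansion r m γ (square-shift r (x^ (- a)) (x^-inverse a)) m 0 (ℕₚ.+-identityʳ m) ⟨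
      Evaluation.sumTo R r m (λ j → const (γ j) ⊗ (r ^ᴿ j ⊗ (const (+ 1) ++ r) ^ᴿ (m ℕ.+ m ∸ 2 ℕ.* j)))
        ≈⟨ Ev-unique r (Ev-resp r (λ i → cong (λ h → Σ₁ h (lucasTerm (m ℕ.+ m) γ) i) (≡.sym (half-double m))) ≈-refl
             (Ev-Σ r m (λ j → Ev-* r (Ev-const r (γ j)) (Ev-* r (Ev-^ r j (Ev-q r)) (Ev-^ r (m ℕ.+ m ∸ 2 ℕ.* j) (Ev-+ r (Ev-one r) (Ev-q r)))))))
             (Ev-resp r lucas ≈-refl (Φ-root a unit)) ⟩
      [] ∎)
      where
      open SetoidReasoning setoid
      r : Elt
      r = x^ a

      inverse-pow : r ^ᴿ m ⊗ (x^ (- a)) ^ᴿ m ≈ const (+ 1)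
      inverse-pow = trans (*-cong (x^-^ a m) (x^-^ (- a) m)) (reflexive (cong x^_ (eq a (+ m))))
        where
        eq : ∀ a m → a * m + - a * m ≡ + 0
        eq = solve-∀

    -- The expansion constrains γ only up to index m, whereas `roots` asks for a polynomial of
    -- degree at most m; the values beyond are replaced by 0.
    γ-truncated : Ser
    γ-truncated j with j ℕₚ.≤? m
    ... | yes _ = const (γ j)
    ... | no  _ = []

    γ-≤ : ∀ j → j ≤ m → γ-truncated j ≈ const (γ j)
    γ-≤ j j≤m with j ℕₚ.≤? m
    ... | yes _  = ≈-refl
    ... | no j≰m = contradiction j≤m j≰m

    γ-> : ∀ j → m < j → γ-truncated j ≈ []
    γ-> j m<j with j ℕₚ.≤? m
    ... | yes j≤m = contradiction j≤m (ℕₚ.<⇒≱ m<j)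
    ... | no _    = ≈-refl

    ev-truncated : ∀ t j → j ≤ m → ev t γ-truncated j ≈ ev t (λ i → const (γ i)) j
    ev-truncated t zero    j≤m = γ-≤ 0 j≤m
    ev-truncated t (suc j) j≤m = +-cong (γ-≤ (suc j) j≤m) (*-congˡ {t} (ev-truncated t j (ℕₚ.<⇒≤ j≤m)))

    -- A polynomial of degree m with m roots λ_a whose differences are cancellable is its leading
    -- coefficient times the product of the linear factors; here that coefficient is γ_0 = Φ_n(0) =
    -- 1.
    γ≈prod : ∀ (H : List ℕ) → length H ≡ m → Unique H → (∀ {a} → a ∈ H → Unit (+ n) (+ a)) →
      (∀ {a b} → a ∈ H → b ∈ H → a ≢ b → (¬ + n ∣ + b - + a) × (¬ + n ∣ + b + + a)) →
      ∀ j → γ-truncated j ≈ prod (map (λ a → pair (+ a)) H) j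
    γ≈prod H length-H H! units separated j = trans
      (roots l γ-truncated
        (λ j l<j → γ-> j (subst (_< j) length-l l<j))
        (Allₚ.map⁺ (All.tabulate λ {a} a∈ → trans (reflexive (cong (ev (pair (+ a)) γ-truncated) length-l))
          (trans (ev-truncated (pair (+ a)) m ℕₚ.≤-refl) (pair-root (+ a) (units a∈)))))
        (AllPairs-map (λ {a} {b} a∈ b∈ a≢b → pair-regular (+ a) (+ b) (proj₁ (separated a∈ b∈ a≢b)) (proj₂ (separated a∈ b∈ a≢b))) H!) j)
      (trans (*-congʳ {prod l j} (trans (γ-≤ 0 z≤n) (reflexive (cong const γ₀)))) (*-identityˡ (prod l j)))
      where
      l : List Elt
      l = map (λ a → pair (+ a)) H

      length-l : length l ≡ m
      length-l = ≡.trans (Listₚ.length-map (λ a → pair (+ a)) H) length-H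

      γ₀ : γ 0 ≡ + 1
      γ₀ = ≡.trans (≡.sym (expansion-0 (m ℕ.+ m) γ)) (≡.trans (≡.sym (lucas 0)) (ConstantTerm.Φ-0 Φ Φ-cyclotomic n 2≤n))

-- Representatives of the units up to sign, split by the value of χ.

unit∌0 : ∀ {n} → 2 ≤ n → ¬ Unit (+ n) (+ 0)
unit∌0 {n} 2≤n (v , n∣) = ℕₚ.<⇒≱ 2≤n (ℕ∣.∣⇒≤ (∣⇒∣ᵤ (subst (+ n ∣_) (cong (_- + 1) (ℤₚ.*-zeroˡ v)) n∣)))

module HalfSystem (S : Modulus) where

  open Modulus S
  open GaussSum S

  χ-0 : χ (+ 0) ≡ + 0
  χ-0 with nonunit-factor (+ 0)
  ... | inj₁ unit          = contradiction unit (unit∌0 2≤n)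
  ... | inj₂ (p , p∈ , p∣0) = χ-zero p∈ (+ 0) p∣0

  χ≢0⇒unit : ∀ {k} → χ k ≢ + 0 → Unit (+ n) k
  χ≢0⇒unit {k} χ≢0 with nonunit-factor k
  ... | inj₁ unit           = unit
  ... | inj₂ (p , p∈ , p∣k) = contradiction (χ-zero p∈ k p∣k) χ≢0

  infix 4 _≈±_
  _≈±_ : ℤ → ℤ → Set
  a ≈± b = (+ n ∣ a - b) ⊎ (+ n ∣ a + b)

  ≈±-sym : ∀ a b → a ≈± b → b ≈± a
  ≈±-sym a b (inj₁ p) = inj₁ (∣-sym a b p)
  ≈±-sym a b (inj₂ p) = inj₂ (subst (+ n ∣_) (ℤₚ.+-comm a b) p)

  ≈±-trans : ∀ a b c → a ≈± b → b ≈± c → a ≈± c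
  ≈±-trans a b c (inj₁ p) (inj₁ q) = inj₁ (∣-by₂ (+ 1) (+ 1) p q (eq a b c))
    where eq : ∀ a b c → a - c ≡ + 1 * (a - b) + + 1 * (b - c)
          eq = solve-∀
  ≈±-trans a b c (inj₁ p) (inj₂ q) = inj₂ (∣-by₂ (+ 1) (+ 1) p q (eq a b c))
    where eq : ∀ a b c → a + c ≡ + 1 * (a - b) + + 1 * (b + c)
          eq = solve-∀
  ≈±-trans a b c (inj₂ p) (inj₁ q) = inj₂ (∣-by₂ (+ 1) (- + 1) p q (eq a b c))
    where eq : ∀ a b c → a + c ≡ + 1 * (a + b) + - + 1 * (b - c)
          eq = solve-∀
  ≈±-trans a b c (inj₂ p) (inj₂ q) = inj₁ (∣-by₂ (+ 1) (- + 1) p q (eq a b c))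
    where eq : ∀ a b c → a - c ≡ + 1 * (a + b) + - + 1 * (b + c)
          eq = solve-∀

  ≈±-* : ∀ u a b → a ≈± b → u * a ≈± u * b
  ≈±-* u a b (inj₁ p) = inj₁ (∣-by u p (eq u a b))
    where eq : ∀ u a b → u * a - u * b ≡ u * (a - b)
          eq = solve-∀
  ≈±-* u a b (inj₂ p) = inj₂ (∣-by u p (eq u a b))
    where eq : ∀ u a b → u * a + u * b ≡ u * (a + b)
          eq = solve-∀

  χ-≈± : ∀ a b → a ≈± b → χ a ≡ χ b
  χ-≈± a b (inj₁ p) = χ-periodic a b p
  χ-≈± a b (inj₂ p) = ≡.trans (χ-periodic a (- b) (subst (λ c → + n ∣ a + c) (≡.sym (ℤₚ.neg-involutive b)) p)) (χ-neg b)

  ≤h⇒<n : ∀ {a} → a ≤ h → a < n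
  ≤h⇒<n a≤h = subst (_ <_) (≡.sym n≡1+2h) (s≤s (ℕₚ.≤-trans a≤h (ℕₚ.m≤m+n h h)))

  half-unique : ∀ {a b} → a ≤ h → b ≤ h → + a ≈± + b → a ≡ b
  half-unique         a≤h b≤h (inj₁ n∣a-b) = residue-unique (≤h⇒<n a≤h) (≤h⇒<n b≤h) n∣a-b
  half-unique {a} {b} a≤h b≤h (inj₂ n∣a+b) = ≡.trans (ℕₚ.m+n≡0⇒m≡0 a a+b≡0) (≡.sym (ℕₚ.m+n≡0⇒n≡0 a a+b≡0))
    where
    a+b≡0 : a ℕ.+ b ≡ 0
    a+b≡0 = ℤₚ.+-injective (small-multiple (+ (a ℕ.+ b)) n∣a+b (subst (a ℕ.+ b <_) (≡.sym n≡1+2h) (s≤s (ℕₚ.+-mono-≤ a≤h b≤h))))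

  rep : ℤ → ℕ
  rep k with k %ℕ n ℕₚ.≤? h
  ... | yes _ = k %ℕ n
  ... | no  _ = n ∸ k %ℕ n

  n∸-≤h : ∀ {r} → ¬ r ≤ h → n ∸ r ≤ h
  n∸-≤h {r} r≰h = ℕₚ.≤-trans (ℕₚ.∸-monoʳ-≤ n (ℕₚ.≰⇒> r≰h))
    (ℕₚ.≤-reflexive (≡.trans (cong (_∸ suc h) n≡1+2h) (ℕₚ.m+n∸n≡m h h)))

  n∸-≈± : ∀ {r} → r ≤ n → + r ≈± + (n ∸ r)
  n∸-≈± {r} r≤n = inj₂ (subst (+ n ∣_) (cong +_ (≡.sym (ℕₚ.m+[n∸m]≡n r≤n))) ∣-refl)

  rep-≤ : ∀ k → rep k ≤ h
  rep-≤ k with k %ℕ n ℕₚ.≤? h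
  ... | yes r≤h = r≤h
  ... | no  r≰h = n∸-≤h r≰h

  rep-≈± : ∀ k → + rep k ≈± k
  rep-≈± k with k %ℕ n ℕₚ.≤? h
  ... | yes _ = ≈±-sym k (+ (k %ℕ n)) (inj₁ (%ℕ-cong k n))
  ... | no  _ = ≈±-sym k (+ (n ∸ k %ℕ n)) (≈±-trans k (+ (k %ℕ n)) (+ (n ∸ k %ℕ n)) (inj₁ (%ℕ-cong k n))
                  (n∸-≈± (ℕₚ.<⇒≤ (n%ℕd<d k n))))

  H : ℤ → List ℕ
  H ε = filter (λ a → χ (+ a) ℤ.≟ ε) (applyUpTo suc h)

  H! : ∀ ε → Unique (H ε)
  H! ε = Uniqueₚ.filter⁺ (λ a → χ (+ a) ℤ.≟ ε) (Uniqueₚ.applyUpTo⁺₁ suc h (λ i<j _ → ℕₚ.<⇒≢ (s≤s i<j)))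

  H⁻ : ∀ {ε a} → a ∈ H ε → 1 ≤ a × a ≤ h × χ (+ a) ≡ ε
  H⁻ {ε} a∈ with ∈ₚ.∈-filter⁻ (λ a → χ (+ a) ℤ.≟ ε) {xs = applyUpTo suc h} a∈
  ... | a∈′ , χa≡ε with ∈ₚ.∈-applyUpTo⁻ suc a∈′
  ...   | i , i<h , refl = s≤s z≤n , i<h , χa≡ε

  H⁺ : ∀ {ε} a → ε ≢ + 0 → a ≤ h → χ (+ a) ≡ ε → a ∈ H ε
  H⁺     zero    ε≢0 _   χ0≡ε = contradiction (≡.trans (≡.sym χ0≡ε) χ-0) ε≢0
  H⁺ {ε} (suc a) _   a<h χa≡ε = ∈ₚ.∈-filter⁺ (λ a → χ (+ a) ℤ.≟ ε) (∈ₚ.∈-applyUpTo⁺ suc a<h) χa≡ε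

  χ-*-cancel : ∀ u v → + n ∣ u * v - + 1 → ∀ ε → χ v * (χ u * ε) ≡ ε
  χ-*-cancel u v n∣ ε = ≡.trans (cong (_* (χ u * ε)) (χ-inverse u v n∣)) (≡.trans (≡.sym (ℤₚ.*-assoc (χ u) (χ u) ε))
    (≡.trans (cong (_* ε) (χ-unit u (v , n∣))) (ℤₚ.*-identityˡ ε)))

  times-H : ∀ u → Unit (+ n) u → ∀ ε → ε ≢ + 0 → χ u * ε ≢ + 0 → map (λ a → rep (u * + a)) (H ε) ↭ H (χ u * ε)
  times-H u (v , n∣) ε ε≢0 χuε≢0 = map-↭ {π′ = λ a → rep (v * + a)} (H! ε) (H! (χ u * ε))
    (λ {a} a∈ → let (_ , a≤h , χa≡ε) = H⁻ a∈ in
      H⁺ _ χuε≢0 (rep-≤ (u * + a)) (≡.trans (χ-rep u a) (cong (χ u *_) χa≡ε)) , inverse u v n∣ a≤h)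
    (λ {a} a∈ → let (_ , a≤h , χa≡) = H⁻ a∈ in
      H⁺ _ ε≢0 (rep-≤ (v * + a)) (≡.trans (χ-rep v a) (≡.trans (cong (χ v *_) χa≡) (χ-*-cancel u v n∣ ε))) ,
      inverse v u (subst (λ c → + n ∣ c - + 1) (ℤₚ.*-comm u v) n∣) a≤h)
    where
    χ-rep : ∀ u a → χ (+ rep (u * + a)) ≡ χ u * χ (+ a)
    χ-rep u a = ≡.trans (χ-≈± (+ rep (u * + a)) (u * + a) (rep-≈± (u * + a))) (χ-* u (+ a))

    inverse : ∀ u v → + n ∣ u * v - + 1 → ∀ {a} → a ≤ h → rep (v * + rep (u * + a)) ≡ a
    inverse u v n∣ {a} a≤h = half-unique (rep-≤ (v * + rep (u * + a))) a≤h
      (≈±-trans (+ rep (v * + rep (u * + a))) (v * + rep (u * + a)) (+ a) (rep-≈± (v * + rep (u * + a)))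
      (≈±-trans (v * + rep (u * + a)) (v * (u * + a)) (+ a) (≈±-* v (+ rep (u * + a)) (u * + a) (rep-≈± (u * + a)))
        (inj₁ (∣-by (+ a) n∣ (eq u v (+ a))))))
      where
      eq : ∀ u v a → v * (u * a) - a ≡ a * (u * v - + 1)
      eq = solve-∀

  -- Multiplication by a unit u with χ(u) = -1 exchanges the two halves.
  length-H : length (H (- + 1)) ≡ length (H (+ 1))
  length-H = from-nonresidue (nonempty ps n≡)
    where
    nonempty : ∀ ps → product ps ≡ n → ∃ (_∈ ps)
    nonempty []      1≡n = contradiction (subst (2 ≤_) (≡.sym 1≡n) 2≤n) (ℕₚ.<-irrefl refl)
    nonempty (p ∷ _) _   = p , here refl

    from-nonresidue : ∃ (_∈ ps) → length (H (- + 1)) ≡ length (H (+ 1))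
    from-nonresidue (p , p∈) with jacobi-primitive ss pps ps! p∈
    ... | u , unit , χu≡-1 , _ = ≡.trans (cong (length ∘ H) (≡.sym χu*1≡-1)) (≡.trans
      (≡.sym (↭ₚ.↭-length (times-H u (subst (λ m → Unit (+ m) u) n≡ unit) (+ 1) (λ ()) (λ χu*1≡0 → minus-one≢0 (≡.trans (≡.sym χu*1≡-1) χu*1≡0)))))
      (Listₚ.length-map (λ a → rep (u * + a)) (H (+ 1))))
      where
      χu*1≡-1 : χ u * + 1 ≡ - + 1
      χu*1≡-1 = cong (_* + 1) χu≡-1
      minus-one≢0 : - + 1 ≢ + 0
      minus-one≢0 ()

  H± : List ℕ
  H± = H (+ 1) ++ H (- + 1)

  H±⁻ : ∀ {a} → a ∈ H± → a ≤ h × Unit (+ n) (+ a)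
  H±⁻ a∈ with ∈ₚ.∈-++⁻ (H (+ 1)) a∈
  ... | inj₁ a∈₁ = proj₁ (proj₂ (H⁻ a∈₁)) , χ≢0⇒unit λ χ≡0 → one≢0 (≡.trans (≡.sym (proj₂ (proj₂ (H⁻ a∈₁)))) χ≡0)
    where one≢0 : + 1 ≢ + 0
          one≢0 ()
  ... | inj₂ a∈₂ = proj₁ (proj₂ (H⁻ a∈₂)) , χ≢0⇒unit λ χ≡0 → one≢0 (≡.trans (≡.sym (proj₂ (proj₂ (H⁻ a∈₂)))) χ≡0)
    where one≢0 : - + 1 ≢ + 0
          one≢0 ()

  H±⁺ : ∀ a → a ≤ h → Unit (+ n) (+ a) → a ∈ H±
  H±⁺ a a≤h unit = by-sign (jacobi-sign ss (+ a)) refl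
    where
    by-sign : ∀ {ε} → Sign ε → χ (+ a) ≡ ε → a ∈ H±
    by-sign plus  χa≡1  = ∈ₚ.∈-++⁺ˡ (H⁺ a (λ ()) a≤h χa≡1)
    by-sign minus χa≡-1 = ∈ₚ.∈-++⁺ʳ (H (+ 1)) (H⁺ a (λ ()) a≤h χa≡-1)
    by-sign zero  χa≡0  with ≡.trans (≡.sym (χ-unit (+ a) unit)) (cong (λ x → x * x) χa≡0)
    ... | ()

  H±! : Unique H±
  H±! = Uniqueₚ.++⁺ (H! (+ 1)) (H! (- + 1)) λ (a∈₁ , a∈₂) → 1≢-1 (≡.trans (≡.sym (proj₂ (proj₂ (H⁻ a∈₁)))) (proj₂ (proj₂ (H⁻ a∈₂))))
    where
    1≢-1 : + 1 ≢ - + 1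
    1≢-1 ()

  H±-separated : ∀ {a b} → a ∈ H± → b ∈ H± → a ≢ b → (¬ + n ∣ + b - + a) × (¬ + n ∣ + b + + a)
  H±-separated a∈ b∈ a≢b =
    (λ n∣ → a≢b (≡.sym (half-unique (proj₁ (H±⁻ b∈)) (proj₁ (H±⁻ a∈)) (inj₁ n∣)))) ,
    (λ n∣ → a≢b (≡.sym (half-unique (proj₁ (H±⁻ b∈)) (proj₁ (H±⁻ a∈)) (inj₂ n∣))))

  coprimes : List ℕ
  coprimes = filter (λ k → gcd k n ℕ.≟ 1) (applyUpTo suc n)

  gcd≡1⇒unit : ∀ k → gcd k n ≡ 1 → Unit (+ n) (+ k)
  gcd≡1⇒unit k gcd≡1 with nonunit-factor (+ k)
  ... | inj₁ unit           = unit
  ... | inj₂ (p , p∈ , p∣k) = contradiction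
    (∣ᵤ⇒∣ (subst (p ℕ∣.∣_) gcd≡1 (GCD.gcd-greatest (∣⇒∣ᵤ p∣k) (∣⇒∣ᵤ (n∣⇒p∣ p∈ (∣-refl {+ n}))))))
    (prime∤1 (All.lookup pps p∈))

  unit⇒gcd≡1 : ∀ k → Unit (+ n) (+ k) → gcd k n ≡ 1
  unit⇒gcd≡1 k (v , n∣) = ℕ∣.∣1⇒≡1 (∣⇒∣ᵤ (∣-by₂ {+ gcd k n} v (- + 1) (∣ᵤ⇒∣ (GCD.gcd[m,n]∣m k n)) (∣-trans (∣ᵤ⇒∣ (GCD.gcd[m,n]∣n k n)) n∣) (eq (+ k) v)))
    where
    eq : ∀ k v → + 1 ≡ v * k + - + 1 * (k * v - + 1)
    eq = solve-∀

  -- Each unit in 1, ..., n is either at most h or the reflection n - a of one that is, never both,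
  -- because n = 2h + 1. This serves to evaluate the totient and to regroup τ into terms x^a + x^-a.
  coprimes-↭ : coprimes ↭ H± ++ map (n ∸_) H±
  coprimes-↭ = ∼bag⇒↭ (∈ₚK.unique∧set⇒bag
      (Uniqueₚ.filter⁺ (λ k → gcd k n ℕ.≟ 1) (Uniqueₚ.applyUpTo⁺₁ suc n (λ i<j _ → ℕₚ.<⇒≢ (s≤s i<j))))
      (Uniqueₚ.++⁺ H±! (map-Unique {π′ = n ∸_} (λ a∈ → ℕₚ.m∸[m∸n]≡n (ℕₚ.<⇒≤ (≤h⇒<n (proj₁ (H±⁻ a∈))))) H±!) disjoint)
      (mk⇔ to from))
    where
    above : ∀ {a} → a ≤ h → ¬ n ∸ a ≤ h
    above {a} a≤h n∸a≤h = ℕₚ.<⇒≱ {h ℕ.+ h} {n} (subst (h ℕ.+ h <_) (≡.sym n≡1+2h) (ℕₚ.n<1+n _))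
      (subst (_≤ h ℕ.+ h) (ℕₚ.m+[n∸m]≡n (ℕₚ.<⇒≤ (≤h⇒<n a≤h))) (ℕₚ.+-mono-≤ a≤h n∸a≤h))

    disjoint : ∀ {a} → ¬ (a ∈ H± × a ∈ map (n ∸_) H±)
    disjoint (a∈₁ , a∈₂) with ∈ₚ.∈-map⁻ (n ∸_) a∈₂
    ... | b , b∈ , refl = above (proj₁ (H±⁻ b∈)) (proj₁ (H±⁻ a∈₁))

    unit-∸ : ∀ {a} → a ≤ n → Unit (+ n) (+ a) → Unit (+ n) (+ (n ∸ a))
    unit-∸ {a} a≤n unit = unit-cong (- + a) (+ (n ∸ a)) (∣-by (- + 1) ∣-refl (≡.trans (eq (+ a) (+ (n ∸ a)))
      (cong (- + 1 *_) (cong +_ (ℕₚ.m+[n∸m]≡n a≤n))))) (unit-neg {u = + a} unit)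
      where
      eq : ∀ a b → - a - b ≡ - + 1 * (a + b)
      eq = solve-∀

    unit-positive : ∀ k → Unit (+ n) (+ k) → k ≤ n → k ∈ applyUpTo suc n
    unit-positive zero    unit _   = contradiction unit (unit∌0 2≤n)
    unit-positive (suc k) _    k<n = ∈ₚ.∈-applyUpTo⁺ suc k<n

    to : ∀ {k} → k ∈ coprimes → k ∈ H± ++ map (n ∸_) H±
    to {k} k∈ with ∈ₚ.∈-filter⁻ (λ k → gcd k n ℕ.≟ 1) {xs = applyUpTo suc n} k∈
    ... | k∈′ , gcd≡1 with ∈ₚ.∈-applyUpTo⁻ suc k∈′
    ...   | i , i<n , refl with suc i ℕₚ.≤? h
    ...     | yes k≤h = ∈ₚ.∈-++⁺ˡ (H±⁺ (suc i) k≤h (gcd≡1⇒unit (suc i) gcd≡1))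
    ...     | no k≰h  = ∈ₚ.∈-++⁺ʳ H± (subst (_∈ map (n ∸_) H±) (ℕₚ.m∸[m∸n]≡n i<n)
                          (∈ₚ.∈-map⁺ (n ∸_) (H±⁺ (n ∸ suc i) (n∸-≤h k≰h) (unit-∸ i<n (gcd≡1⇒unit (suc i) gcd≡1)))))

    from : ∀ {k} → k ∈ H± ++ map (n ∸_) H± → k ∈ coprimes
    from {k} k∈ with ∈ₚ.∈-++⁻ H± k∈
    ... | inj₁ k∈₁ = coprime (proj₂ (H±⁻ k∈₁)) (ℕₚ.<⇒≤ (≤h⇒<n (proj₁ (H±⁻ k∈₁))))
      where
      coprime : ∀ {k} → Unit (+ n) (+ k) → k ≤ n → k ∈ coprimes
      coprime {k} unit k≤n = ∈ₚ.∈-filter⁺ (λ k → gcd k n ℕ.≟ 1) (unit-positive k unit k≤n) (unit⇒gcd≡1 k unit)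
    ... | inj₂ k∈₂ with ∈ₚ.∈-map⁻ (n ∸_) k∈₂
    ...   | a , a∈ , refl = ∈ₚ.∈-filter⁺ (λ k → gcd k n ℕ.≟ 1) (unit-positive (n ∸ a) unit (ℕₚ.m∸n≤m n a)) (unit⇒gcd≡1 (n ∸ a) unit)
      where
      unit : Unit (+ n) (+ (n ∸ a))
      unit = unit-∸ (ℕₚ.<⇒≤ (≤h⇒<n (proj₁ (H±⁻ a∈)))) (proj₂ (H±⁻ a∈))

  totient-half : totient n ≡ length H± ℕ.+ length H±
  totient-half = ≡.trans (↭ₚ.↭-length coprimes-↭) (≡.trans (Listₚ.length-++ H±) (cong (length H± ℕ.+_) (Listₚ.length-map (n ∸_) H±)))

  length-H± : length H± ≡ length (H (+ 1)) ℕ.+ length (H (+ 1))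
  length-H± = ≡.trans (Listₚ.length-++ (H (+ 1))) (cong (length (H (+ 1)) ℕ.+_) length-H)

-- The half products and the Galois action on their coefficients.

σ-prod : ∀ w u l j → σ u (Series.prod (weightedAlgebra w) l j) ≡ Series.prod (weightedAlgebra w) (map (σ u) l) j
σ-prod w u []      zero    = cong (λ e → (+ 1 , e) ∷ []) (ℤₚ.*-zeroʳ u)
σ-prod w u []      (suc j) = refl
σ-prod w u (t ∷ l) zero    = σ-prod w u l zero
σ-prod w u (t ∷ l) (suc j) = ≡.trans (σ-++ u (prod l (suc j)) (⊖ (t ⊗ prod l j)))
  (cong₂ _++_ (σ-prod w u l (suc j)) (≡.trans (σ-⊖ u (t ⊗ prod l j)) (cong ⊖_ (≡.trans (σ-⊗ u t (prod l j)) (cong (σ u t ⊗_) (σ-prod w u l j))))))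
  where open Series (weightedAlgebra w)

-- The weight enters the equality of the ring but none of its operations. One formal product can
-- thus be read both in ℤ[ℤ/n] and in ℤ[x].
prod-weight : ∀ w w′ l j → Series.prod (weightedAlgebra w) l j ≡ Series.prod (weightedAlgebra w′) l j
prod-weight w w′ []      zero    = refl
prod-weight w w′ []      (suc j) = refl
prod-weight w w′ (t ∷ l) zero    = prod-weight w w′ l zero
prod-weight w w′ (t ∷ l) (suc j) = cong₂ (λ a b → a ++ ⊖ (t ⊗ b)) (prod-weight w w′ l (suc j)) (prod-weight w w′ l j)

module HalfProducts (S : Modulus) where

  open Modulus S
  open GaussSum S
  open HalfSystem S
  open Series R using (prod; prod-1; prod-0; sum)

  Γ : ℤ → ℕ → Elt
  Γ ε = prod (map (λ a → pair (+ a)) (H ε))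

  private
    -- With δ as weight, equality is equality of coefficients, so this is ℤ[ℤ/n] itself. Galois
    -- symmetry is established here because `descent` asks for equivariance of coefficients.
    Rδ : ℤAlgebra _ _
    Rδ = weightedAlgebra (ind (+ n))

    module δ = ℤAlgebra Rδ
    module Serδ = Series Rδ

    x^-δ : ∀ a b → + n ∣ a - b → x^ a δ.≈ x^ b
    x^-δ a b n∣ = mk≈ λ k → cong (λ i → + 1 * i + + 0) (ind-cong (k - a) (k - b) (∣-by (- + 1) n∣ (eq k a b)))
      where
      eq : ∀ k a b → k - a - (k - b) ≡ - + 1 * (a - b)
      eq = solve-∀

    pair-δ : ∀ a b → a ≈± b → pair a δ.≈ pair b
    pair-δ a b (inj₁ n∣) = δ.+-congˡ {const (+ 2)} (δ.+-cong (x^-δ a b n∣) (x^-δ (- a) (- b) (∣-by (- + 1) n∣ (eq a b))))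
      where
      eq : ∀ a b → - a - - b ≡ - + 1 * (a - b)
      eq = solve-∀
    pair-δ a b (inj₂ n∣) = δ.+-congˡ {const (+ 2)} (δ.trans (δ.+-comm (x^ a) (x^ (- a)))
      (δ.+-cong (x^-δ (- a) b (∣-by (- + 1) n∣ (eq a b))) (x^-δ a (- b) (∣-by (+ 1) n∣ (eq′ a b)))))
      where
      eq : ∀ a b → - a - b ≡ - + 1 * (a + b)
      eq = solve-∀
      eq′ : ∀ a b → a - - b ≡ + 1 * (a + b)
      eq′ = solve-∀

    σ-pair : ∀ v a → σ v (pair a) ≡ pair (v * a)
    σ-pair v a = cong₂ (λ x y → (+ 2 , x) ∷ (+ 1 , v * a) ∷ (+ 1 , y) ∷ []) (ℤₚ.*-zeroʳ v) (≡.sym (ℤₚ.neg-distribʳ-* v a))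

  -- With v inverse to u, the coefficient of Γ_ε at u k is that of its image under x ↦ x^v at k. The
  -- substitution sends λ_a to λ_(va), so it permutes the factors of Γ_ε into those of Γ_(χ(v)ε),
  -- and χ(v) = χ(u).
  Γ-equivariant : ∀ u → Unit (+ n) u → ∀ ε → ε ≢ + 0 → χ u * ε ≢ + 0 → ∀ j k → coeff (Γ ε j) (u * k) ≡ coeff (Γ (χ u * ε) j) k
  Γ-equivariant u unit@(v , n∣) ε ε≢0 χuε≢0 j k = begin
    coeff (Γ ε j) (u * k)                        ≡⟨ coeff-σ v (unit-inverse {u = u} unit) (Γ ε j) (u * k) ⟨
    coeff (σ v (Γ ε j)) (v * (u * k))            ≡⟨ coeff-periodic (σ v (Γ ε j)) (v * (u * k)) k (∣-by k n∣ (eq u v k)) ⟩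
    coeff (σ v (Γ ε j)) k                        ≡⟨ cong (λ f → coeff f k) (σ-prod w v (map (λ a → pair (+ a)) (H ε)) j) ⟩
    coeff (prod (map (σ v) (map (λ a → pair (+ a)) (H ε))) j) k ≡⟨ cong (λ l → coeff (prod l j) k) (Listₚ.map-∘ (H ε)) ⟨
    coeff (prod (map (λ a → σ v (pair (+ a))) (H ε)) j) k ≡⟨ cong (λ f → coeff f k) (prod-weight w (ind (+ n)) (map (λ a → σ v (pair (+ a))) (H ε)) j) ⟩
    coeff (Serδ.prod (map (λ a → σ v (pair (+ a))) (H ε)) j) k ≡⟨ act≡ (Serδ.prod-cong (λ a → σ v (pair (+ a))) (λ a → pair (+ rep (v * + a)))
      (λ a → δ.trans (δ.reflexive (σ-pair v (+ a))) (pair-δ (v * + a) (+ rep (v * + a)) (≈±-sym (+ rep (v * + a)) (v * + a) (rep-≈± (v * + a))))) (H ε) j) k ⟩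
    coeff (Serδ.prod (map (λ a → pair (+ rep (v * + a))) (H ε)) j) k ≡⟨ cong (λ l → coeff (Serδ.prod l j) k) (Listₚ.map-∘ (H ε)) ⟩
    coeff (Serδ.prod (map (λ a → pair (+ a)) (map (λ a → rep (v * + a)) (H ε))) j) k
      ≡⟨ act≡ (Serδ.prod-↭ (↭ₚ.map⁺ (λ a → pair (+ a)) (times-H v (unit-inverse {u = u} unit) ε ε≢0 (subst (λ c → c * ε ≢ + 0) (≡.sym χv≡χu) χuε≢0))) j) k ⟩
    coeff (Serδ.prod (map (λ a → pair (+ a)) (H (χ v * ε))) j) k ≡⟨ cong (λ f → coeff f k) (prod-weight (ind (+ n)) w (map (λ a → pair (+ a)) (H (χ v * ε))) j) ⟩
    coeff (Γ (χ v * ε) j) k                      ≡⟨ cong (λ c → coeff (Γ (c * ε) j) k) χv≡χu ⟩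
    coeff (Γ (χ u * ε) j) k                      ∎
    where
    open ≡.≡-Reasoning
    χv≡χu : χ v ≡ χ u
    χv≡χu = χ-inverse u v n∣
    eq : ∀ u v k → v * (u * k) - k ≡ k * (u * v - + 1)
    eq = solve-∀

  U V : ℕ → Elt
  U j = Γ (+ 1) j ++ Γ (- + 1) j
  V j = Γ (+ 1) j ++ ⊖ Γ (- + 1) j

  χ-unit-sign : ∀ u → Unit (+ n) u → χ u ≡ + 1 ⊎ χ u ≡ - + 1
  χ-unit-sign u unit = by-sign (jacobi-sign ss u) (χ-unit u unit)
    where
    by-sign : ∀ {z} → Sign z → z * z ≡ + 1 → z ≡ + 1 ⊎ z ≡ - + 1
    by-sign plus  _ = inj₁ refl
    by-sign minus _ = inj₂ refl

  private
    Γ-at : ∀ u → Unit (+ n) u → ∀ ε ε′ → ε ≢ + 0 → ε′ ≢ + 0 → χ u * ε ≡ ε′ → ∀ j k → coeff (Γ ε j) (u * k) ≡ coeff (Γ ε′ j) k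
    Γ-at u unit ε _ ε≢0 χuε≢0 refl = Γ-equivariant u unit ε ε≢0 χuε≢0

    +≢0 : + 1 ≢ + 0
    +≢0 ()
    -≢0 : - + 1 ≢ + 0
    -≢0 ()

  U-invariant : ∀ j u → Unit (+ n) u → ∀ k → coeff (U j) (u * k) ≡ coeff (U j) k
  U-invariant j u unit k = ≡.trans (act-++ (ind (+ n)) (Γ (+ 1) j) (Γ (- + 1) j) (u * k))
    (≡.trans (swap (χ-unit-sign u unit)) (≡.sym (act-++ (ind (+ n)) (Γ (+ 1) j) (Γ (- + 1) j) k)))
    where
    swap : χ u ≡ + 1 ⊎ χ u ≡ - + 1 → coeff (Γ (+ 1) j) (u * k) + coeff (Γ (- + 1) j) (u * k) ≡ coeff (Γ (+ 1) j) k + coeff (Γ (- + 1) j) k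
    swap (inj₁ χu) = cong₂ _+_ (Γ-at u unit (+ 1) (+ 1) +≢0 +≢0 (cong (_* + 1) χu) j k) (Γ-at u unit (- + 1) (- + 1) -≢0 -≢0 (cong (_* - + 1) χu) j k)
    swap (inj₂ χu) = ≡.trans (cong₂ _+_ (Γ-at u unit (+ 1) (- + 1) +≢0 -≢0 (cong (_* + 1) χu) j k) (Γ-at u unit (- + 1) (+ 1) -≢0 +≢0 (cong (_* - + 1) χu) j k))
      (ℤₚ.+-comm (coeff (Γ (- + 1) j) k) (coeff (Γ (+ 1) j) k))

  V-equivariant : ∀ j → Equivariant χ (coeff (V j))
  V-equivariant j u unit k = ≡.trans (expand (u * k)) (≡.trans (swap (χ-unit-sign u unit)) (cong (χ u *_) (≡.sym (expand k))))
    where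
    expand : ∀ k → coeff (V j) k ≡ coeff (Γ (+ 1) j) k - coeff (Γ (- + 1) j) k
    expand k = ≡.trans (act-++ (ind (+ n)) (Γ (+ 1) j) (⊖ Γ (- + 1) j) k) (cong (_+_ (coeff (Γ (+ 1) j) k)) (act-⊖ (ind (+ n)) (Γ (- + 1) j) k))

    flip : ∀ a b → b - a ≡ - + 1 * (a - b)
    flip = solve-∀

    swap : χ u ≡ + 1 ⊎ χ u ≡ - + 1 → coeff (Γ (+ 1) j) (u * k) - coeff (Γ (- + 1) j) (u * k) ≡ χ u * (coeff (Γ (+ 1) j) k - coeff (Γ (- + 1) j) k)
    swap (inj₁ χu) = ≡.trans (cong₂ _-_ (Γ-at u unit (+ 1) (+ 1) +≢0 +≢0 (cong (_* + 1) χu) j k) (Γ-at u unit (- + 1) (- + 1) -≢0 -≢0 (cong (_* - + 1) χu) j k))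
      (≡.trans (≡.sym (ℤₚ.*-identityˡ _)) (cong (_* (coeff (Γ (+ 1) j) k - coeff (Γ (- + 1) j) k)) (≡.sym χu)))
    swap (inj₂ χu) = ≡.trans (cong₂ _-_ (Γ-at u unit (+ 1) (- + 1) +≢0 -≢0 (cong (_* + 1) χu) j k) (Γ-at u unit (- + 1) (+ 1) -≢0 +≢0 (cong (_* - + 1) χu) j k))
      (≡.trans (flip (coeff (Γ (+ 1) j) k) (coeff (Γ (- + 1) j) k)) (cong (_* (coeff (Γ (+ 1) j) k - coeff (Γ (- + 1) j) k)) (≡.sym χu)))

  private
    pairs : List ℕ → ℤ → ℤ
    pairs l k = act (sum (map (λ a → pair (+ a)) l)) w k

    both : List ℕ → ℤ → ℤ
    both l k = act (coeffs-on χ l) w k + act (coeffs-on χ (map (n ∸_) l)) w k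

    act-coeffs-++ : ∀ g l l′ k → act (coeffs-on g (l ++ l′)) w k ≡ act (coeffs-on g l) w k + act (coeffs-on g l′) w k
    act-coeffs-++ g l l′ k = ≡.trans (cong (λ f → act f w k) (Listₚ.map-++ (λ j → g (+ j) , + j) l l′)) (act-++ w (coeffs-on g l) (coeffs-on g l′) k)

    act-coeffs-↭ : ∀ g {l l′} → l ↭ l′ → ∀ k → act (coeffs-on g l) w k ≡ act (coeffs-on g l′) w k
    act-coeffs-↭ g ↭.refl         k = refl
    act-coeffs-↭ g (↭.prep x p)   k = cong (_+_ (g (+ x) * w (k - + x))) (act-coeffs-↭ g p k)
    act-coeffs-↭ g (↭.swap {l} {l′} x y p) k = ≡.trans (cong (λ a → g (+ x) * w (k - + x) + (g (+ y) * w (k - + y) + a)) (act-coeffs-↭ g p k))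
      (eq (g (+ x) * w (k - + x)) (g (+ y) * w (k - + y)) (act (coeffs-on g l′) w k))
      where
      eq : ∀ a b c → a + (b + c) ≡ b + (a + c)
      eq = solve-∀
    act-coeffs-↭ g (↭.trans p q)  k = ≡.trans (act-coeffs-↭ g p k) (act-coeffs-↭ g q k)

    -- x^a + x^(n-a) = λ_a - 2 and χ(n - a) = χ(a) = ε; the constants 2 are collected in the term
    -- with `length l`.
    both-pairs : ∀ ε l → (∀ {a} → a ∈ l → a ≤ h × χ (+ a) ≡ ε) → ∀ k → both l k ≡ ε * (pairs l k - + 2 * (+ length l * w k))
    both-pairs ε []      _     k = eq ε (w k)
      where
      eq : ∀ ε w → + 0 ≡ ε * (+ 0 - + 2 * (+ 0 * w))
      eq = solve-∀
    both-pairs ε (a ∷ l) props k = ≡.trans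
      (cong₂ (λ x y → x * w (k - + a) + act (coeffs-on χ l) w k + (y + act (coeffs-on χ (map (n ∸_) l)) w k)) χa≡ε reflected)
      (≡.trans (regroup ε (w (k - + a)) (w (k - - + a)) (act (coeffs-on χ l) w k) (act (coeffs-on χ (map (n ∸_) l)) w k))
      (≡.trans (cong (_+_ (ε * (w (k - + a) + w (k - - + a)))) (both-pairs ε l (λ b∈ → props (there b∈)) k))
      (≡.trans (eq ε (w (k - + a)) (w (k - - + a)) (pairs l k) (w k) (+ length l))
        (cong (λ i → ε * (+ 2 * i + (+ 1 * w (k - + a) + (+ 1 * w (k - - + a) + pairs l k)) - + 2 * ((+ 1 + + length l) * w k)))
          (cong w (≡.sym (ℤₚ.+-identityʳ k)))))))
      where
      a≤h : a ≤ h
      a≤h = proj₁ (props (here refl))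

      χa≡ε : χ (+ a) ≡ ε
      χa≡ε = proj₂ (props (here refl))

      n∣ : + n ∣ + (n ∸ a) + + a
      n∣ = subst (+ n ∣_) (cong +_ (≡.sym (ℕₚ.m∸n+n≡m (ℕₚ.<⇒≤ (≤h⇒<n a≤h))))) ∣-refl

      reflected : χ (+ (n ∸ a)) * w (k - + (n ∸ a)) ≡ ε * w (k - - + a)
      reflected = cong₂ _*_ (≡.trans (χ-≈± (+ (n ∸ a)) (+ a) (inj₂ n∣)) χa≡ε)
        (w-periodic (k - + (n ∸ a)) (k - - + a) (∣-by (- + 1) n∣ (eq k (+ (n ∸ a)) (+ a))))
        where
        eq : ∀ k b a → k - b - (k - - a) ≡ - + 1 * (b + a)
        eq = solve-∀

      regroup : ∀ ε x y u v → ε * x + u + (ε * y + v) ≡ ε * (x + y) + (u + v)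
      regroup = solve-∀

      eq : ∀ ε x y p z l → ε * (x + y) + ε * (p - + 2 * (l * z)) ≡ ε * (+ 2 * z + (+ 1 * x + (+ 1 * y + p)) - + 2 * ((+ 1 + l) * z))
      eq = solve-∀

    act-filter : ∀ {q} {Q : ℕ → Set q} (Q? : ∀ j → Dec (Q j)) → (∀ j → ¬ Q j → χ (+ j) ≡ + 0) →
      ∀ l k → act (coeffs-on χ l) w k ≡ act (coeffs-on χ (filter Q? l)) w k
    act-filter Q? χ≡0 []      k = refl
    act-filter Q? χ≡0 (j ∷ l) k with Q? j
    ... | yes q = cong (_+_ (χ (+ j) * w (k - + j))) (act-filter Q? χ≡0 l k)
    ... | no ¬q = ≡.trans (cong (λ c → c * w (k - + j) + act (coeffs-on χ l) w k) (χ≡0 j ¬q))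
                    (≡.trans (ℤₚ.+-identityˡ (act (coeffs-on χ l) w k)) (act-filter Q? χ≡0 l k))

    τ≡coprimes : ∀ k → act τ w k ≡ act (coeffs-on χ coprimes) w k
    -- τ runs over 0, ..., n - 1 and the list of coprimes is taken from 1, ..., n; the terms at 0
    -- and at n both vanish because χ does.
    τ≡coprimes k = ≡.trans (≡.sym (≡.trans (cong (λ l → act (coeffs-on χ l) w k) (≡.sym (Listₚ.upTo-∷ʳ n)))
        (≡.trans (act-coeffs-++ χ (upTo n) (n ∷ []) k) (≡.trans (cong (_+_ (act τ w k)) last-term) (ℤₚ.+-identityʳ _)))))
      (≡.trans (cong (λ c → c * w (k - + 0) + act (coeffs-on χ (applyUpTo suc n)) w k) χ-0)
        (≡.trans (ℤₚ.+-identityˡ (act (coeffs-on χ (applyUpTo suc n)) w k)) (filtered (applyUpTo suc n))))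
      where
      last-term : χ (+ n) * w (k - + n) + + 0 ≡ + 0
      last-term = cong (λ c → c * w (k - + n) + + 0) (≡.trans (χ-periodic (+ n) (+ 0) (∣-by (+ 1) ∣-refl (eq (+ n)))) χ-0)
        where
        eq : ∀ n → n - + 0 ≡ + 1 * n
        eq = solve-∀

      filtered : ∀ l → act (coeffs-on χ l) w k ≡ act (coeffs-on χ (filter (λ k → gcd k n ℕ.≟ 1) l)) w k
      filtered l = act-filter (λ k → gcd k n ℕ.≟ 1) (λ j gcd≢1 → vanishes j gcd≢1 (χ (+ j) ℤ.≟ + 0)) l k
        where
        vanishes : ∀ j → gcd j n ≢ 1 → Dec (χ (+ j) ≡ + 0) → χ (+ j) ≡ + 0
        vanishes j _     (yes χj≡0) = χj≡0
        vanishes j gcd≢1 (no χj≢0)  = contradiction (unit⇒gcd≡1 j (χ≢0⇒unit χj≢0)) gcd≢1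

    both-++ : ∀ l l′ k → both (l ++ l′) k ≡ both l k + both l′ k
    both-++ l l′ k = ≡.trans
      (cong₂ _+_ (act-coeffs-++ χ l l′ k) (≡.trans (cong (λ l → act (coeffs-on χ l) w k) (Listₚ.map-++ (n ∸_) l l′)) (act-coeffs-++ χ (map (n ∸_) l) (map (n ∸_) l′) k)))
      (eq (act (coeffs-on χ l) w k) (act (coeffs-on χ l′) w k) (act (coeffs-on χ (map (n ∸_) l)) w k) (act (coeffs-on χ (map (n ∸_) l′)) w k))
      where
      eq : ∀ a b c d → a + b + (c + d) ≡ a + c + (b + d)
      eq = solve-∀

    τ≡both : ∀ k → act τ w k ≡ both (H (+ 1)) k + both (H (- + 1)) k
    τ≡both k = ≡.trans (τ≡coprimes k) (≡.trans (act-coeffs-↭ χ coprimes-↭ k)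
      (≡.trans (act-coeffs-++ χ H± (map (n ∸_) H±) k) (both-++ (H (+ 1)) (H (- + 1)) k)))

  V₀ : V 0 ≈ []
  V₀ = trans (+-cong (prod-0 (map (λ a → pair (+ a)) (H (+ 1)))) (ℤAlgebra.-‿cong R (prod-0 (map (λ a → pair (+ a)) (H (- + 1)))))) (ℤAlgebra.-‿inverseʳ R (const (+ 1)))

  -- The coefficient of y in Γ_ε is -Σ λ_a. In the difference of the halves the constants 2 in the
  -- λ_a cancel, as both halves have the same size, and the remaining terms χ(a)(x^a + x^-a) add up
  -- to τ.
  V₁ : V 1 ≈ ⊖ τ
  V₁ = mk≈ λ k → begin
    act (V 1) w k                                 ≡⟨ act-++ w (Γ (+ 1) 1) (⊖ Γ (- + 1) 1) k ⟩
    act (Γ (+ 1) 1) w k + act (⊖ Γ (- + 1) 1) w k ≡⟨ cong₂ _+_ (linear (+ 1) k) (≡.trans (act-⊖ w (Γ (- + 1) 1) k) (cong -_ (linear (- + 1) k))) ⟩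
    - pairs (H (+ 1)) k - - pairs (H (- + 1)) k   ≡⟨ eq (pairs (H (+ 1)) k) (pairs (H (- + 1)) k) (+ length (H (+ 1)) * w k) ⟩
    - (+ 1 * (pairs (H (+ 1)) k - + 2 * (+ length (H (+ 1)) * w k)) + - + 1 * (pairs (H (- + 1)) k - + 2 * (+ length (H (+ 1)) * w k)))
      ≡⟨ cong (λ m → - (+ 1 * (pairs (H (+ 1)) k - + 2 * (+ length (H (+ 1)) * w k)) + - + 1 * (pairs (H (- + 1)) k - + 2 * (+ m * w k)))) length-H ⟨
    - (+ 1 * (pairs (H (+ 1)) k - + 2 * (+ length (H (+ 1)) * w k)) + - + 1 * (pairs (H (- + 1)) k - + 2 * (+ length (H (- + 1)) * w k)))
      ≡⟨ cong -_ (cong₂ _+_ (both-pairs (+ 1) (H (+ 1)) (λ a∈ → proj₂ (H⁻ a∈)) k) (both-pairs (- + 1) (H (- + 1)) (λ a∈ → proj₂ (H⁻ a∈)) k)) ⟨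
    - (both (H (+ 1)) k + both (H (- + 1)) k)     ≡⟨ cong -_ (τ≡both k) ⟨
    - act τ w k                                   ≡⟨ act-⊖ w τ k ⟨
    act (⊖ τ) w k                                 ∎
    where
    open ≡.≡-Reasoning
    linear : ∀ ε k → act (Γ ε 1) w k ≡ - pairs (H ε) k
    linear ε k = ≡.trans (act≡ (prod-1 (map (λ a → pair (+ a)) (H ε))) k) (act-⊖ w (sum (map (λ a → pair (+ a)) (H ε))) k)

    eq : ∀ p q l → - p - - q ≡ - (+ 1 * (p - + 2 * l) + - + 1 * (q - + 2 * l))
    eq = solve-∀

-- What the bivariate argument takes over from the ring. M = φ(n)/4 bounds the degrees in y of A and
-- B; `B₀≡0` lets a factor t be split off, while `A₀≢0` and `B₁≢0` provide the leading powers of s.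
record GaussFormula (n : ℕ) (γ : ℕ → ℤ) : Set where
  field
    M          : ℕ
    1≤M        : 1 ≤ M
    totient≡4M : totient n ≡ (M ℕ.+ M) ℕ.+ (M ℕ.+ M)
    A B        : ℕ → ℤ
    A-degree   : ∀ j → M < j → A j ≡ + 0
    B-degree   : ∀ j → M < j → B j ≡ + 0
    A₀≢0       : A 0 ≢ + 0
    B₀≡0       : B 0 ≡ + 0
    B₁≢0       : B 1 ≢ + 0
    formula    : ∀ j → j ≤ M ℕ.+ M → + 4 * γ j ≡ (A *₁ A) j - + n * (B *₁ B) j

-- The identity 4 γ = A² - n B².

module Descended (S : Modulus) where

  open Modulus S
  open GaussSum S
  open HalfSystem S
  open HalfProducts S
  open Series R using (prod; conv; conv-cong; conv-polar; conv-prod; conv-scale; prod-deg; prod-0; prod-↭)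
  open SetoidReasoning setoid

  private
    M : ℕ
    M = length (H (+ 1))

    abstract
      A : ℕ → ℤ
      A j = proj₁ (invariant⇒integer (U j) (U-invariant j))

      U≈A : ∀ j → U j ≈ const (A j)
      U≈A j = proj₂ (invariant⇒integer (U j) (U-invariant j))

      B : ℕ → ℤ
      B j = proj₁ (equivariant⇒multiple (V j) (V-equivariant j))

      V≈Bτ : ∀ j → V j ≈ const (B j) ⊗ τ
      V≈Bτ j = proj₂ (equivariant⇒multiple (V j) (V-equivariant j))

    -- Multiplication by τ turns b τ = 0 into b n = 0 in ℤ.
    multiple-zero : ∀ b → const b ⊗ τ ≈ [] → b ≡ + 0
    multiple-zero b bτ≈0 = cancel (ℤₚ.i*j≡0⇒i≡0∨j≡0 b (const-injective (b * + n) (+ 0) (begin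
      const (b * + n)       ≈⟨ ι-* b (+ n) ⟩
      const b ⊗ const (+ n) ≈⟨ *-congˡ {const b} gauss ⟨
      const b ⊗ (τ ⊗ τ)     ≈⟨ *-assoc (const b) τ τ ⟨
      const b ⊗ τ ⊗ τ       ≈⟨ *-congʳ {τ} bτ≈0 ⟩
      []                    ≈⟨ ι-0 ⟨
      const (+ 0)           ∎)))
      where
      cancel : b ≡ + 0 ⊎ + n ≡ + 0 → b ≡ + 0
      cancel (inj₁ b≡0) = b≡0
      cancel (inj₂ n≡0) = contradiction (ℤₚ.+-injective n≡0) (ℕ.≢-nonZero⁻¹ n)

    Γ-degree : ∀ ε j → length (H ε) < j → Γ ε j ≈ []
    Γ-degree ε j l<j = prod-deg (map (λ a → pair (+ a)) (H ε)) j (subst (_< j) (≡.sym (Listₚ.length-map (λ a → pair (+ a)) (H ε))) l<j)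

    A-degree : ∀ j → M < j → A j ≡ + 0
    A-degree j M<j = const-injective (A j) (+ 0) (trans (sym (U≈A j))
      (trans (+-cong (Γ-degree (+ 1) j M<j) (Γ-degree (- + 1) j (subst (_< j) (≡.sym length-H) M<j))) (sym ι-0)))

    B-degree : ∀ j → M < j → B j ≡ + 0
    B-degree j M<j = multiple-zero (B j) (trans (sym (V≈Bτ j))
      (+-cong (Γ-degree (+ 1) j M<j) (ℤAlgebra.-‿cong R (Γ-degree (- + 1) j (subst (_< j) (≡.sym length-H) M<j)))))

    A₀≡2 : A 0 ≡ + 2
    A₀≡2 = const-injective (A 0) (+ 2) (trans (sym (U≈A 0))
      (trans (+-cong (prod-0 (map (λ a → pair (+ a)) (H (+ 1)))) (prod-0 (map (λ a → pair (+ a)) (H (- + 1))))) (sym (ι-+ (+ 1) (+ 1)))))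

    B₀≡0 : B 0 ≡ + 0
    B₀≡0 = multiple-zero (B 0) (trans (sym (V≈Bτ 0)) V₀)

    B₁≢0 : B 1 ≢ + 0
    B₁≢0 B₁≡0 = one≢0 (multiple-zero (- + 1) (begin
      const (- + 1) ⊗ τ   ≈⟨ mk≈ (λ k → ≡.trans (act-const⊗ (- + 1) τ w k) (≡.trans (ℤₚ.-1*i≡-i (act τ w k)) (≡.sym (act-⊖ w τ k)))) ⟩
      ⊖ τ                 ≈⟨ V₁ ⟨
      V 1                 ≈⟨ V≈Bτ 1 ⟩
      const (B 1) ⊗ τ     ≈⟨ *-congʳ {τ} (trans (reflexive (cong const B₁≡0)) ι-0) ⟩
      []                  ∎))
      where
      one≢0 : - + 1 ≢ + 0
      one≢0 ()

    all-pairs : ℕ → Elt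
    all-pairs = prod (map (λ a → pair (+ a)) H±)

    -- Both orders of multiplication give the product over all of `H±`, the linear factors being
    -- permutable.
    double-product : ∀ j → conv (Γ (+ 1)) (Γ (- + 1)) j ++ conv (Γ (- + 1)) (Γ (+ 1)) j ≈ const (+ 2) ⊗ all-pairs j
    double-product j = begin
      conv (Γ (+ 1)) (Γ (- + 1)) j ++ conv (Γ (- + 1)) (Γ (+ 1)) j
        ≈⟨ +-cong (conv-prod l₁ l₂ j) (trans (conv-prod l₂ l₁ j) (prod-↭ (↭ₚ.++-comm l₂ l₁) j)) ⟩
      prod (l₁ ++ l₂) j ++ prod (l₁ ++ l₂) j ≡⟨ cong (λ l → prod l j ++ prod l j) (Listₚ.map-++ (λ a → pair (+ a)) (H (+ 1)) (H (- + 1))) ⟨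
      all-pairs j ++ all-pairs j             ≈⟨ +-cong (*-identityˡ (all-pairs j)) (*-identityˡ (all-pairs j)) ⟨
      const (+ 1) ⊗ all-pairs j ++ const (+ 1) ⊗ all-pairs j ≈⟨ distribʳ (all-pairs j) (const (+ 1)) (const (+ 1)) ⟨
      (const (+ 1) ++ const (+ 1)) ⊗ all-pairs j ≈⟨ *-congʳ {all-pairs j} (ι-+ (+ 1) (+ 1)) ⟨
      const (+ 2) ⊗ all-pairs j              ∎
      where
      l₁ l₂ : List Elt
      l₁ = map (λ a → pair (+ a)) (H (+ 1))
      l₂ = map (λ a → pair (+ a)) (H (- + 1))

    four-pairs : ∀ j → const (+ 4) ⊗ all-pairs j ≈ const ((A *₁ A) j - + n * (B *₁ B) j)
    four-pairs j = begin
      const (+ 4) ⊗ all-pairs j                    ≈⟨ *-assoc (const (+ 2)) (const (+ 2)) (all-pairs j) ⟩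
      const (+ 2) ⊗ (const (+ 2) ⊗ all-pairs j)    ≈⟨ *-congˡ {const (+ 2)} (double-product j) ⟨
      const (+ 2) ⊗ (conv (Γ (+ 1)) (Γ (- + 1)) j ++ conv (Γ (- + 1)) (Γ (+ 1)) j) ≈⟨ conv-polar (Γ (+ 1)) (Γ (- + 1)) j ⟨
      conv U U j ++ ⊖ conv V V j                   ≈⟨ +-cong (conv-cong U≈A U≈A j) (ℤAlgebra.-‿cong R (conv-cong V≈Bτ V≈Bτ j)) ⟩
      conv (λ i → const (A i)) (λ i → const (A i)) j ++ ⊖ conv (λ i → const (B i) ⊗ τ) (λ i → const (B i) ⊗ τ) j
        ≈⟨ +-cong (sym (ι-conv R A A j)) (ℤAlgebra.-‿cong R (begin
             conv (λ i → const (B i) ⊗ τ) (λ i → const (B i) ⊗ τ) j ≈⟨ conv-scale τ (λ i → const (B i)) (λ i → const (B i)) j ⟩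
             conv (λ i → const (B i)) (λ i → const (B i)) j ⊗ (τ ⊗ τ) ≈⟨ *-cong (sym (ι-conv R B B j)) gauss ⟩
             const ((B *₁ B) j) ⊗ const (+ n) ≈⟨ ι-* ((B *₁ B) j) (+ n) ⟨
             const ((B *₁ B) j * + n)         ≡⟨ cong const (ℤₚ.*-comm ((B *₁ B) j) (+ n)) ⟩
             const (+ n * (B *₁ B) j)         ∎)) ⟩
      const ((A *₁ A) j) ++ ⊖ const (+ n * (B *₁ B) j) ≈⟨ +-congˡ {const ((A *₁ A) j)} (ι-neg (+ n * (B *₁ B) j)) ⟨
      const ((A *₁ A) j) ++ const (- (+ n * (B *₁ B) j)) ≈⟨ ι-+ ((A *₁ A) j) (- (+ n * (B *₁ B) j)) ⟨
      const ((A *₁ A) j - + n * (B *₁ B) j)            ∎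

  module _ (Φ : ℕ → Poly₁) (Φ-cyclotomic : IsCyclotomicFamily Φ) (γ : ℕ → ℤ) (lucas : IsLucasCoeffs Φ n γ) where
    open GammaProduct S Φ Φ-cyclotomic using (γ≈prod; γ-≤)

    private
      m : ℕ
      m = length H±

      lucas′ : Φ n ≈₁ LucasExpansion (m ℕ.+ m) γ
      lucas′ = subst (λ φ → Φ n ≈₁ LucasExpansion φ γ) totient-half lucas

      1≤M : 1 ≤ M
      1≤M = nonempty (H⁺ 1 (λ ()) (1≤h h n≡1+2h) χ-1)
        where
        1≤h : ∀ h → n ≡ suc (h ℕ.+ h) → 1 ≤ h
        1≤h zero    n≡1 = contradiction (subst (2 ≤_) n≡1 2≤n) (ℕₚ.<-irrefl refl)
        1≤h (suc h) _   = s≤s z≤n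

        nonempty : ∀ {a} {l : List ℕ} → a ∈ l → 1 ≤ length l
        nonempty (here _)  = s≤s z≤n
        nonempty (there _) = s≤s z≤n

    gaussFormula : GaussFormula n γ
    gaussFormula = record
      { M = M
      ; 1≤M = 1≤M
      ; totient≡4M = ≡.trans totient-half (cong₂ ℕ._+_ length-H± length-H±)
      ; A = A
      ; B = B
      ; A-degree = A-degree
      ; B-degree = B-degree
      ; A₀≢0 = λ A₀≡0 → two≢0 (≡.trans (≡.sym A₀≡2) A₀≡0)
      ; B₀≡0 = B₀≡0
      ; B₁≢0 = B₁≢0
      ; formula = λ j j≤2M → const-injective (+ 4 * γ j) ((A *₁ A) j - + n * (B *₁ B) j) (begin
          const (+ 4 * γ j)           ≈⟨ ι-* (+ 4) (γ j) ⟩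
          const (+ 4) ⊗ const (γ j)   ≈⟨ *-congˡ {const (+ 4)} (γ-≤ γ m lucas′ j (subst (j ≤_) (≡.sym length-H±) j≤2M)) ⟨
          _                           ≈⟨ *-congˡ {const (+ 4)} (γ≈prod γ m lucas′ H± refl H±! (λ a∈ → proj₂ (H±⁻ a∈)) H±-separated j) ⟩
          const (+ 4) ⊗ all-pairs j   ≈⟨ four-pairs j ⟩
          const ((A *₁ A) j - + n * (B *₁ B) j) ∎)
      }
      where
      two≢0 : + 2 ≢ + 0
      two≢0 ()

-- Bivariate polynomials: monomials and weighted-homogeneous forms.

Σ≤-single : ∀ n a {f} → a ≤ n → (∀ i → i ≢ a → f i ≡ + 0) → Σ≤ n f ≡ f a
Σ≤-single zero    zero    _   _   = refl
Σ≤-single (suc n) a {f} a≤n f≡0 with a ℕ.≟ suc n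
... | yes refl = ≡.trans (cong (_+ f (suc n)) (Σ≤-zero n (λ i i≤n → f≡0 i (ℕₚ.<⇒≢ (s≤s i≤n))))) (ℤₚ.+-identityˡ _)
... | no a≢1+n = ≡.trans (cong₂ _+_ (Σ≤-single n a (ℕ.s≤s⁻¹ (ℕₚ.≤∧≢⇒< a≤n a≢1+n)) f≡0) (f≡0 (suc n) (a≢1+n ∘ ≡.sym))) (ℤₚ.+-identityʳ _)

Σ≤-+ : ∀ n f g → Σ≤ n (λ i → f i + g i) ≡ Σ≤ n f + Σ≤ n g
Σ≤-+ zero    f g = refl
Σ≤-+ (suc n) f g = ≡.trans (cong (_+ (f (suc n) + g (suc n))) (Σ≤-+ n f g)) (eq (Σ≤ n f) (Σ≤ n g) (f (suc n)) (g (suc n)))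
  where
  eq : ∀ a b c d → a + b + (c + d) ≡ a + c + (b + d)
  eq = solve-∀

Σ≤-swap : ∀ m n (f : ℕ → ℕ → ℤ) → Σ≤ m (λ a → Σ≤ n (f a)) ≡ Σ≤ n (λ b → Σ≤ m (λ a → f a b))
Σ≤-swap zero    n f = refl
Σ≤-swap (suc m) n f = ≡.trans (cong (_+ Σ≤ n (f (suc m))) (Σ≤-swap m n f)) (≡.sym (Σ≤-+ n (λ b → Σ≤ m (λ a → f a b)) (f (suc m))))

Σ≤-* : ∀ n c f → Σ≤ n (λ i → c * f i) ≡ c * Σ≤ n f
Σ≤-* zero    c f = refl
Σ≤-* (suc n) c f = ≡.trans (cong (_+ c * f (suc n)) (Σ≤-* n c f)) (≡.sym (ℤₚ.*-distribˡ-+ c _ _))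

IsMono : Poly₂ → ℕ → ℕ → ℤ → Set
IsMono X a b c = X a b ≡ c × (∀ i j → i ≢ a ⊎ j ≢ b → X i j ≡ + 0)

*₂-zero : ∀ f g i j → (∀ a b → a ≤ i → b ≤ j → f a b * g (i ∸ a) (j ∸ b) ≡ + 0) → (f *₂ g) i j ≡ + 0
*₂-zero f g i j terms≡0 = Σ≤-zero i λ a a≤i → Σ≤-zero j λ b b≤j → terms≡0 a b a≤i b≤j

mono-* : ∀ {X a b c} → IsMono X a b c → ∀ f i j → a ≤ i → b ≤ j → (X *₂ f) i j ≡ c * f (i ∸ a) (j ∸ b)
mono-* {X} {a} {b} (X≡c , X≡0) f i j a≤i b≤j = ≡.trans
  (Σ≤-single i a a≤i (λ a′ a′≢a → Σ≤-zero j (λ b′ _ → vanish a′ b′ (inj₁ a′≢a))))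
  (≡.trans (Σ≤-single j b b≤j (λ b′ b′≢b → vanish a b′ (inj₂ b′≢b))) (cong (_* f (i ∸ a) (j ∸ b)) X≡c))
  where
  vanish : ∀ a′ b′ → a′ ≢ a ⊎ b′ ≢ b → X a′ b′ * f (i ∸ a′) (j ∸ b′) ≡ + 0
  vanish a′ b′ ne = ≡.trans (cong (_* f (i ∸ a′) (j ∸ b′)) (X≡0 a′ b′ ne)) (ℤₚ.*-zeroˡ (f (i ∸ a′) (j ∸ b′)))

mono-mono : ∀ {X Y a b c a′ b′ c′} → IsMono X a b c → IsMono Y a′ b′ c′ → IsMono (X *₂ Y) (a ℕ.+ a′) (b ℕ.+ b′) (c * c′)
mono-mono {X} {Y} {a} {b} {c} {a′} {b′} {c′} mX@(X≡c , X≡0) (Y≡c′ , Y≡0) =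
  ≡.trans (mono-* mX Y (a ℕ.+ a′) (b ℕ.+ b′) (ℕₚ.m≤m+n a a′) (ℕₚ.m≤m+n b b′))
    (cong (c *_) (≡.trans (cong₂ Y (ℕₚ.m+n∸m≡n a a′) (ℕₚ.m+n∸m≡n b b′)) Y≡c′)) ,
  λ i j ne → *₂-zero X Y i j λ e f e≤i f≤j → term i j ne e f e≤i f≤j
  where
  term : ∀ i j → i ≢ a ℕ.+ a′ ⊎ j ≢ b ℕ.+ b′ → ∀ e f → e ≤ i → f ≤ j → X e f * Y (i ∸ e) (j ∸ f) ≡ + 0
  term i j ne e f e≤i f≤j with e ℕ.≟ a | f ℕ.≟ b
  ... | no e≢a   | _        = ≡.trans (cong (_* Y (i ∸ e) (j ∸ f)) (X≡0 e f (inj₁ e≢a))) (ℤₚ.*-zeroˡ (Y (i ∸ e) (j ∸ f)))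
  ... | yes _    | no f≢b   = ≡.trans (cong (_* Y (i ∸ e) (j ∸ f)) (X≡0 e f (inj₂ f≢b))) (ℤₚ.*-zeroˡ (Y (i ∸ e) (j ∸ f)))
  ... | yes refl | yes refl = ≡.trans (cong (X e f *_) (Y≡0 (i ∸ e) (j ∸ f) (shift ne))) (ℤₚ.*-zeroʳ (X e f))
    where
    shift : i ≢ e ℕ.+ a′ ⊎ j ≢ f ℕ.+ b′ → i ∸ e ≢ a′ ⊎ j ∸ f ≢ b′
    shift (inj₁ i≢) = inj₁ λ { refl → i≢ (≡.sym (ℕₚ.m+[n∸m]≡n e≤i)) }
    shift (inj₂ j≢) = inj₂ λ { refl → j≢ (≡.sym (ℕₚ.m+[n∸m]≡n f≤j)) }

const-mono : ∀ c → IsMono (const₂ c) 0 0 c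
const-mono c = refl , λ { zero zero (inj₁ ne) → contradiction refl ne ; zero zero (inj₂ ne) → contradiction refl ne
                        ; zero (suc _) _ → refl ; (suc _) zero _ → refl ; (suc _) (suc _) _ → refl }

s-mono : IsMono s₂ 1 0 (+ 1)
s-mono = refl , λ { zero _ _ → refl ; (suc zero) zero (inj₁ ne) → contradiction refl ne ; (suc zero) zero (inj₂ ne) → contradiction refl ne
                  ; (suc zero) (suc _) _ → refl ; (suc (suc _)) _ _ → refl }

t-mono : IsMono t₂ 0 1 (+ 1)
t-mono = refl , λ { zero zero _ → refl ; zero (suc zero) (inj₁ ne) → contradiction refl ne ; zero (suc zero) (inj₂ ne) → contradiction refl ne
                  ; zero (suc (suc _)) _ → refl ; (suc _) _ _ → refl }

neg-mono : ∀ {X a b c} → IsMono X a b c → IsMono (neg₂ X) a b (- c)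
neg-mono (X≡c , X≡0) = cong -_ X≡c , λ i j ne → cong -_ (X≡0 i j ne)

sgn : ℕ → ℤ
sgn zero    = + 1
sgn (suc j) = - + 1 * sgn j

sgn-+ : ∀ i j → sgn (i ℕ.+ j) ≡ sgn i * sgn j
sgn-+ zero    j = ≡.sym (ℤₚ.*-identityˡ (sgn j))
sgn-+ (suc i) j = ≡.trans (cong (- + 1 *_) (sgn-+ i j)) (≡.sym (ℤₚ.*-assoc (- + 1) (sgn i) (sgn j)))

s-pow : ∀ k → IsMono (s₂ ^₂ k) k 0 (+ 1)
s-pow zero    = const-mono (+ 1)
s-pow (suc k) = mono-mono s-mono (s-pow k)

t-pow : ∀ k → IsMono (neg₂ t₂ ^₂ k) 0 k (sgn k)
t-pow zero    = const-mono (+ 1)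
t-pow (suc k) = mono-mono (neg-mono t-mono) (t-pow k)

const-* : ∀ c f i j → (const₂ c *₂ f) i j ≡ c * f i j
const-* c f i j = mono-* (const-mono c) f i j z≤n z≤n

-- Weighted-homogeneous polynomials Σ_j α_j s^(d - 2j) (-t)^j.

pick : ∀ {p} {P : Set p} → Dec P → ℤ → ℤ
pick (yes _) a = a
pick (no _)  a = + 0

pick-yes : ∀ {p} {P : Set p} (P? : Dec P) {a} → P → pick P? a ≡ a
pick-yes (yes _) _ = refl
pick-yes (no ¬p) p = contradiction p ¬p

pick-no : ∀ {p} {P : Set p} (P? : Dec P) {a} → ¬ P → pick P? a ≡ + 0
pick-no (yes p) ¬p = contradiction p ¬p
pick-no (no _)  _  = refl

pick-0 : ∀ {p} {P : Set p} (P? : Dec P) {a} → a ≡ + 0 → pick P? a ≡ + 0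
pick-0 (yes _) a≡0 = a≡0
pick-0 (no _)  _   = refl

hom : ℕ → (ℕ → ℤ) → Poly₂
hom d α i j = pick (i ℕ.+ (j ℕ.+ j) ℕ.≟ d) (sgn j * α j)

hom-yes : ∀ {d} α i j → i ℕ.+ (j ℕ.+ j) ≡ d → hom d α i j ≡ sgn j * α j
hom-yes {d} α i j = pick-yes (i ℕ.+ (j ℕ.+ j) ℕ.≟ d)

hom-no : ∀ {d} α i j → i ℕ.+ (j ℕ.+ j) ≢ d → hom d α i j ≡ + 0
hom-no {d} α i j = pick-no (i ℕ.+ (j ℕ.+ j) ℕ.≟ d)

hom-0 : ∀ {d} α i j → α j ≡ + 0 → hom d α i j ≡ + 0
hom-0 {d} α i j αj≡0 = pick-0 (i ℕ.+ (j ℕ.+ j) ℕ.≟ d) (≡.trans (cong (sgn j *_) αj≡0) (ℤₚ.*-zeroʳ (sgn j)))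

hom-large : ∀ {d i} α → d < i → ∀ j → hom d α i j ≡ + 0
hom-large {i = i} α d<i j = hom-no α i j (λ eq → ℕₚ.<⇒≱ d<i (ℕₚ.≤-trans (ℕₚ.m≤m+n _ (j ℕ.+ j)) (ℕₚ.≤-reflexive eq)))

hom-large′ : ∀ {d j} α → d < j → ∀ i → hom d α i j ≡ + 0
hom-large′ {j = j} α d<j i = hom-no α i j (λ eq → ℕₚ.<⇒≱ d<j (ℕₚ.≤-trans (ℕₚ.≤-trans (ℕₚ.m≤m+n j j) (ℕₚ.m≤n+m (j ℕ.+ j) i)) (ℕₚ.≤-reflexive eq)))

double-≤ : ∀ {a b} → a ℕ.+ a ≤ b ℕ.+ b → a ≤ b
double-≤ {a} {b} 2a≤2b with a ℕₚ.≤? b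
... | yes a≤b = a≤b
... | no a≰b  = contradiction 2a≤2b (ℕₚ.<⇒≱ (ℕₚ.+-mono-< (ℕₚ.≰⇒> a≰b) (ℕₚ.≰⇒> a≰b)))

-- With s of weight 1 and t of weight 2, the square of a form of weight d has weight 2d, and for
-- each b exactly one power of s, s^(d-2b), accompanies t^b. The Cauchy product also runs over
-- indices above M = d/2, which a form of weight d cannot contain; there α has to vanish.
hom-square : ∀ M α → (∀ j → M < j → α j ≡ + 0) → ∀ i j →
  (hom (M ℕ.+ M) α *₂ hom (M ℕ.+ M) α) i j ≡ hom ((M ℕ.+ M) ℕ.+ (M ℕ.+ M)) (α *₁ α) i j
hom-square M α deg i j = by-degree (i ℕ.+ (j ℕ.+ j) ℕ.≟ (d ℕ.+ d))
  where
  d : ℕ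
  d = M ℕ.+ M

  E : Poly₂
  E = hom d α

  split : ∀ {a b} → a ≤ i → b ≤ j → i ℕ.+ (j ℕ.+ j) ≡ (a ℕ.+ (b ℕ.+ b)) ℕ.+ ((i ∸ a) ℕ.+ ((j ∸ b) ℕ.+ (j ∸ b)))
  split {a} {b} a≤i b≤j = ≡.trans (cong₂ (λ x y → x ℕ.+ (y ℕ.+ y)) (≡.sym (ℕₚ.m+[n∸m]≡n a≤i)) (≡.sym (ℕₚ.m+[n∸m]≡n b≤j)))
    (eq a (i ∸ a) b (j ∸ b))
    where
    eq : ∀ a x b y → (a ℕ.+ x) ℕ.+ ((b ℕ.+ y) ℕ.+ (b ℕ.+ y)) ≡ (a ℕ.+ (b ℕ.+ b)) ℕ.+ (x ℕ.+ (y ℕ.+ y))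
    eq = ℕ-Ring.solve-∀

  row : i ℕ.+ (j ℕ.+ j) ≡ d ℕ.+ d → ∀ b → b ≤ j → Σ≤ i (λ a → E a b * E (i ∸ a) (j ∸ b)) ≡ sgn j * (α b * α (j ∸ b))
  row total b b≤j with b ℕₚ.≤? M | (j ∸ b) ℕₚ.≤? M
  ... | no b≰M | _ = ≡.trans
        (Σ≤-zero i (λ a _ → ≡.trans (cong (_* E (i ∸ a) (j ∸ b)) (hom-0 α a b αb≡0)) (ℤₚ.*-zeroˡ (E (i ∸ a) (j ∸ b)))))
        (≡.sym (≡.trans (cong (λ x → sgn j * (x * α (j ∸ b))) αb≡0) (eq (sgn j) (α (j ∸ b)))))
    where
    αb≡0 : α b ≡ + 0
    αb≡0 = deg b (ℕₚ.≰⇒> b≰M)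
    eq : ∀ s a → s * (+ 0 * a) ≡ + 0
    eq = solve-∀
  ... | yes _ | no c≰M = ≡.trans
        (Σ≤-zero i (λ a _ → ≡.trans (cong (E a b *_) (hom-0 α (i ∸ a) (j ∸ b) αc≡0)) (ℤₚ.*-zeroʳ (E a b))))
        (≡.sym (≡.trans (cong (λ x → sgn j * (α b * x)) αc≡0) (eq (sgn j) (α b))))
    where
    αc≡0 : α (j ∸ b) ≡ + 0
    αc≡0 = deg (j ∸ b) (ℕₚ.≰⇒> c≰M)
    eq : ∀ s a → s * (a * + 0) ≡ + 0
    eq = solve-∀
  ... | yes b≤M | yes c≤M = ≡.trans
        (Σ≤-single i a a≤i (λ a′ a′≢a → ≡.trans (cong (_* E (i ∸ a′) (j ∸ b)) (hom-no α a′ b (λ eq → a′≢a (≡.trans (≡.sym (ℕₚ.m+n∸n≡m a′ (b ℕ.+ b))) (cong (_∸ (b ℕ.+ b)) eq)))))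
           (ℤₚ.*-zeroˡ (E (i ∸ a′) (j ∸ b)))))
        (≡.trans (cong₂ _*_ (hom-yes α a b a+2b≡d) (hom-yes α (i ∸ a) (j ∸ b) rest≡d))
        (≡.trans (eq (sgn b) (α b) (sgn (j ∸ b)) (α (j ∸ b))) (cong (_* (α b * α (j ∸ b)))
          (≡.trans (≡.sym (sgn-+ b (j ∸ b))) (cong sgn (ℕₚ.m+[n∸m]≡n b≤j))))))
    where
    a : ℕ
    a = d ∸ (b ℕ.+ b)

    a+2b≡d : a ℕ.+ (b ℕ.+ b) ≡ d
    a+2b≡d = ℕₚ.m∸n+n≡m (ℕₚ.+-mono-≤ b≤M b≤M)

    c : ℕ
    c = j ∸ b

    2j≡ : j ℕ.+ j ≡ (b ℕ.+ b) ℕ.+ (c ℕ.+ c)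
    2j≡ = ≡.trans (cong (λ x → x ℕ.+ x) (≡.sym (ℕₚ.m+[n∸m]≡n b≤j))) (alg b c)
      where
      alg : ∀ b c → (b ℕ.+ c) ℕ.+ (b ℕ.+ c) ≡ (b ℕ.+ b) ℕ.+ (c ℕ.+ c)
      alg = ℕ-Ring.solve-∀

    -- As i + 2j = 2d and j = b + c, i = (d - 2b) + (d - 2c), where 2c ≤ d.
    a≤i : a ≤ i
    a≤i = ℕₚ.+-cancelʳ-≤ (j ℕ.+ j) a i (ℕₚ.≤-trans (ℕₚ.≤-reflexive (≡.trans (cong (a ℕ.+_) 2j≡)
            (≡.trans (≡.sym (ℕₚ.+-assoc a (b ℕ.+ b) (c ℕ.+ c))) (cong (ℕ._+ (c ℕ.+ c)) a+2b≡d))))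
          (ℕₚ.≤-trans (ℕₚ.+-monoʳ-≤ d (ℕₚ.+-mono-≤ c≤M c≤M)) (ℕₚ.≤-reflexive (≡.sym total))))

    rest≡d : (i ∸ a) ℕ.+ (c ℕ.+ c) ≡ d
    rest≡d = ℕₚ.+-cancelˡ-≡ d _ _ (≡.trans (≡.sym (≡.trans (split a≤i b≤j) (cong (ℕ._+ ((i ∸ a) ℕ.+ (c ℕ.+ c))) a+2b≡d))) total)

    eq : ∀ s x t y → s * x * (t * y) ≡ s * t * (x * y)
    eq = solve-∀

  by-degree : Dec (i ℕ.+ (j ℕ.+ j) ≡ d ℕ.+ d) → (E *₂ E) i j ≡ hom (d ℕ.+ d) (α *₁ α) i j
  by-degree (yes total) = ≡.trans (Σ≤-swap i j (λ a b → E a b * E (i ∸ a) (j ∸ b)))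
    (≡.trans (Σ≤-cong j (row total)) (≡.trans (Σ≤-* j (sgn j) (λ b → α b * α (j ∸ b))) (≡.sym (hom-yes (α *₁ α) i j total))))
  by-degree (no ≢total) = ≡.trans (*₂-zero E E i j term) (≡.sym (hom-no (α *₁ α) i j ≢total))
    where
    term : ∀ a b → a ≤ i → b ≤ j → E a b * E (i ∸ a) (j ∸ b) ≡ + 0
    term a b a≤i b≤j with a ℕ.+ (b ℕ.+ b) ℕ.≟ d | (i ∸ a) ℕ.+ ((j ∸ b) ℕ.+ (j ∸ b)) ℕ.≟ d
    ... | no _   | _      = refl
    ... | yes _  | no _   = ℤₚ.*-zeroʳ (sgn b * α b)
    ... | yes p  | yes q  = contradiction (≡.trans (split a≤i b≤j) (cong₂ ℕ._+_ p q)) ≢total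

lucasAtom-hom : ∀ n γ m → totient n ≡ m ℕ.+ m → LucasAtom n γ ≈₂ hom (m ℕ.+ m) γ
lucasAtom-hom n γ m φ≡2m i j = ≡.trans (cong (λ φ → atom φ i j) φ≡2m) (by-degree (i ℕ.+ (j ℕ.+ j) ℕ.≟ (m ℕ.+ m)))
  where
  term : ℕ → ℕ → Poly₂
  term φ k = const₂ (γ k) *₂ ((s₂ ^₂ (φ ∸ 2 ℕ.* k)) *₂ (neg₂ t₂ ^₂ k))

  atom : ℕ → Poly₂
  atom φ = Σ₂ (φ / 2) (term φ)

  2*≡ : ∀ k → 2 ℕ.* k ≡ k ℕ.+ k
  2*≡ k = cong (k ℕ.+_) (ℕₚ.+-identityʳ k)

  term-mono : ∀ k → IsMono (term (m ℕ.+ m) k) (m ℕ.+ m ∸ 2 ℕ.* k ℕ.+ 0) k (γ k * (+ 1 * sgn k))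
  term-mono k = mono-mono (const-mono (γ k)) (mono-mono (s-pow (m ℕ.+ m ∸ 2 ℕ.* k)) (t-pow k))

  eq : ∀ g s → g * (+ 1 * s) ≡ s * g
  eq = solve-∀

  by-degree : Dec (i ℕ.+ (j ℕ.+ j) ≡ m ℕ.+ m) → atom (m ℕ.+ m) i j ≡ hom (m ℕ.+ m) γ i j
  by-degree (yes total) = ≡.trans (cong (λ h → Σ₂ h (term (m ℕ.+ m)) i j) (half-double m))
    (≡.trans (Σ≤-single m j (double-≤ (ℕₚ.≤-trans (ℕₚ.m≤n+m (j ℕ.+ j) i) (ℕₚ.≤-reflexive total)))
      (λ k k≢j → proj₂ (term-mono k) i j (inj₂ (k≢j ∘ ≡.sym))))
    (≡.trans (cong (λ x → term (m ℕ.+ m) j x j) i≡)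
    (≡.trans (proj₁ (term-mono j)) (≡.trans (eq (γ j) (sgn j)) (≡.sym (hom-yes γ i j total))))))
    where
    i≡ : i ≡ m ℕ.+ m ∸ 2 ℕ.* j ℕ.+ 0
    i≡ = ≡.sym (≡.trans (ℕₚ.+-identityʳ _) (≡.trans (cong₂ _∸_ (≡.sym total) (2*≡ j)) (ℕₚ.m+n∸n≡m i (j ℕ.+ j))))
  by-degree (no ≢total) = ≡.trans (cong (λ h → Σ₂ h (term (m ℕ.+ m)) i j) (half-double m))
    (≡.trans (Σ≤-zero m (λ k k≤m → proj₂ (term-mono k) i j (off k k≤m))) (≡.sym (hom-no γ i j ≢total)))
    where
    off : ∀ k → k ≤ m → i ≢ m ℕ.+ m ∸ 2 ℕ.* k ℕ.+ 0 ⊎ j ≢ k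
    off k k≤m with j ℕ.≟ k
    ... | no j≢k   = inj₂ j≢k
    ... | yes refl = inj₁ λ i≡ → ≢total (≡.trans (cong (ℕ._+ (j ℕ.+ j)) (≡.trans i≡ (≡.trans (ℕₚ.+-identityʳ _) (cong (m ℕ.+ m ∸_) (2*≡ j)))))
                       (ℕₚ.m∸n+n≡m (ℕₚ.+-mono-≤ k≤m k≤m)))

-- Without terms in t^0, G is t times its shift F, so G² = t² F². In t-degrees 0 and 1 both sides
-- vanish; in degree j + 2 the first and last summands of G² drop out and the others are those of F²
-- in degree j.
t²-square : ∀ (G : Poly₂) → (∀ i → G i 0 ≡ + 0) → ∀ i j →
  ((t₂ *₂ t₂) *₂ ((λ i j → G i (suc j)) *₂ (λ i j → G i (suc j)))) i j ≡ (G *₂ G) i j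
t²-square G G0≡0 i zero = ≡.trans
  (Σ≤-zero i λ a _ → ≡.trans (cong (_* ((λ i j → G i (suc j)) *₂ (λ i j → G i (suc j))) (i ∸ a) 0)
     (proj₂ (mono-mono t-mono t-mono) a 0 (inj₂ λ ()))) (ℤₚ.*-zeroˡ (((λ i j → G i (suc j)) *₂ (λ i j → G i (suc j))) (i ∸ a) 0)))
  (≡.sym (Σ≤-zero i λ a _ → ≡.trans (cong (_* G (i ∸ a) 0) (G0≡0 a)) (ℤₚ.*-zeroˡ (G (i ∸ a) 0))))
t²-square G G0≡0 i (suc zero) = ≡.trans
  (*₂-zero (t₂ *₂ t₂) F² i 1 λ a b _ b≤1 → ≡.trans (cong (_* F² (i ∸ a) (1 ∸ b))
     (proj₂ (mono-mono t-mono t-mono) a b (inj₂ (ℕₚ.<⇒≢ (s≤s b≤1))))) (ℤₚ.*-zeroˡ (F² (i ∸ a) (1 ∸ b))))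
  (≡.sym (Σ≤-zero i λ a _ → cong₂ _+_
    (≡.trans (cong (_* G (i ∸ a) 1) (G0≡0 a)) (ℤₚ.*-zeroˡ (G (i ∸ a) 1)))
    (≡.trans (cong (G a 1 *_) (G0≡0 (i ∸ a))) (ℤₚ.*-zeroʳ (G a 1)))))
  where
  F² : Poly₂
  F² = (λ i j → G i (suc j)) *₂ (λ i j → G i (suc j))
t²-square G G0≡0 i (suc (suc j)) = ≡.trans (mono-* (mono-mono t-mono t-mono) F² i (suc (suc j)) z≤n (s≤s (s≤s z≤n)))
  (≡.trans (ℤₚ.*-identityˡ (F² i j)) (Σ≤-cong i λ a _ → ≡.sym (row a)))
  where
  F² : Poly₂
  F² = (λ i j → G i (suc j)) *₂ (λ i j → G i (suc j))

  row : ∀ a → Σ≤ (suc (suc j)) (λ b → G a b * G (i ∸ a) (suc (suc j) ∸ b)) ≡ Σ≤ j (λ b → G a (suc b) * G (i ∸ a) (suc (j ∸ b)))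
  row a = ≡.trans (Σ≤-suc (suc j) (λ b → G a b * G (i ∸ a) (suc (suc j) ∸ b)))
    (≡.trans (cong₂ _+_ first (cong₂ _+_ (Σ≤-cong j (λ b b≤j → cong (λ x → G a (suc b) * G (i ∸ a) x) (ℕₚ.+-∸-assoc 1 b≤j))) last-term))
      (eq (Σ≤ j (λ b → G a (suc b) * G (i ∸ a) (suc (j ∸ b))))))
    where
    first : G a 0 * G (i ∸ a) (suc (suc j)) ≡ + 0
    first = ≡.trans (cong (_* G (i ∸ a) (suc (suc j))) (G0≡0 a)) (ℤₚ.*-zeroˡ (G (i ∸ a) (suc (suc j))))
    last-term : G a (suc (suc j)) * G (i ∸ a) (suc j ∸ suc j) ≡ + 0
    last-term = ≡.trans (cong (λ x → G a (suc (suc j)) * G (i ∸ a) x) (ℕₚ.n∸n≡0 j))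
      (≡.trans (cong (G a (suc (suc j)) *_) (G0≡0 (i ∸ a))) (ℤₚ.*-zeroʳ (G a (suc (suc j)))))
    eq : ∀ a → + 0 + (a + + 0) ≡ a
    eq = solve-∀

-- The polynomials E and F, with G = t F, and their degrees in s.

module LucasAtomFormula {n : ℕ} {γ : ℕ → ℤ} (gf : GaussFormula n γ) where
  open GaussFormula gf

  d : ℕ
  d = M ℕ.+ M

  2≤d : 2 ≤ d
  2≤d = ℕₚ.+-mono-≤ 1≤M 1≤M

  half-totient : totient n / 2 ≡ d
  half-totient = ≡.trans (cong (_/ 2) totient≡4M) (half-double d)

  E G F : Poly₂
  E = hom d A
  G = hom d B
  F i j = G i (suc j)

  E-poly : IsPoly₂ E
  E-poly = suc d , λ i j → (λ d<i → hom-large A d<i j) , (λ d<j → hom-large′ A d<j i)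

  F-poly : IsPoly₂ F
  F-poly = suc d , λ i j → (λ d<i → hom-large B d<i (suc j)) , (λ d<j → hom-large′ B (ℕₚ.m<n⇒m<1+n d<j) i)

  E-degree : SDeg E d
  E-degree = (0 , λ E≡0 → A₀≢0 (≡.trans (≡.sym (ℤₚ.*-identityˡ (A 0))) (≡.trans (≡.sym (hom-yes A d 0 (ℕₚ.+-identityʳ d))) E≡0))) ,
    λ i j d<i → hom-large A d<i j

  F-degree : SDeg F (d ∸ 2)
  -- The coefficient of s^(d-2) t^0 in F is that of s^(d-2) t in G, namely -B_1. A term s^i t^j of F
  -- has i + 2(j + 1) = d, so no larger power of s occurs.
  F-degree = (0 , λ F≡0 → B₁≢0 (≡.trans (alg (B 1)) (cong (- + 1 *_) (≡.trans (≡.sym (hom-yes B (d ∸ 2) 1 (ℕₚ.m∸n+n≡m 2≤d))) F≡0)))) ,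
    λ i j d-2<i → hom-no B i (suc j) λ eq → ℕₚ.<⇒≱ d-2<i (ℕₚ.m+n≤o⇒m≤o∸n i
      (ℕₚ.≤-trans (ℕₚ.+-monoʳ-≤ i (s≤s (ℕₚ.≤-trans (s≤s z≤n) (ℕₚ.m≤n+m (suc j) j)))) (ℕₚ.≤-reflexive eq)))
    where
    alg : ∀ b → b ≡ - + 1 * (- + 1 * + 1 * b)
    alg = solve-∀

  identity : (const₂ (+ 4) *₂ LucasAtom n γ) ≈₂ ((E *₂ E) -₂ (const₂ (+ n) *₂ ((t₂ *₂ t₂) *₂ (F *₂ F))))
  identity i j = begin
    (const₂ (+ 4) *₂ LucasAtom n γ) i j   ≡⟨ const-* (+ 4) (LucasAtom n γ) i j ⟩
    + 4 * LucasAtom n γ i j               ≡⟨ cong (+ 4 *_) (lucasAtom-hom n γ d totient≡4M i j) ⟩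
    + 4 * hom (d ℕ.+ d) γ i j             ≡⟨ compare (i ℕ.+ (j ℕ.+ j) ℕ.≟ d ℕ.+ d) ⟩
    hom (d ℕ.+ d) (A *₁ A) i j - + n * hom (d ℕ.+ d) (B *₁ B) i j
      ≡⟨ cong₂ (λ x y → x - + n * y) (hom-square M A A-degree i j) (hom-square M B B-degree i j) ⟨
    (E *₂ E) i j - + n * (G *₂ G) i j     ≡⟨ cong (λ x → (E *₂ E) i j - + n * x) (t²-square G (λ i → hom-0 B i 0 B₀≡0) i j) ⟨
    (E *₂ E) i j - + n * ((t₂ *₂ t₂) *₂ (F *₂ F)) i j
      ≡⟨ cong (_-_ ((E *₂ E) i j)) (const-* (+ n) ((t₂ *₂ t₂) *₂ (F *₂ F)) i j) ⟨
    (E *₂ E) i j - (const₂ (+ n) *₂ ((t₂ *₂ t₂) *₂ (F *₂ F))) i j ∎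
    where
    open ≡.≡-Reasoning

    compare : Dec (i ℕ.+ (j ℕ.+ j) ≡ d ℕ.+ d) →
      + 4 * hom (d ℕ.+ d) γ i j ≡ hom (d ℕ.+ d) (A *₁ A) i j - + n * hom (d ℕ.+ d) (B *₁ B) i j
    compare (no ≢total) = ≡.trans (cong (+ 4 *_) (hom-no γ i j ≢total)) (≡.sym (≡.trans
      (cong₂ (λ x y → x - + n * y) (hom-no (A *₁ A) i j ≢total) (hom-no (B *₁ B) i j ≢total)) (alg (+ n))))
      where
      alg : ∀ n → + 0 - n * + 0 ≡ + 0
      alg = solve-∀
    compare (yes total) = begin
      + 4 * hom (d ℕ.+ d) γ i j                      ≡⟨ cong (+ 4 *_) (hom-yes γ i j total) ⟩
      + 4 * (sgn j * γ j)                            ≡⟨ alg₁ (sgn j) (γ j) ⟩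
      sgn j * (+ 4 * γ j)                            ≡⟨ cong (sgn j *_) (formula j (double-≤ (ℕₚ.≤-trans (ℕₚ.m≤n+m (j ℕ.+ j) i) (ℕₚ.≤-reflexive total)))) ⟩
      sgn j * ((A *₁ A) j - + n * (B *₁ B) j)        ≡⟨ alg₂ (sgn j) ((A *₁ A) j) (+ n) ((B *₁ B) j) ⟩
      sgn j * (A *₁ A) j - + n * (sgn j * (B *₁ B) j) ≡⟨ cong₂ (λ x y → x - + n * y) (hom-yes (A *₁ A) i j total) (hom-yes (B *₁ B) i j total) ⟨
      hom (d ℕ.+ d) (A *₁ A) i j - + n * hom (d ℕ.+ d) (B *₁ B) i j ∎
      where
      alg₁ : ∀ s g → + 4 * (s * g) ≡ s * (+ 4 * g)
      alg₁ = solve-∀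
      alg₂ : ∀ s a n b → s * (a - n * b) ≡ s * a - n * (s * b)
      alg₂ = solve-∀

-- Square-free n congruent to 1 modulo 4.

module OddSquareFree (n : ℕ) (5≤n : 5 ≤ n) (squareFree : SquareFree n) (n%4≡1 : n % 4 ≡ 1) where

  private
    instance
      n≢0 : ℕ.NonZero n
      n≢0 = ℕ.>-nonZero (ℕₚ.≤-trans (s≤s z≤n) 5≤n)

    2≤n : 2 ≤ n
    2≤n = ℕₚ.≤-trans (s≤s (s≤s z≤n)) 5≤n

    open PrimeFactorisation (factorise n) renaming (factors to ps; isFactorisation to n≡product; factorsPrime to pps)

    ps! : Unique ps
    ps! = squareFree⇒Unique ps pps λ p pp p²∣ → squareFree p pp (subst (p ℕ.* p ℕ∣.∣_) (≡.sym n≡product) p²∣)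

    2∤n : ¬ 2 ℕ∣.∣ n
    2∤n 2∣n = ℕ∣.>⇒∤ {1} {2} (s≤s (s≤s z≤n)) (ℕ∣.∣m+n∣m⇒∣n
      (subst (2 ℕ∣.∣_) (≡.trans (m≡m%n+[m/n]*n n 4) (≡.trans (cong (ℕ._+ n / 4 ℕ.* 4) n%4≡1) (ℕₚ.+-comm 1 (n / 4 ℕ.* 4)))) 2∣n)
      (ℕ∣.∣n⇒∣m*n (n / 4) (ℕ∣.divides 2 refl)))

    symbols : Symbols ps
    symbols = All.tabulate λ p∈ → legendreSymbol (All.lookup pps p∈) λ 2∣p →
      2∤n (ℕ∣.∣-trans 2∣p (subst (_ ℕ∣.∣_) (≡.sym n≡product) (ListAction.∈⇒∣product p∈)))

    -- χ(-1) ≡ n ≡ 1 modulo 4, and among -1, 0, 1 only 1 satisfies this.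
    jacobi-neg : jacobi symbols (- + 1) ≡ + 1
    jacobi-neg = by-sign (jacobi-sign symbols (- + 1)) (∣-by₂ (- + 1) (+ 1) (jacobi-neg-1 symbols) 4∣n-1
      (alg (+ product ps) (jacobi symbols (- + 1))))
      where
      4∣n-1 : + 4 ∣ + product ps - + 1
      4∣n-1 = subst (λ m → + 4 ∣ + m - + 1) n≡product (divides (+ (n / 4))
        (≡.trans (cong (λ m → + m - + 1) (≡.trans (m≡m%n+[m/n]*n n 4) (cong (ℕ._+ n / 4 ℕ.* 4) n%4≡1)))
          (≡.trans (alg₁ (+ (n / 4 ℕ.* 4))) (ℤₚ.pos-* (n / 4) 4))))
        where
        alg₁ : ∀ a → + 1 + a - + 1 ≡ a
        alg₁ = solve-∀

      alg : ∀ n j → j - + 1 ≡ - + 1 * (n - j) + + 1 * (n - + 1)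
      alg = solve-∀

      by-sign : ∀ {z} → Sign z → + 4 ∣ z - + 1 → z ≡ + 1
      by-sign plus  _  = refl
      by-sign zero  4∣ = contradiction (∣⇒∣ᵤ 4∣) (ℕ∣.>⇒∤ (s≤s (s≤s z≤n)))
      by-sign minus 4∣ = contradiction (∣⇒∣ᵤ 4∣) (ℕ∣.>⇒∤ (s≤s (s≤s (s≤s z≤n))))

  gauss-formula : ∀ Φ → IsCyclotomicFamily Φ → ∀ γ → IsLucasCoeffs Φ n γ → GaussFormula n γ
  gauss-formula Φ Φ-cyclotomic γ lucas with odd-half n 2∤n 2≤n
  ... | h , n≡1+2h = Descended.gaussFormula modulus Φ Φ-cyclotomic γ lucas
    where
    modulus : Modulus
    modulus = record
      { pps = pps ; ps! = ps! ; n = n ; n≡ = ≡.sym n≡product ; 2≤n = 2≤n ; h = suc h ; n≡1+2h = n≡1+2h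
      ; ss = symbols ; jacobi-neg = jacobi-neg }

theorem4p4 : (Φ : ℕ → Poly₁) → IsCyclotomicFamily Φ →
    (n : ℕ) → 5 ≤ n → SquareFree n → n % 4 ≡ 1 →
    (γ : ℕ → ℤ) → IsLucasCoeffs Φ n γ →
    Σ Poly₂ λ E → Σ Poly₂ λ F →
      IsPoly₂ E × IsPoly₂ F ×
      (const₂ (+ 4) *₂ LucasAtom n γ)
        ≈₂ ((E *₂ E) -₂ (const₂ (+ n) *₂ ((t₂ *₂ t₂) *₂ (F *₂ F)))) ×
      SDeg E (totient n / 2) × SDeg F (totient n / 2 ∸ 2)
theorem4p4 Φ Φ-cyclotomic n 5≤n squareFree n%4≡1 γ lucas =
  E , F , E-poly , F-poly , identity ,
  subst (SDeg E) (≡.sym half-totient) E-degree ,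
  subst (SDeg F) (cong (_∸ 2) (≡.sym half-totient)) F-degree
  where open LucasAtomFormula (OddSquareFree.gauss-formula n 5≤n squareFree n%4≡1 Φ Φ-cyclotomic γ lucas)
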